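{- Let $p$ and $q$ be odd primes with $p \neq 3$, and let $k$ be a positive integer with $p^k \equiv 1 \pmod{q}$. Let $B$ be an abelian group of odd order with $3 \nmid |B|$ and $p \nmid |B|$. Let $\alpha$ be an automorphism of $\mathbb{Z}_p^k \times B$ of order $q$ such that its restriction $\alpha|_{\mathbb{Z}_p^k}$ to the subgroup $\mathbb{Z}_p^k$ (viewed as an element of $\mathrm{GL}(k,p)$) has order $q$ and is not diagonalisable. Then $G = \mathbb{Z}_q \ltimes_\alpha (\mathbb{Z}_p^k \times B)$ is sequenceable. -}

module Defs where

open import Data.Nat as ℕ using (ℕ; zero; suc)
open import Data.Nat.DivMod using (_mod_)
open import Data.Fin using (Fin; zero; suc; toℕ)
open import Data.Vec using (Vec; []; _∷_; zipWith; map; replicate)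
open import Data.Product using (Σ; _×_; _,_; proj₁; proj₂)
open import Function using (_∘_)
open import Function.Bundles using (_↔_)
open import Function.Definitions using (Bijective)
open import Relation.Binary.PropositionalEquality using (_≡_)
open import Relation.Nullary using (¬_)
open import Data.Empty using (⊥)
open import Algebra.Structures using (IsAbelianGroup)

_+ᶠ_ : ∀ {n} → Fin n → Fin n → Fin n
_+ᶠ_ {suc n} a b = (toℕ a ℕ.+ toℕ b) mod suc n

_*ᶠ_ : ∀ {n} → Fin n → Fin n → Fin n
_*ᶠ_ {suc n} a b = (toℕ a ℕ.* toℕ b) mod suc n

Vp : ℕ → ℕ → Set
Vp p k = Vec (Fin p) k

_⊕_ : ∀ {p k} → Vp p k → Vp p k → Vp p k
_⊕_ = zipWith _+ᶠ_

_⊙_ : ∀ {p k} → Fin p → Vp p k → Vp p k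
c ⊙ v = map (c *ᶠ_) v

-- the zero vector (only needed for p ≥ 1, which holds for primes)
0V : ∀ {p k} → Fin p → Vp p k
0V {k = k} z = replicate k z

lincomb : ∀ {p k m} → Vp p k → Vec (Fin p) m → (Fin m → Vp p k) → Vp p k
lincomb z [] e = z
lincomb z (c ∷ cs) e = (c ⊙ e zero) ⊕ lincomb z cs (e ∘ suc)

Diagonalisable : (p k : ℕ) → (Vp p k → Vp p k) → Set
-- (p = 0 never occurs below since p is prime; the clause is a dummy)
Diagonalisable zero k f = ⊥
Diagonalisable (suc p) k f =
  Σ (Fin k → Vp (suc p) k) λ e →
  Σ (Fin k → Fin (suc p)) λ λs →
    (∀ i → f (e i) ≡ λs i ⊙ e i)
    × Bijective _≡_ _≡_ (λ (c : Vec (Fin (suc p)) k) → lincomb (0V zero) c e)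

iter : ∀ {A : Set} → (A → A) → ℕ → A → A
iter f zero x = x
iter f (suc n) x = f (iter f n x)

HasOrder : ∀ {A : Set} → (A → A) → ℕ → Set
HasOrder f n = (∀ x → iter f n x ≡ x)
             × (∀ m → 0 ℕ.< m → m ℕ.< n → ¬ (∀ x → iter f m x ≡ x))

record FinAbGroup : Set₁ where
  field
    Carrier        : Set
    _∙_            : Carrier → Carrier → Carrier
    ε              : Carrier
    _⁻¹            : Carrier → Carrier
    isAbelianGroup : IsAbelianGroup _≡_ _∙_ ε _⁻¹
    order          : ℕ
    enumeration    : Fin order ↔ Carrier

module _ (p k : ℕ) (B : FinAbGroup) where
  open FinAbGroup B

  H : Set
  H = Vp p k × Carrier

  _·H_ : H → H → H
  (v , b) ·H (w , c) = (v ⊕ w , b ∙ c)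

  IsAutomorphism : (H → H) → Set
  IsAutomorphism α = (∀ x y → α (x ·H y) ≡ α x ·H α y) × Bijective _≡_ _≡_ α

  restrict : (H → H) → Vp p k → Vp p k
  restrict α v = proj₁ (α (v , ε))

  SD : ℕ → Set
  SD q = H × Fin q

  sdMul : (q : ℕ) → (H → H) → SD q → SD q → SD q
  sdMul q α (h , i) (h' , j) = (h ·H iter α (toℕ i) h' , i +ᶠ j)

partialsFrom : ∀ {G : Set} {m} → (G → G → G) → G → (Fin m → G) → Fin (suc m) → G
partialsFrom _·_ acc t zero = acc
partialsFrom {m = suc m} _·_ acc t (suc i) = partialsFrom _·_ (acc · t zero) (t ∘ suc) i

partials : ∀ {G : Set} {n} → (G → G → G) → (Fin (suc n) → G) → Fin (suc n) → G
partials _·_ s = partialsFrom _·_ (s zero) (s ∘ suc)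

Sequenceable : (G : Set) → (G → G → G) → Set
Sequenceable G _·_ =
  Σ ℕ λ n → Σ (Fin (suc n) → G) λ s →
    Bijective _≡_ _≡_ s × (∀ {i j} → partials _·_ s i ≡ partials _·_ s j → i ≡ j)

{-# OPTIONS --safe #-}

-- Write q = 2h + 1 and A = ℤ_p^k × B, of odd order. A sequencing amounts to a walk through
-- ℤ_q ⋉ A whose vertices, and whose steps, are all different; as the number of vertices is
-- fixed, it suffices that every vertex and every nontrivial step occurs.
--
-- The walk starts and ends in the fibre over 0 and in between runs through h blocks. The j-th
-- block alternates between the fibres j and -j through o + t and o - t, for t along a list of
-- A: moves in one direction are the -2t, i.e. all of A, and moves in the other direction are
-- the sums of neighbours, which a suitable antisymmetric list -x_K, …, -x_1, 0, x_1, …, x_K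
-- makes cover A \ 0. The missing moves by 0 are the links between consecutive blocks. In the
-- fibre 0 the walk starts with -γ_K, …, -γ_1 and ends with γ_K, …, γ_1, 0, where
-- γ_i = (-1)^i x_i, and only the step γ_1 is missing. One special block, between the fibres
-- s and -s in the middle, provides it by a jump by Δ = α^(-s) γ_1 inside the fibre -s. It
-- thereby misses one more move, by -ν or its negative, and shifts the subsequent blocks by
-- Δ + ν, where ν = Δ + κ with κ in a subgroup not containing Δ, which may be prescribed. The
-- link back to the fibre 0 is that move if γ_K = -γ_1 + Δ + ν - α^r ν for a certain 0 < r < q.
--
-- Lists of A with prescribed γ_1 and γ_K exist as soon as an additive functional to ℤ_p kills
-- γ_1 but not γ_K, and the analogous condition on Δ and κ is of the same kind. Taking for κ a
-- multiple of a vector u of ℤ_p^k moved by α^r, suitable functionals are 2 × 2 minors against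
-- γ_1 and u. Non-diagonalisability is only used to exclude k = 1.
module Submission where

open import Defs
open import Data.Nat using (ℕ; _^_; _∸_; _<_)
open import Relation.Binary.PropositionalEquality using (_≢_)
open import Data.Nat.Primality using (Prime)
open import Data.Nat.Divisibility using (_∣_)
open import Relation.Nullary using (¬_)

open import Algebra.Bundles using (CommutativeMonoid)
import Algebra.Properties.CommutativeMonoid.Sum as Sums
open import Algebra.Structures using (IsAbelianGroup)
open import Data.Bool using (Bool; true; false; not; _xor_)
import Data.Bool.Properties as Boolₚ
open import Data.Fin using (Fin; zero; suc; toℕ; fromℕ<; combine; remQuot; punchOut)
import Data.Fin.Properties as Finₚ
open import Data.List as List using (List; []; _∷_; length; _++_)
import Data.List.Properties as Listₚ
open import Data.Maybe as Maybe using (Maybe; nothing; just)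
open import Data.Nat using (zero; suc; _+_; _*_; _≤_; z≤n; s≤s; s≤s⁻¹; _%_; _/_; _≤?_; _<?_)
open import Data.Nat.Coprimality using (Coprime; coprime-Bézout)
open import Data.Nat.DivMod using (_mod_; m≡m%n+[m/n]*n; m%n<n; m<n⇒m%n≡m; m*n%n≡0; [m+n]%n≡m%n; [m+kn]%n≡m%n;
  %-distribˡ-+; %-distribˡ-*)
open import Data.Nat.Divisibility using (divides; n∣m⇒m%n≡0)
open import Data.Nat.GCD using (module Bézout)
open import Data.Nat.Primality using (prime[2]; prime?; prime⇒irreducible; euclidsLemma; ¬prime[1])
import Data.Nat.Properties as ℕₚ
open import Data.Nat.Tactic.RingSolver using (solve-∀)
open import Data.Product using (Σ; ∃; ∃₂; _×_; _,_; proj₁; proj₂)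
open import Data.Product.Function.NonDependent.Propositional using (_×-↔_)
open import Data.Sum as Sum using (_⊎_; inj₁; inj₂)
open import Data.Vec using (Vec; []; _∷_; zipWith; replicate; lookup; map; head; _[_]≔_)
import Data.Vec.Properties as Vecₚ
open import Function using (_∘_)
open import Function.Bundles using (_↔_; Inverse; mk↔ₛ′)
open import Function.Properties.Inverse using (↔-refl; ↔-sym; ↔-trans)
open import Relation.Binary.Definitions using (DecidableEquality; Tri; tri<; tri≈; tri>)
open import Relation.Binary.PropositionalEquality
open import Relation.Nullary using (Dec; yes; no; contradiction)
open import Relation.Nullary.Decidable using (map′; _×-dec_; ¬?; decidable-stable; from-yes)

-- Walks

-- The lists come from cyclic extensions. If g has order 2l + 1 modulo a subgroup D, each d in a
-- list of D is replaced by d - lg, ..., d + lg: sums inside these runs fill the nonzero classes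
-- modulo D, and sums across them stay what they were, since lg and -lg cancel. The end of such a
-- list is a sum over all generators used. So the last extension, by w, runs instead through the
-- levels 1, 3, 5, ..., 4, 2 with alternating signs, and a displacement of level 2 makes it end in
-- 2w. Between rounds of opposite sign the sums are w + 2m - (2x + y), which is where 3 must be
-- invertible: over neighbours x, y, the value 2x + y has to be anything but one element. The
-- special block stands in the middle because links repair blocks: those before it lack the move by
-- 0 from -j to j, those after it the one from j to -j, and the links supply these if 2s is h or h +
-- 1. The cases differ in the direction of the special block served by an ordinary link. The other
-- direction is left to the closing link and must be the one that misses -ν; the offset, 0 or ν,
-- decides this.

infixr 5 _⌢_
-- A nonempty list as a tree of concatenations: `rev` and `bind` follow the tree, and a pair of
-- neighbours lies inside a subtree or at one join, so nothing has to be reassociated.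
data Walk (A : Set) : Set where
  [_]  : A → Walk A
  _⌢_ : Walk A → Walk A → Walk A

module _ {A : Set} where
  first last : Walk A → A
  first [ a ]   = a
  first (u ⌢ v) = first u
  last [ a ]   = a
  last (u ⌢ v) = last v

  len : Walk A → ℕ
  len [ a ]   = 1
  len (u ⌢ v) = len u + len v

  rev : Walk A → Walk A
  rev [ a ]   = [ a ]
  rev (u ⌢ v) = rev v ⌢ rev u

  infix 4 _∈_
  data _∈_ (a : A) : Walk A → Set where
    this : a ∈ [ a ]
    inˡ  : ∀ {u v} → a ∈ u → a ∈ u ⌢ v
    inʳ  : ∀ {u v} → a ∈ v → a ∈ u ⌢ v

  data Edge : A → A → Walk A → Set where
    join : ∀ {u v} → Edge (last u) (first v) (u ⌢ v)
    inˡ  : ∀ {a b u v} → Edge a b u → Edge a b (u ⌢ v)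
    inʳ  : ∀ {a b u v} → Edge a b v → Edge a b (u ⌢ v)

  join′ : ∀ {a b u v} → last u ≡ a → first v ≡ b → Edge a b (u ⌢ v)
  join′ refl refl = join

  first-rev : ∀ w → first (rev w) ≡ last w
  first-rev [ a ]   = refl
  first-rev (u ⌢ v) = first-rev v

  last-rev : ∀ w → last (rev w) ≡ first w
  last-rev [ a ]   = refl
  last-rev (u ⌢ v) = last-rev u

  len-rev : ∀ w → len (rev w) ≡ len w
  len-rev [ a ]   = refl
  len-rev (u ⌢ v) = trans (cong₂ _+_ (len-rev v) (len-rev u)) (ℕₚ.+-comm (len v) (len u))

  ∈-rev : ∀ {a w} → a ∈ w → a ∈ rev w
  ∈-rev this    = this
  ∈-rev (inˡ p) = inʳ (∈-rev p)
  ∈-rev (inʳ p) = inˡ (∈-rev p)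

  edge-rev : ∀ {a b w} → Edge a b w → Edge b a (rev w)
  edge-rev (join {u} {v}) = join′ (last-rev v) (first-rev u)
  edge-rev (inˡ e)        = inʳ (edge-rev e)
  edge-rev (inʳ e)        = inˡ (edge-rev e)

module _ {A B : Set} where
  bind : (A → Walk B) → Walk A → Walk B
  bind f [ a ]   = f a
  bind f (u ⌢ v) = bind f u ⌢ bind f v

  first-bind : ∀ f w → first (bind f w) ≡ first (f (first w))
  first-bind f [ a ]   = refl
  first-bind f (u ⌢ v) = first-bind f u

  last-bind : ∀ f w → last (bind f w) ≡ last (f (last w))
  last-bind f [ a ]   = refl
  last-bind f (u ⌢ v) = last-bind f v

  ∈-bind : ∀ {f a b w} → a ∈ w → b ∈ f a → b ∈ bind f w
  ∈-bind this    q = q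
  ∈-bind (inˡ p) q = inˡ (∈-bind p q)
  ∈-bind (inʳ p) q = inʳ (∈-bind p q)

  edge-bind : ∀ {f a b b′ w} → a ∈ w → Edge b b′ (f a) → Edge b b′ (bind f w)
  edge-bind this    q = q
  edge-bind (inˡ p) q = inˡ (edge-bind p q)
  edge-bind (inʳ p) q = inʳ (edge-bind p q)

  edge-join : ∀ {f a a′ w} → Edge a a′ w → Edge (last (f a)) (first (f a′)) (bind f w)
  edge-join {f} (join {u} {v}) = join′ (last-bind f u) (first-bind f v)
  edge-join (inˡ e) = inˡ (edge-join e)
  edge-join (inʳ e) = inʳ (edge-join e)

  len-bind : ∀ f c w → (∀ a → len (f a) ≡ c) → len (bind f w) ≡ len w * c
  len-bind f c [ a ] h = trans (h a) (sym (ℕₚ.+-identityʳ c))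
  len-bind f c (u ⌢ v) h =
    trans (cong₂ _+_ (len-bind f c u h) (len-bind f c v h)) (sym (ℕₚ.*-distribʳ-+ c (len u) (len v)))

  mapW : (A → B) → Walk A → Walk B
  mapW f = bind λ a → [ f a ]

  ∈-map : ∀ f {a w} → a ∈ w → f a ∈ mapW f w
  ∈-map f p = ∈-bind p this

  edge-map : ∀ f {a b w} → Edge a b w → Edge (f a) (f b) (mapW f w)
  edge-map f e = edge-join e

  len-map : ∀ f w → len (mapW f w) ≡ len w
  len-map f w = trans (len-bind _ 1 w λ _ → refl) (ℕₚ.*-identityʳ (len w))

oddLen : {A : Set} → Walk A → Bool
oddLen [ a ]   = true
oddLen (u ⌢ v) = oddLen u xor oddLen v

-- The labels alternate along the walk, the parity of `u` fixing the label with which `v` starts.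
-- They serve as alternating signs.
tag : {A : Set} → Bool → Walk A → Walk (Bool × A)
tag b [ a ]   = [ b , a ]
tag b (u ⌢ v) = tag b u ⌢ tag (b xor oddLen u) v

module _ {A : Set} where
  private
    xor-true : ∀ b → b ≡ not (b xor true)
    xor-true false = refl
    xor-true true  = refl

  first-tag : ∀ b (w : Walk A) → first (tag b w) ≡ (b , first w)
  first-tag b [ a ]   = refl
  first-tag b (u ⌢ v) = first-tag b u

  last-tag : ∀ b (w : Walk A) → last (tag b w) ≡ (not (b xor oddLen w) , last w)
  last-tag b [ a ]   = cong (_, a) (xor-true b)
  last-tag b (u ⌢ v) = trans (last-tag (b xor oddLen u) v)
    (cong (λ c → not c , last v) (Boolₚ.xor-assoc b (oddLen u) (oddLen v)))

  ∈-tag : ∀ b {a} {w : Walk A} → a ∈ w → ∃ λ c → (c , a) ∈ tag b w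
  ∈-tag b this    = b , this
  ∈-tag b (inˡ p) = let c , q = ∈-tag b p in c , inˡ q
  ∈-tag b (inʳ p) = let c , q = ∈-tag _ p in c , inʳ q

  edge-tag : ∀ b {x y} {w : Walk A} → Edge x y w → ∃ λ c → Edge (c , x) (not c , y) (tag b w)
  edge-tag b (join {u} {v}) = not (b xor oddLen u) ,
    join′ (last-tag b u) (trans (first-tag _ v) (cong (_, first v) (sym (Boolₚ.not-involutive (b xor oddLen u)))))
  edge-tag b (inˡ e) = let c , q = edge-tag b e in c , inˡ q
  edge-tag b (inʳ e) = let c , q = edge-tag _ e in c , inʳ q

  len-tag : ∀ b (w : Walk A) → len (tag b w) ≡ len w
  len-tag b [ a ]   = refl
  len-tag b (u ⌢ v) = cong₂ _+_ (len-tag b u) (len-tag _ v)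

-- Abelian groups: multiples and a solver for linear identities

module AbelianGroup {A : Set} {_∙_ : A → A → A} {ε : A} {_⁻¹ : A → A}
  (isAb : IsAbelianGroup _≡_ _∙_ ε _⁻¹) where

  open IsAbelianGroup isAb public using (assoc; comm; identityˡ; identityʳ; inverseˡ; inverseʳ)

  infixr 8 _·_
  _·_ : ℕ → A → A
  zero  · x = ε
  suc n · x = x ∙ (n · x)

  cancelʳ : ∀ {x y} z → x ∙ z ≡ y ∙ z → x ≡ y
  cancelʳ {x} {y} z e = trans (sym (lem x)) (trans (cong (_∙ (z ⁻¹)) e) (lem y))
    where
    lem : ∀ u → (u ∙ z) ∙ (z ⁻¹) ≡ u
    lem u = trans (assoc u z (z ⁻¹)) (trans (cong (u ∙_) (inverseʳ z)) (identityʳ u))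

  ∙-congˡ : ∀ {x y z} → y ≡ z → x ∙ y ≡ x ∙ z
  ∙-congˡ refl = refl

  ∙-congʳ : ∀ {x y z} → x ≡ y → x ∙ z ≡ y ∙ z
  ∙-congʳ refl = refl

  interchange : ∀ a b c d → (a ∙ b) ∙ (c ∙ d) ≡ (a ∙ c) ∙ (b ∙ d)
  interchange a b c d = trans (assoc a b _) (trans (cong (a ∙_)
    (trans (sym (assoc b c d)) (trans (cong (_∙ d) (comm b c)) (assoc c b d)))) (sym (assoc a c _)))

  ·-+ : ∀ m n x → (m + n) · x ≡ (m · x) ∙ (n · x)
  ·-+ zero    n x = sym (identityˡ _)
  ·-+ (suc m) n x = trans (cong (x ∙_) (·-+ m n x)) (sym (assoc x _ _))

  ·-∙ : ∀ n x y → n · (x ∙ y) ≡ (n · x) ∙ (n · y)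
  ·-∙ zero    x y = sym (identityˡ ε)
  ·-∙ (suc n) x y = trans (cong ((x ∙ y) ∙_) (·-∙ n x y)) (interchange x y _ _)

  ·-ε : ∀ n → n · ε ≡ ε
  ·-ε zero    = refl
  ·-ε (suc n) = trans (identityˡ _) (·-ε n)

  ·-· : ∀ m n x → (m * n) · x ≡ m · (n · x)
  ·-· zero    n x = refl
  ·-· (suc m) n x = trans (·-+ n (m * n) x) (cong ((n · x) ∙_) (·-· m n x))

  data Expr (n : ℕ) : Set where
    var  : Fin n → Expr n
    :ε   : Expr n
    _:∙_ : Expr n → Expr n → Expr n
    :-_  : Expr n → Expr n
    _:·_ : ℕ → Expr n → Expr n
  infixl 6 _:∙_
  infix 8 :-_
  infixr 7 _:·_

  ⟦_⟧ : ∀ {n} → Expr n → Vec A n → A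
  ⟦ var i ⟧  ρ = lookup ρ i
  ⟦ :ε ⟧     ρ = ε
  ⟦ e :∙ f ⟧ ρ = ⟦ e ⟧ ρ ∙ ⟦ f ⟧ ρ
  ⟦ :- e ⟧   ρ = ⟦ e ⟧ ρ ⁻¹
  ⟦ k :· e ⟧ ρ = k · ⟦ e ⟧ ρ

  private
    comb : ∀ {n} → Vec ℕ n → Vec A n → A
    comb []       []       = ε
    comb (c ∷ cs) (x ∷ ρ) = (c · x) ∙ comb cs ρ

    _+ᵛ_ : ∀ {n} → Vec ℕ n → Vec ℕ n → Vec ℕ n
    _+ᵛ_ = zipWith _+_

    unit : ∀ {n} → Fin n → Vec ℕ n
    unit {suc n} zero = 1 ∷ replicate n 0
    unit (suc i) = 0 ∷ unit i

    posᵛ negᵛ : ∀ {n} → Expr n → Vec ℕ n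
    posᵛ (var i)  = unit i
    posᵛ :ε       = replicate _ 0
    posᵛ (e :∙ f) = posᵛ e +ᵛ posᵛ f
    posᵛ (:- e)   = negᵛ e
    posᵛ (k :· e) = map (k *_) (posᵛ e)
    negᵛ (var i)  = replicate _ 0
    negᵛ :ε       = replicate _ 0
    negᵛ (e :∙ f) = negᵛ e +ᵛ negᵛ f
    negᵛ (:- e)   = posᵛ e
    negᵛ (k :· e) = map (k *_) (negᵛ e)

    comb-0 : ∀ {n} (ρ : Vec A n) → comb (replicate n 0) ρ ≡ ε
    comb-0 []      = refl
    comb-0 (x ∷ ρ) = trans (identityˡ _) (comb-0 ρ)

    comb-unit : ∀ {n} (i : Fin n) (ρ : Vec A n) → comb (unit i) ρ ≡ lookup ρ i
    comb-unit zero    (x ∷ ρ) = trans (cong₂ _∙_ (identityʳ x) (comb-0 ρ)) (identityʳ x)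
    comb-unit (suc i) (x ∷ ρ) = trans (identityˡ _) (comb-unit i ρ)

    comb-+ : ∀ {n} (c d : Vec ℕ n) ρ → comb (c +ᵛ d) ρ ≡ comb c ρ ∙ comb d ρ
    comb-+ []      []      []      = sym (identityˡ ε)
    comb-+ (c ∷ cs) (d ∷ ds) (x ∷ ρ) =
      trans (cong₂ _∙_ (·-+ c d x) (comb-+ cs ds ρ)) (interchange _ _ _ _)

    comb-* : ∀ {n} k (c : Vec ℕ n) ρ → comb (map (k *_) c) ρ ≡ k · comb c ρ
    comb-* k []       []      = sym (·-ε k)
    comb-* k (c ∷ cs) (x ∷ ρ) =
      trans (cong₂ _∙_ (·-· k c x) (comb-* k cs ρ)) (sym (·-∙ k _ _))

    -- Positive and negative coefficients are kept apart, so natural numbers suffice; the negative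
    -- part is moved to the side of the expression.
    correct : ∀ {n} (e : Expr n) ρ → ⟦ e ⟧ ρ ∙ comb (negᵛ e) ρ ≡ comb (posᵛ e) ρ
    correct (var i) ρ = trans (∙-congˡ (comb-0 ρ)) (trans (identityʳ _) (sym (comb-unit i ρ)))
    correct :ε ρ = identityˡ _
    correct (e :∙ f) ρ = trans (∙-congˡ (comb-+ (negᵛ e) (negᵛ f) ρ))
      (trans (interchange _ _ _ _) (trans (cong₂ _∙_ (correct e ρ) (correct f ρ))
        (sym (comb-+ (posᵛ e) (posᵛ f) ρ))))
    correct (:- e) ρ = trans (∙-congˡ (sym (correct e ρ)))
      (trans (sym (assoc _ _ _)) (trans (∙-congʳ (inverseˡ _)) (identityˡ _)))
    correct (k :· e) ρ = trans (∙-congˡ (comb-* k (negᵛ e) ρ))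
      (trans (sym (·-∙ k _ _)) (trans (cong (k ·_) (correct e ρ)) (sym (comb-* k (posᵛ e) ρ))))

  solve : ∀ {n} (l r : Expr n) (ρ : Vec A n) →
    zipWith _+_ (posᵛ l) (negᵛ r) ≡ zipWith _+_ (posᵛ r) (negᵛ l) → ⟦ l ⟧ ρ ≡ ⟦ r ⟧ ρ
  solve l r ρ eq = cancelʳ (comb (negᵛ l) ρ ∙ comb (negᵛ r) ρ)
    (trans (sym (assoc _ _ _)) (trans (∙-congʳ (correct l ρ)) (trans (sym (comb-+ (posᵛ l) (negᵛ r) ρ))
      (trans (cong (λ c → comb c ρ) eq) (trans (comb-+ (posᵛ r) (negᵛ l) ρ)
        (trans (∙-congʳ (sym (correct r ρ))) (trans (assoc _ _ _) (cong (⟦ r ⟧ ρ ∙_) (comm _ _)))))))))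

  v₀ : ∀ {n} → Expr (1 + n)
  v₀ = var zero
  v₁ : ∀ {n} → Expr (2 + n)
  v₁ = var (suc zero)
  v₂ : ∀ {n} → Expr (3 + n)
  v₂ = var (suc (suc zero))
  v₃ : ∀ {n} → Expr (4 + n)
  v₃ = var (suc (suc (suc zero)))
  v₄ : ∀ {n} → Expr (5 + n)
  v₄ = var (suc (suc (suc (suc zero))))

-- Antisymmetric lists of an abelian group

least : {Q : ℕ → Set} → (∀ n → Dec (Q n)) → ∀ n → Q n → ∃ λ m → Q m × (∀ j → j < m → ¬ Q j)
least {Q} Q? n q = go n 0 (subst Q (sym (ℕₚ.+-identityʳ n)) q) λ j ()
  where
  go : ∀ fuel s → Q (fuel + s) → (∀ j → j < s → ¬ Q j) → ∃ λ m → Q m × (∀ j → j < m → ¬ Q j)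
  go fuel s q below with Q? s
  ... | yes qs = s , qs , below
  go zero s q below | no ¬qs = contradiction q ¬qs
  go (suc fuel) s q below | no ¬qs = go fuel (suc s) (subst Q (sym (ℕₚ.+-suc fuel s)) q) below′
    where
    below′ : ∀ j → j < suc s → ¬ Q j
    below′ j j<s with ℕₚ.m≤n⇒m<n∨m≡n (s≤s⁻¹ j<s)
    ... | inj₁ lt = below j lt
    ... | inj₂ refl = ¬qs

data Mod2 : ℕ → Set where
  even : ∀ j → Mod2 (j + j)
  odd  : ∀ j → Mod2 (suc (j + j))

mod2 : ∀ n → Mod2 n
mod2 zero = even 0
mod2 (suc n) with mod2 n
... | even j = odd j
... | odd j  = subst Mod2 (cong suc (ℕₚ.+-suc j j)) (even (suc j))

data Mod3 : ℕ → Set where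
  r0 : ∀ j → Mod3 (j * 3)
  r1 : ∀ j → Mod3 (1 + j * 3)
  r2 : ∀ j → Mod3 (2 + j * 3)

mod3 : ∀ n → Mod3 n
mod3 zero = r0 0
mod3 (suc n) with mod3 n
... | r0 j = r1 j
... | r1 j = r2 j
... | r2 j = r0 (suc j)

infixr 5 _⌢?_
_⌢?_ : {A : Set} → Walk A → Maybe (Walk A) → Walk A
u ⌢? nothing = u
u ⌢? just v  = u ⌢ v

module Lexicographic {A : Set} {_∙_ : A → A → A} {ε : A} {_⁻¹ : A → A}
  (isAb : IsAbelianGroup _≡_ _∙_ ε _⁻¹) {N : ℕ} (fin : Fin N ↔ A)
  {e : ℕ} (torsion : ∀ x → AbelianGroup._·_ isAb e x ≡ ε)
  (h₂ c₂ : ℕ) (half-eq : 2 * h₂ ≡ 1 + c₂ * e)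
  (h₃ c₃ : ℕ) (third-eq : 3 * h₃ ≡ 1 + c₃ * e) where

  open AbelianGroup isAb

  enum : Fin N → A
  enum = Inverse.to fin

  index : A → Fin N
  index = Inverse.from fin

  enum-index : ∀ a → enum (index a) ≡ a
  enum-index a = Inverse.strictlyInverseˡ fin a

  infix 4 _≟_
  _≟_ : DecidableEquality A
  a ≟ b = map′ (λ eq → trans (sym (enum-index a)) (trans (cong enum eq) (enum-index b)))
               (cong index) (index a Finₚ.≟ index b)

  search : {Q : A → Set} → (∀ a → Dec (Q a)) → Dec (∃ Q)
  search {Q} Q? = map′ (λ (i , q) → enum i , q)
    (λ (a , q) → index a , subst Q (sym (enum-index a)) q) (Finₚ.any? λ i → Q? (enum i))

  div-inv : ∀ {k h c} → k * h ≡ 1 + c * e → ∀ x → k · (h · x) ≡ x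
  div-inv {k} {h} {c} eq x = trans (sym (·-· k h x)) (trans (cong (_· x) eq)
    (trans (cong (x ∙_) (trans (·-· c e x) (trans (cong (c ·_) (torsion x)) (·-ε c)))) (identityʳ x)))

  -- Being multiples of `x`, these lie in every subgroup that contains `x`.
  half third : A → A
  half x  = h₂ · x
  third x = h₃ · x

  2·half : ∀ x → 2 · half x ≡ x
  2·half = div-inv {2} {h₂} {c₂} half-eq

  3·third : ∀ x → 3 · third x ≡ x
  3·third = div-inv {3} {h₃} {c₃} third-eq

  ·-comm : ∀ m n x → m · (n · x) ≡ n · (m · x)
  ·-comm m n x = trans (sym (·-· m n x)) (trans (cong (_· x) (ℕₚ.*-comm m n)) (·-· n m x))

  half·2 : ∀ x → half (2 · x) ≡ x
  half·2 x = trans (·-comm h₂ 2 x) (2·half x)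

  third·3 : ∀ x → third (3 · x) ≡ x
  third·3 x = trans (·-comm h₃ 3 x) (3·third x)

  record Subgroup : Set₁ where
    field
      P    : A → Set
      P?   : ∀ a → Dec (P a)
      P-ε  : P ε
      P-∙  : ∀ {a b} → P a → P b → P (a ∙ b)
      P-⁻¹ : ∀ {a} → P a → P (a ⁻¹)

    P-· : ∀ n {a} → P a → P (n · a)
    P-· zero    p = P-ε
    P-· (suc n) p = P-∙ p (P-· n p)

    ∙⁻¹ : ∀ {a b} → P a → P b → P (a ∙ (b ⁻¹))
    ∙⁻¹ p q = P-∙ p (P-⁻¹ q)

  open Subgroup

  -- A lower bound for the size of `Q`, read as an upper bound for `M`: it stops the growth of lists
  -- and later bounds the length of the whole walk.
  Card : (A → Set) → ℕ → Set
  Card Q M = Σ (Fin M → A) λ f → (∀ i → Q (f i)) × (∀ {i j} → f i ≡ f j → i ≡ j)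

  Card-≤ : ∀ {Q M} → Card Q M → M ≤ N
  Card-≤ (f , _ , inj) = Finₚ.injective⇒≤ {f = λ i → index (f i)} λ {i} {j} eq →
    inj (trans (sym (enum-index (f i))) (trans (cong enum eq) (enum-index (f j))))

  run : A → A → ℕ → Walk A
  run b g zero    = [ b ]
  run b g (suc n) = [ b ] ⌢ run (b ∙ g) g n

  first-run : ∀ b g n → first (run b g n) ≡ b
  first-run b g zero    = refl
  first-run b g (suc n) = refl

  last-run : ∀ b g n → last (run b g n) ≡ b ∙ (n · g)
  last-run b g zero    = sym (identityʳ b)
  last-run b g (suc n) = trans (last-run (b ∙ g) g n) (assoc b g (n · g))

  len-run : ∀ b g n → len (run b g n) ≡ suc n
  len-run b g zero    = refl
  len-run b g (suc n) = cong suc (len-run (b ∙ g) g n)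

  ∈-run : ∀ b g {n j} → j ≤ n → b ∙ (j · g) ∈ run b g n
  ∈-run b g {zero}  z≤n = subst (_∈ run b g 0) (sym (identityʳ b)) this
  ∈-run b g {suc n} {zero} z≤n = subst (_∈ run b g (suc n)) (sym (identityʳ b)) (inˡ this)
  ∈-run b g {suc n} {suc j} (s≤s le) =
    subst (_∈ run b g (suc n)) (assoc b g (j · g)) (inʳ (∈-run (b ∙ g) g le))

  edge-run : ∀ b g {n j} → j < n → Edge (b ∙ (j · g)) (b ∙ (suc j · g)) (run b g n)
  edge-run b g {suc n} {zero} (s≤s z≤n) = join′ (sym (identityʳ b))
    (trans (first-run (b ∙ g) g n) (cong (b ∙_) (sym (identityʳ g))))
  edge-run b g {suc n} {suc j} (s≤s lt) = subst₂ (λ x y → Edge x y (run b g (suc n)))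
    (assoc b g (j · g)) (assoc b g (suc j · g)) (inʳ (edge-run (b ∙ g) g lt))

  -- z lists the subgroup Q antisymmetrically; X? is the half of z after 0, absent if Q is trivial.
  record Lex (Q : A → Set) : Set where
    field
      z      : Walk A
      X?     : Maybe (Walk A)
      z-all  : ∀ {a} → Q a → a ∈ z
      z-sum  : ∀ {a} → Q a → a ≢ ε → ∃₂ λ x y → Edge x y z × x ∙ y ≡ a
      z-sum₃ : ∀ {a} → Q a → a ≢ last z → ∃₂ λ x y → Edge x y z × (2 · x) ∙ y ≡ a
      z-anti : first z ≡ last z ⁻¹
      z-last : Q (last z)
      card   : Card Q (len z)
      X-all  : ∀ {a} → Q a → a ≡ ε ⊎ ∃₂ λ X x → X? ≡ just X × x ∈ X × (a ≡ x ⊎ a ⁻¹ ≡ x)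
      X-sum  : ∀ {a} → Q a → a ≢ ε → ∃ λ X → X? ≡ just X ×
                 ((first X ≡ a ⊎ first X ≡ a ⁻¹)
                 ⊎ ∃₂ λ x y → Edge x y X × (x ∙ y ≡ a ⊎ x ∙ y ≡ a ⁻¹))
      X-last : ∀ {X} → X? ≡ just X → last X ≡ last z
      X-len  : len z ≡ suc (2 * Maybe.maybe len 0 X?)

  Lex-trivial : Lex (_≡ ε)
  Lex-trivial = record
    { z = [ ε ] ; X? = nothing
    ; z-all = λ { refl → this }
    ; z-sum = λ p n → contradiction p n
    ; z-sum₃ = λ p n → contradiction p n
    ; z-anti = solve :ε (:- :ε) [] refl
    ; z-last = refl
    ; card = (λ _ → ε) , (λ _ → refl) , λ { {zero} {zero} _ → refl }
    ; X-all = inj₁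
    ; X-sum = λ p n → contradiction p n
    ; X-last = λ () ; X-len = refl }

  Lex-⊆ : ∀ {Q R : A → Set} → (∀ {a} → R a → Q a) → (∀ {a} → Q a → R a) → Lex Q → Lex R
  Lex-⊆ to from L = record
    { z = z ; X? = X? ; z-all = λ r → z-all (to r) ; z-sum = λ r → z-sum (to r)
    ; z-sum₃ = λ r → z-sum₃ (to r) ; z-anti = z-anti ; z-last = from z-last
    ; card = let f , p , inj = card in f , (λ i → from (p i)) , inj
    ; X-all = λ r → X-all (to r) ; X-sum = λ r → X-sum (to r)
    ; X-last = X-last ; X-len = X-len }
    where open Lex L

  -- One cyclic extension, by `g` of order `n = 2l + 1` modulo `S`; `inv₃` says that 3 is invertible
  -- modulo `n`.
  module Extend (S : Subgroup) (g : A) (l′ : ℕ)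
    (ng : P S (suc (suc l′ + suc l′) · g))
    (minimal : ∀ j → suc j < suc (suc l′ + suc l′) → ¬ P S (suc j · g))
    (i₃ k₃ : ℕ) (inv₃ : 3 * i₃ ≡ 1 + k₃ * suc (suc l′ + suc l′)) where

    l n : ℕ
    l = suc l′
    n = suc (l + l)

    Q : A → Set
    Q a = ∃₂ λ d j → P S d × a ≡ d ∙ (j · g)

    ·-mod : ∀ j → j · g ≡ ((j / n) · (n · g)) ∙ ((j % n) · g)
    ·-mod j = trans (cong (_· g) (trans (m≡m%n+[m/n]*n j n) (ℕₚ.+-comm (j % n) _)))
      (trans (·-+ (j / n * n) (j % n) g) (∙-congʳ (·-· (j / n) n g)))

    P⇒Q : ∀ {a} → P S a → Q a
    P⇒Q {a} p = a , 0 , p , sym (identityʳ a)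

    Q-∙ : ∀ {a b} → Q a → Q b → Q (a ∙ b)
    Q-∙ (d , j , p , refl) (d′ , j′ , p′ , refl) = d ∙ d′ , j + j′ , P-∙ S p p′ ,
      trans (interchange d _ d′ _) (cong ((d ∙ d′) ∙_) (sym (·-+ j j′ g)))

    g∈Q : Q g
    g∈Q = ε , 1 , P-ε S , solve v₀ (:ε :∙ (1 :· v₀)) (g ∷ []) refl

    Q-· : ∀ k {a} → Q a → Q (k · a)
    Q-· zero    q = P⇒Q (P-ε S)
    Q-· (suc k) q = Q-∙ q (Q-· k q)

    Q-⁻¹ : ∀ {a} → Q a → Q (a ⁻¹)
    -- Modulo `n`, -j is 2lj; the difference, jn times `g`, lies in `S`.
    Q-⁻¹ (d , j , p , refl) = (d ⁻¹) ∙ ((j · (n · g)) ⁻¹) , j * (l + l) ,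
      P-∙ S (P-⁻¹ S p) (P-⁻¹ S (P-· S j ng)) ,
      trans (cong (λ t → (d ∙ t) ⁻¹) refl)
      (trans (solve (:- (v₀ :∙ v₁)) ((:- v₀ :∙ :- (v₁ :∙ v₂)) :∙ v₂) (d ∷ (j · g) ∷ ((j * (l + l)) · g) ∷ []) refl)
        (cong (λ t → ((d ⁻¹) ∙ (t ⁻¹)) ∙ ((j * (l + l)) · g))
          (trans (sym (·-+ j (j * (l + l)) g)) (trans (cong (_· g) (sym (ℕₚ.*-suc j (l + l)))) (·-· j n g)))))

    -- Multiplication by k is invertible modulo n, so k·g generates Q over P.
    by-multiples : ∀ k {i c} → k * i ≡ 1 + c * n → ∀ {a} → Q a →
      ∃₂ λ d j → P S d × j < n × a ≡ d ∙ ((k * j) · g)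
    by-multiples k {i} {c} eq (d , t , p , refl) =
      (d ∙ (corr ⁻¹)) ∙ (k · ((j₀ / n) · (n · g))) , j₀ % n ,
      P-∙ S (∙⁻¹ S p (P-· S (c * t) ng)) (P-· S k (P-· S (j₀ / n) ng)) , m%n<n j₀ n ,
      trans (solve (v₀ :∙ v₁) ((v₀ :∙ :- v₂) :∙ (v₁ :∙ v₂)) (d ∷ (t · g) ∷ corr ∷ []) refl)
      (trans (cong ((d ∙ (corr ⁻¹)) ∙_)
        (trans (sym (trans (cong (_· g) arith) (trans (·-+ t (c * t * n) g) (cong ((t · g) ∙_) (·-· (c * t) n g)))))
          (trans (·-· k j₀ g) (trans (cong (k ·_) (·-mod j₀)) (trans (·-∙ k _ _) (∙-congˡ (sym (·-· k (j₀ % n) g))))))))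
        (sym (assoc _ _ _)))
      where
      j₀ = i * t
      corr = (c * t) · (n · g)
      arith : k * j₀ ≡ t + c * t * n
      arith = trans (sym (ℕₚ.*-assoc k i t)) (trans (cong (_* t) eq) (lem c n t))
        where
        lem : ∀ c n t → (1 + c * n) * t ≡ t + c * t * n
        lem = solve-∀

    reduce : ∀ {a} → Q a → ∃₂ λ d j → P S d × j < n × a ≡ d ∙ (j · g)
    reduce q with by-multiples 1 {1} {0} refl q
    ... | d , j , p , lt , eq = d , j , p , lt , trans eq (cong (λ t → d ∙ (t · g)) (ℕₚ.*-identityˡ j))

    Q? : ∀ a → Dec (Q a)
    Q? a = map′ (λ (i , p) → _ , toℕ i , p , solve v₀ ((v₀ :∙ :- v₁) :∙ v₁) (a ∷ (toℕ i · g) ∷ []) refl)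
      (λ q → let d , j , p , lt , eq = reduce q in fromℕ< lt ,
        subst (λ t → P S (a ∙ ((t · g) ⁻¹))) (sym (Finₚ.toℕ-fromℕ< lt))
          (subst (P S) (trans (solve v₀ ((v₀ :∙ v₁) :∙ :- v₁) (d ∷ (j · g) ∷ []) refl) (cong (_∙ ((j · g) ⁻¹)) (sym eq))) p))
      (Finₚ.any? {n = n} λ i → P? S (a ∙ ((toℕ i · g) ⁻¹)))

    extended : Subgroup
    extended = record { P = Q ; P? = Q? ; P-ε = P⇒Q (P-ε S) ; P-∙ = Q-∙ ; P-⁻¹ = Q-⁻¹ }

    G = l · g

    2l : (l + l) · g ≡ G ∙ G
    2l = ·-+ l l g

    -- Centred at `d`, so that negation reverses the run into that of `d ⁻¹`, and the end of one run
    -- cancels against the start of the next.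
    levels : A → Walk A
    levels d = run (d ∙ (G ⁻¹)) g (l + l)

    first-levels : ∀ d → first (levels d) ≡ d ∙ (G ⁻¹)
    first-levels d = first-run _ g (l + l)

    last-levels : ∀ d → last (levels d) ≡ d ∙ G
    last-levels d = trans (last-run _ g (l + l)) (trans (∙-congˡ 2l)
      (solve ((v₀ :∙ :- v₁) :∙ (v₁ :∙ v₁)) (v₀ :∙ v₁) (d ∷ G ∷ []) refl))

    -- Places j and j + 1 of the run around d have sum 2d + (2j + 1 - 2l)g. For j < 2l the
    -- coefficients meet every class modulo `n` except 0, which is left to the joins of runs.
    data Class₂ (a : A) : Set where
      inside  : ∀ d j → P S d → j < l + l → a ≡ (2 · d) ∙ ((2 · (j · g)) ∙ (g ∙ ((2 · G) ⁻¹))) → Class₂ a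
      between : P S a → Class₂ a

    class₂ : ∀ {a} → Q a → Class₂ a
    -- The inverse of 2 modulo 2l + 1 is l + 1. Adding 2lg - g first turns the coefficient 2j + 1 -
    -- 2l into 2j.
    class₂ {a} q with by-multiples 2 {suc l} {1} (arith l) (Q-∙ (Q-∙ q (Q-· (l + l) g∈Q)) (Q-⁻¹ g∈Q))
      where
      arith : ∀ l → 2 * suc l ≡ 1 + 1 * suc (l + l)
      arith = solve-∀
    ... | d , j , p , lt , eq with ℕₚ.m≤n⇒m<n∨m≡n (s≤s⁻¹ lt)
    ... | inj₁ lt′ = inside (half d) j (P-· S h₂ p) lt′
      (trans (trans (solve v₀ (((v₀ :∙ (v₁ :∙ v₁)) :∙ :- v₂) :∙ (v₂ :∙ :- (2 :· v₁))) (a ∷ G ∷ g ∷ []) refl)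
        (cong (_∙ (g ∙ ((2 · G) ⁻¹))) (trans (cong (λ t → (a ∙ t) ∙ (g ⁻¹)) (sym 2l)) (trans eq (cong (d ∙_) (·-· 2 j g))))))
        (trans (assoc _ _ _) (∙-congʳ (sym (2·half d)))))
    ... | inj₂ refl = between (subst (P S) (sym a≡) (P-∙ S p ng))
      where
      a≡ : a ≡ d ∙ (n · g)
      a≡ = trans (solve v₀ (((v₀ :∙ (v₁ :∙ v₁)) :∙ :- v₂) :∙ (v₂ :∙ :- (2 :· v₁))) (a ∷ G ∷ g ∷ []) refl)
        (trans (cong (_∙ (g ∙ ((2 · G) ⁻¹))) (trans (cong (λ t → (a ∙ t) ∙ (g ⁻¹)) (sym 2l)) (trans eq
          (cong (d ∙_) (trans (·-· 2 (l + l) g) (cong (2 ·_) 2l))))))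
        (trans (solve ((v₀ :∙ (2 :· (v₁ :∙ v₁))) :∙ (v₂ :∙ :- (2 :· v₁))) (v₀ :∙ (v₂ :∙ (v₁ :∙ v₁))) (d ∷ G ∷ g ∷ []) refl)
          (cong (λ t → d ∙ (g ∙ t)) (sym 2l))))

    module _ (L : Lex (P S)) where
      open Lex L

      zQ : Walk A
      zQ = bind levels z

      -- What follows 0 in `zQ`: the rest of the run around `ε`, then the runs around the second
      -- half of `z`.
      XQ : Walk A
      XQ = run g g l′ ⌢? Maybe.map (bind levels) X?

      last-zQ : last zQ ≡ last z ∙ G
      last-zQ = trans (last-bind levels z) (last-levels (last z))

      zQ-all : ∀ {a} → Q a → a ∈ zQ
      zQ-all {a} q with reduce (Q-∙ q (Q-· l g∈Q))
      ... | d , j , p , lt , eq = subst (_∈ zQ)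
        (trans (solve ((v₀ :∙ :- v₁) :∙ v₂) ((v₀ :∙ v₂) :∙ :- v₁) (d ∷ G ∷ (j · g) ∷ []) refl)
          (trans (cong (_∙ (G ⁻¹)) (sym eq)) (solve ((v₀ :∙ v₁) :∙ :- v₁) v₀ (a ∷ G ∷ []) refl)))
        (∈-bind (z-all p) (∈-run (d ∙ (G ⁻¹)) g (s≤s⁻¹ lt)))

      level-sum : ∀ d j → ((d ∙ (G ⁻¹)) ∙ (j · g)) ∙ ((d ∙ (G ⁻¹)) ∙ (suc j · g)) ≡
        (2 · d) ∙ ((2 · (j · g)) ∙ (g ∙ ((2 · G) ⁻¹)))
      level-sum d j = solve (((v₀ :∙ :- v₁) :∙ v₂) :∙ ((v₀ :∙ :- v₁) :∙ (v₃ :∙ v₂)))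
        ((2 :· v₀) :∙ ((2 :· v₂) :∙ (v₃ :∙ :- (2 :· v₁)))) (d ∷ G ∷ (j · g) ∷ g ∷ []) refl

      join-sum : ∀ x y → last (levels x) ∙ first (levels y) ≡ x ∙ y
      join-sum x y = trans (cong₂ _∙_ (last-levels x) (first-levels y))
        (solve ((v₀ :∙ v₂) :∙ (v₁ :∙ :- v₂)) (v₀ :∙ v₁) (x ∷ y ∷ G ∷ []) refl)

      zQ-sum : ∀ {a} → Q a → a ≢ ε → ∃₂ λ x y → Edge x y zQ × x ∙ y ≡ a
      zQ-sum q a≢ε with class₂ q
      ... | inside d j p lt eq = _ , _ , edge-bind (z-all p) (edge-run (d ∙ (G ⁻¹)) g lt) ,
        trans (level-sum d j) (sym eq)
      ... | between p with z-sum p a≢ε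
      ... | x , y , E , eq = _ , _ , edge-join E , trans (join-sum x y) eq

      -- Inside a run, 2x + y is 3d + (3j + 1 - 3l)g. As 3 is invertible modulo `n`, only the class
      -- of j = 2l is left, which is that of lg. The joins give 2x + y + lg there, so the exception
      -- moves by `G` just as the last element does.
      zQ-sum₃ : ∀ {a} → Q a → a ≢ last zQ → ∃₂ λ x y → Edge x y zQ × (2 · x) ∙ y ≡ a
      zQ-sum₃ {a} q a≢ with by-multiples 3 {i₃} {k₃} inv₃ (Q-∙ (Q-∙ q (Q-· 3 (Q-· l g∈Q))) (Q-⁻¹ g∈Q))
      ... | d , j , p , lt , eq with ℕₚ.m≤n⇒m<n∨m≡n (s≤s⁻¹ lt)
      ... | inj₁ lt′ = _ , _ , edge-bind (z-all (P-· S h₃ p)) (edge-run (third d ∙ (G ⁻¹)) g lt′) ,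
        trans (solve ((2 :· ((v₀ :∙ :- v₁) :∙ v₂)) :∙ ((v₀ :∙ :- v₁) :∙ (v₃ :∙ v₂)))
                (((3 :· v₀) :∙ (3 :· v₂)) :∙ (v₃ :∙ :- (3 :· v₁))) (third d ∷ G ∷ (j · g) ∷ g ∷ []) refl)
        (trans (cong (λ t → (t ∙ (3 · (j · g))) ∙ (g ∙ ((3 · G) ⁻¹))) (3·third d))
        (trans (cong (λ t → (d ∙ t) ∙ (g ∙ ((3 · G) ⁻¹))) (sym (·-· 3 j g)))
        (trans (cong (_∙ (g ∙ ((3 · G) ⁻¹))) (sym eq))
          (solve (((v₀ :∙ (3 :· v₁)) :∙ :- v₂) :∙ (v₂ :∙ :- (3 :· v₁))) v₀ (a ∷ G ∷ g ∷ []) refl))))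
      ... | inj₂ refl with z-sum₃ (P-∙ S p ng) (λ eq′ → a≢ (trans a≡ (trans (cong (_∙ G) eq′) (sym last-zQ))))
        where
        a≡ : a ≡ (d ∙ (n · g)) ∙ G
        a≡ = trans (solve v₀ (((v₀ :∙ (3 :· v₁)) :∙ :- v₂) :∙ (v₂ :∙ :- (3 :· v₁))) (a ∷ G ∷ g ∷ []) refl)
          (trans (cong (_∙ (g ∙ ((3 · G) ⁻¹))) (trans eq (cong (d ∙_) (trans (·-· 3 (l + l) g) (cong (3 ·_) 2l)))))
          (trans (solve ((v₀ :∙ (3 :· (v₁ :∙ v₁))) :∙ (v₂ :∙ :- (3 :· v₁))) ((v₀ :∙ (v₂ :∙ (v₁ :∙ v₁))) :∙ v₁)
                   (d ∷ G ∷ g ∷ []) refl)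
            (cong (λ t → (d ∙ (g ∙ t)) ∙ G) (sym 2l))))
      ... | x , y , E , eq′ = _ , _ , edge-join E ,
        trans (cong₂ (λ s t → (2 · s) ∙ t) (last-levels x) (first-levels y))
        (trans (solve ((2 :· (v₀ :∙ v₂)) :∙ (v₁ :∙ :- v₂)) (((2 :· v₀) :∙ v₁) :∙ v₂) (x ∷ y ∷ G ∷ []) refl)
        (trans (cong (_∙ G) eq′)
        (sym (trans (solve v₀ (((v₀ :∙ (3 :· v₁)) :∙ :- v₂) :∙ (v₂ :∙ :- (3 :· v₁))) (a ∷ G ∷ g ∷ []) refl)
          (trans (cong (_∙ (g ∙ ((3 · G) ⁻¹))) (trans eq (cong (d ∙_) (trans (·-· 3 (l + l) g) (cong (3 ·_) 2l)))))
          (trans (solve ((v₀ :∙ (3 :· (v₁ :∙ v₁))) :∙ (v₂ :∙ :- (3 :· v₁))) ((v₀ :∙ (v₂ :∙ (v₁ :∙ v₁))) :∙ v₁)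
                   (d ∷ G ∷ g ∷ []) refl)
            (cong (λ t → (d ∙ (g ∙ t)) ∙ G) (sym 2l))))))))

      zQ-anti : first zQ ≡ last zQ ⁻¹
      zQ-anti = trans (first-bind levels z) (trans (first-levels (first z)) (trans (cong (_∙ (G ⁻¹)) z-anti)
        (trans (solve (:- v₀ :∙ :- v₁) (:- (v₀ :∙ v₁)) (last z ∷ G ∷ []) refl) (cong _⁻¹ (sym last-zQ)))))

      len-levels : ∀ d → len (levels d) ≡ n
      len-levels d = len-run _ g (l + l)

      -- Equal entries at places j < j′ would put (j′ - j)g into `S`, against minimality; at equal
      -- places the injectivity for `z` applies.
      cardQ : Card Q (len zQ)
      cardQ = subst (Card Q) (sym (len-bind levels n z len-levels)) (f′ , f′∈ , λ {i} {k} → inj i k)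
        where
        M = len z
        f = proj₁ card
        f′ : Fin (M * n) → A
        f′ i = f (proj₁ (remQuot n i)) ∙ (toℕ (proj₂ (remQuot {M} n i)) · g)
        f′∈ : ∀ i → Q (f′ i)
        f′∈ i = _ , toℕ (proj₂ (remQuot {M} n i)) , proj₁ (proj₂ card) _ , refl
        clash : ∀ {d d′} j j′ → P S d → P S d′ → j < j′ → j′ < n → d ∙ (j · g) ≢ d′ ∙ (j′ · g)
        clash {d} {d′} j j′ p p′ j<j′ j′<n eq =
          minimal t (ℕₚ.≤-<-trans (subst (_≤ j′) refl (ℕₚ.≤-trans (ℕₚ.m≤n+m (suc t) j) (ℕₚ.≤-reflexive j+t))) j′<n)
            (subst (P S) lem (∙⁻¹ S p p′))
          where
          t = j′ ∸ suc j
          j+t : j + suc t ≡ j′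
          j+t = trans (ℕₚ.+-suc j t) (ℕₚ.m+[n∸m]≡n j<j′)
          lem : d ∙ (d′ ⁻¹) ≡ suc t · g
          lem = trans (solve (v₀ :∙ :- v₁) ((v₀ :∙ v₂) :∙ :- (v₁ :∙ v₂)) (d ∷ d′ ∷ (j · g) ∷ []) refl)
            (trans (cong (_∙ ((d′ ∙ (j · g)) ⁻¹)) (trans eq (cong (d′ ∙_) (trans (cong (_· g) (sym j+t)) (·-+ j (suc t) g)))))
              (solve ((v₁ :∙ (v₂ :∙ v₃)) :∙ :- (v₁ :∙ v₂)) v₃ (d ∷ d′ ∷ (j · g) ∷ (suc t · g) ∷ []) refl))
        inj : ∀ i k → f′ i ≡ f′ k → i ≡ k
        inj i k eq with ℕₚ.<-cmp (toℕ (proj₂ (remQuot {M} n i))) (toℕ (proj₂ (remQuot {M} n k)))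
        ... | tri< lt _ _ = contradiction eq (clash _ _ (proj₁ (proj₂ card) _) (proj₁ (proj₂ card) _) lt (Finₚ.toℕ<n _))
        ... | tri> _ _ gt = contradiction (sym eq) (clash _ _ (proj₁ (proj₂ card) _) (proj₁ (proj₂ card) _) gt (Finₚ.toℕ<n _))
        ... | tri≈ _ same _ = trans (sym (Finₚ.combine-remQuot {M} n i))
          (trans (cong₂ combine
            (proj₂ (proj₂ card) (cancelʳ _ (trans eq (cong (λ t → f (proj₁ (remQuot n k)) ∙ (t · g)) (sym same)))))
            (Finₚ.toℕ-injective same)) (Finₚ.combine-remQuot {M} n k))

      ∈-half : ∀ {X x a} → X? ≡ just X → x ∈ X → a ∈ levels x → a ∈ XQ
      ∈-half eq x∈ a∈ rewrite eq = inʳ (∈-bind x∈ a∈)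

      edge-half : ∀ {X x a b} → X? ≡ just X → x ∈ X → Edge a b (levels x) → Edge a b XQ
      edge-half eq x∈ E rewrite eq = inʳ (edge-bind x∈ E)

      ∈-start : ∀ {a} → a ∈ run g g l′ → a ∈ XQ
      ∈-start p with X?
      ... | nothing = p
      ... | just _  = inˡ p

      edge-start : ∀ {a b} → Edge a b (run g g l′) → Edge a b XQ
      edge-start p with X?
      ... | nothing = p
      ... | just _  = inˡ p

      first-XQ : first XQ ≡ g
      first-XQ with X?
      ... | nothing = first-run g g l′
      ... | just _  = first-run g g l′

      multiple∈ : ∀ {t} → t < l → suc t · g ∈ XQ
      multiple∈ (s≤s lt) = ∈-start (∈-run g g lt)

      data HalfSum (a : A) : Set where
        half-sum : (first XQ ≡ a ⊎ first XQ ≡ a ⁻¹)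
          ⊎ (∃₂ λ x y → Edge x y XQ × (x ∙ y ≡ a ⊎ x ∙ y ≡ a ⁻¹)) → HalfSum a

      -- (2t + 1)g is the sum of tg and (t + 1)g. For t = 0 the left neighbour is the omitted 0,
      -- which is why the first entry itself counts as a sum.
      odd-multiple : ∀ {t a} → t < l → a ≡ suc (t + t) · g ⊎ a ⁻¹ ≡ suc (t + t) · g → HalfSum a
      odd-multiple {zero} {a} lt eq = half-sum (inj₁ (Sum.map st st eq))
        where
        st : ∀ {b} → b ≡ 1 · g → first XQ ≡ b
        st eq = trans first-XQ (trans (sym (identityʳ g)) (sym eq))
      odd-multiple {suc t} {a} (s≤s lt) eq = half-sum (inj₂ (_ , _ , edge-start (edge-run g g lt) ,
        Sum.map st st eq))
        where
        st : ∀ {b} → b ≡ suc (suc t + suc t) · g → (g ∙ (t · g)) ∙ (g ∙ (suc t · g)) ≡ b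
        st eq = trans (solve ((v₀ :∙ v₁) :∙ (v₀ :∙ (v₀ :∙ v₁))) (v₀ :∙ ((v₀ :∙ v₁) :∙ (v₀ :∙ v₁))) (g ∷ (t · g) ∷ []) refl)
          (trans (cong (g ∙_) (sym (·-+ (suc t) (suc t) g))) (sym eq))

      XQ-all : ∀ {a} → Q a → a ≡ ε ⊎ ∃ λ x → x ∈ XQ × (a ≡ x ⊎ a ⁻¹ ≡ x)
      XQ-all {a} q with reduce (Q-∙ q (Q-· l g∈Q))
      ... | d , j , p , lt , eq with X-all p
      ... | inj₂ (X , x , X≡ , x∈ , inj₁ refl) = inj₂ (a , subst (_∈ XQ)
        (trans (solve ((v₀ :∙ :- v₁) :∙ v₂) ((v₀ :∙ v₂) :∙ :- v₁) (d ∷ G ∷ (j · g) ∷ []) refl)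
          (trans (cong (_∙ (G ⁻¹)) (sym eq)) (solve ((v₀ :∙ v₁) :∙ :- v₁) v₀ (a ∷ G ∷ []) refl)))
        (∈-half X≡ x∈ (∈-run (d ∙ (G ⁻¹)) g (s≤s⁻¹ lt))) , inj₁ refl)
      -- The negative of place j in the run around d is place 2l - j in the run around -d.
      ... | inj₂ (X , x , X≡ , x∈ , inj₂ refl) = inj₂ (a ⁻¹ , subst (_∈ XQ)
        (trans (solve ((:- v₀ :∙ :- v₁) :∙ v₃) ((:- (v₀ :∙ v₂) :∙ (v₂ :∙ v₃)) :∙ :- v₁)
            (d ∷ G ∷ (j · g) ∷ ((l + l ∸ j) · g) ∷ []) refl)
          (trans (cong₂ (λ s t → ((s ⁻¹) ∙ t) ∙ (G ⁻¹)) (sym eq)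
              (trans (sym (·-+ j (l + l ∸ j) g)) (trans (cong (_· g) (ℕₚ.m+[n∸m]≡n (s≤s⁻¹ lt))) 2l)))
            (solve ((:- (v₀ :∙ v₁) :∙ (v₁ :∙ v₁)) :∙ :- v₁) (:- v₀) (a ∷ G ∷ []) refl)))
        (∈-half X≡ x∈ (∈-run ((d ⁻¹) ∙ (G ⁻¹)) g (ℕₚ.m∸n≤m (l + l) j))) , inj₂ refl)
      ... | inj₁ refl with ℕₚ.<-cmp j l
      ... | tri≈ _ refl _ = inj₁ (cancelʳ G (trans eq refl))
      ... | tri< j<l _ _ = inj₂ (a ⁻¹ , subst (_∈ XQ)
          (trans (solve v₀ ((v₁ :∙ v₀) :∙ :- v₁) ((suc t · g) ∷ (j · g) ∷ []) refl)
          (trans (cong (_∙ ((j · g) ⁻¹)) (trans (sym (·-+ j (suc t) g)) (cong (_· g) j+t)))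
          (trans (solve (v₁ :∙ :- v₀) (v₁ :∙ :- (:ε :∙ v₀)) ((j · g) ∷ G ∷ []) refl)
          (trans (cong (λ s → G ∙ (s ⁻¹)) (sym eq)) (solve (v₁ :∙ :- (v₀ :∙ v₁)) (:- v₀) (a ∷ G ∷ []) refl)))))
          (multiple∈ (ℕₚ.≤-trans (ℕₚ.m≤n+m (suc t) j) (ℕₚ.≤-reflexive j+t))) , inj₂ refl)
        where
        t = l ∸ suc j
        j+t : j + suc t ≡ l
        j+t = trans (ℕₚ.+-suc j t) (ℕₚ.m+[n∸m]≡n j<l)
      ... | tri> _ _ l<j = inj₂ (a , subst (_∈ XQ)
          (trans (solve v₀ ((v₁ :∙ v₀) :∙ :- v₁) ((suc t · g) ∷ G ∷ []) refl)
          (trans (cong (_∙ (G ⁻¹)) (trans (sym (·-+ l (suc t) g)) (trans (cong (_· g) l+t) (trans (sym (identityˡ _)) (sym eq)))))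
            (solve ((v₀ :∙ v₁) :∙ :- v₁) v₀ (a ∷ G ∷ []) refl)))
          (multiple∈ (ℕₚ.+-cancelˡ-≤ l _ _ (ℕₚ.≤-trans (ℕₚ.≤-reflexive l+t) (s≤s⁻¹ lt)))) , inj₁ refl)
        where
        t = j ∸ suc l
        l+t : l + suc t ≡ j
        l+t = trans (ℕₚ.+-suc l t) (ℕₚ.m+[n∸m]≡n l<j)

      last-start : last (run g g l′) ≡ G
      last-start = last-run g g l′

      XQ-sum : ∀ {a} → Q a → a ≢ ε → HalfSum a
      XQ-sum {a} q a≢ε with class₂ q
      XQ-sum {a} q a≢ε | between p with X-sum p a≢ε
      -- The entry before the first run of `X` is now lg, the end of the run around `ε`, so the sum
      -- 0 + `first X` becomes that of a genuine edge.
      ... | X , X≡ , inj₁ s = half-sum (inj₂ (G , first X ∙ (G ⁻¹) , E , Sum.map st st s))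
        where
        E : Edge G (first X ∙ (G ⁻¹)) XQ
        E rewrite X≡ = join′ last-start (trans (first-bind levels X) (first-levels (first X)))
        st : ∀ {b} → first X ≡ b → G ∙ (first X ∙ (G ⁻¹)) ≡ b
        st refl = solve (v₁ :∙ (v₀ :∙ :- v₁)) v₀ (first X ∷ G ∷ []) refl
      ... | X , X≡ , inj₂ (x , y , E , s) = half-sum (inj₂ (_ , _ , E′ , Sum.map st st s))
        where
        E′ : Edge (last (levels x)) (first (levels y)) XQ
        E′ rewrite X≡ = inʳ (edge-join E)
        st : ∀ {b} → x ∙ y ≡ b → last (levels x) ∙ first (levels y) ≡ b
        st eq = trans (join-sum x y) eq
      XQ-sum {a} q a≢ε | inside d j p lt eq with X-all p
      ... | inj₂ (X , x , X≡ , x∈ , inj₁ refl) = half-sum (inj₂ (_ , _ ,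
        edge-half X≡ x∈ (edge-run (d ∙ (G ⁻¹)) g lt) , inj₁ (trans (level-sum d j) (sym eq))))
      ... | inj₂ (X , x , X≡ , x∈ , inj₂ refl) = half-sum (inj₂ (_ , _ ,
        edge-half X≡ x∈ (edge-run ((d ⁻¹) ∙ (G ⁻¹)) g t<) , inj₂ (trans (level-sum (d ⁻¹) t)
          (trans (trans (solve ((2 :· (:- v₀)) :∙ ((2 :· v₃) :∙ (v₂ :∙ :- (2 :· v₁))))
                   ((:- ((2 :· v₀) :∙ ((2 :· v₄) :∙ (v₂ :∙ :- (2 :· v₁))))) :∙ (2 :· ((v₂ :∙ (v₄ :∙ v₃)) :∙ :- (v₁ :∙ v₁))))
                   (d ∷ G ∷ g ∷ (t · g) ∷ (j · g) ∷ []) refl)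
                 (cong (λ s → (((2 · d) ∙ ((2 · (j · g)) ∙ (g ∙ ((2 · G) ⁻¹)))) ⁻¹) ∙ (2 · (s ∙ ((G ∙ G) ⁻¹))))
                   (trans (sym (trans (cong (_· g) (sym j+t)) (cong (g ∙_) (·-+ j t g)))) 2l)))
          (trans (solve (:- v₀ :∙ (2 :· (v₁ :∙ :- v₁))) (:- v₀) (_ ∷ (G ∙ G) ∷ []) refl) (cong _⁻¹ (sym eq)))))))
        where
        t = l + l ∸ suc j
        j+t : suc (j + t) ≡ l + l
        j+t = ℕₚ.m+[n∸m]≡n lt
        t< : t < l + l
        t< = ℕₚ.≤-trans (s≤s (ℕₚ.m≤n+m t j)) (ℕₚ.≤-reflexive j+t)
      ... | inj₁ d≡ε with j <? l
      ... | yes j<l = odd-multiple (ℕₚ.≤-trans (s≤s (ℕₚ.m≤n+m t j)) (ℕₚ.≤-reflexive j+t)) (inj₂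
          (trans (cong _⁻¹ (trans eq (cong (λ s → (2 · s) ∙ ((2 · (j · g)) ∙ (g ∙ ((2 · G) ⁻¹)))) d≡ε)))
          (trans (cong (λ s → ((2 · ε) ∙ ((2 · (j · g)) ∙ (g ∙ ((2 · s) ⁻¹)))) ⁻¹)
                   (trans (cong (_· g) (sym j+t)) (cong (g ∙_) (·-+ j t g))))
          (trans (solve (:- ((2 :· :ε) :∙ ((2 :· v₀) :∙ (v₂ :∙ :- (2 :· (v₂ :∙ (v₀ :∙ v₁))))))) (v₂ :∙ (v₁ :∙ v₁))
                   ((j · g) ∷ (t · g) ∷ g ∷ []) refl)
            (cong (g ∙_) (sym (·-+ t t g)))))))
        where
        t = l ∸ suc j
        j+t : suc (j + t) ≡ l
        j+t = ℕₚ.m+[n∸m]≡n j<l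
      ... | no j≮l = odd-multiple (ℕₚ.+-cancelˡ-< l _ _ (subst (_< l + l) (sym l+t) lt)) (inj₁
          (trans eq (trans (cong (λ s → (2 · s) ∙ ((2 · (j · g)) ∙ (g ∙ ((2 · G) ⁻¹)))) d≡ε)
          (trans (cong (λ s → (2 · ε) ∙ ((2 · s) ∙ (g ∙ ((2 · G) ⁻¹)))) (trans (cong (_· g) (sym l+t)) (·-+ l t g)))
          (trans (solve ((2 :· :ε) :∙ ((2 :· (v₀ :∙ v₁)) :∙ (v₂ :∙ :- (2 :· v₀)))) (v₂ :∙ (v₁ :∙ v₁)) (G ∷ (t · g) ∷ g ∷ []) refl)
            (cong (g ∙_) (sym (·-+ t t g))))))))
        where
        t = j ∸ l
        l+t : l + t ≡ j
        l+t = ℕₚ.m+[n∸m]≡n (ℕₚ.≮⇒≥ j≮l)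

      last-XQ : last XQ ≡ last zQ
      last-XQ with X? | X-last | X-len
      ... | just X | eq | _ = trans (last-bind levels X) (trans (last-levels (last X)) (trans (cong (_∙ G) (eq refl)) (sym last-zQ)))
      -- Without a second half, `z` has a single element; it is its own negative, hence `ε` by
      -- halving.
      ... | nothing | _ | len≡ = trans last-start (sym (trans last-zQ (trans (cong (_∙ G) (single z len≡ z-anti)) (identityˡ G))))
        where
        two≰ : ∀ (u : Walk A) → 1 ≤ len u
        two≰ [ _ ] = s≤s z≤n
        two≰ (u ⌢ v) = ℕₚ.≤-trans (two≰ u) (ℕₚ.m≤m+n _ _)
        single : ∀ w → len w ≡ 1 → first w ≡ last w ⁻¹ → last w ≡ ε
        single [ a ] _ eq = trans (sym (half·2 a)) (trans (cong (h₂ ·_)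
          (trans (cong (_∙ (1 · a)) eq) (solve (:- v₀ :∙ (1 :· v₀)) :ε (a ∷ []) refl))) (·-ε h₂))
        single (u ⌢ v) eq _ = contradiction (ℕₚ.+-mono-≤ (two≰ u) (two≰ v)) (subst (λ k → ¬ (2 ≤ k)) (sym eq) (λ { (s≤s ()) }))

      len-XQ : len zQ ≡ suc (2 * len XQ)
      len-XQ with X? | X-len
      ... | nothing | eq = trans (len-bind levels n z len-levels) (trans (cong (_* n) eq)
        (trans (arith l) (cong (λ k → suc (2 * k)) (sym (len-run g g l′)))))
        where
        arith : ∀ l → 1 * suc (l + l) ≡ suc (2 * l)
        arith = solve-∀
      ... | just X | eq = trans (len-bind levels n z len-levels) (trans (cong (_* n) eq)
        (trans (arith l (len X)) (cong (λ k → suc (2 * k))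
          (sym (cong₂ _+_ (len-run g g l′) (len-bind levels n X len-levels))))))
        where
        arith : ∀ l x → suc (2 * x) * suc (l + l) ≡ suc (2 * (l + x * suc (l + l)))
        arith = solve-∀

      extend : Lex Q
      extend = record
        { z = zQ ; X? = just XQ ; z-all = zQ-all ; z-sum = zQ-sum ; z-sum₃ = zQ-sum₃ ; z-anti = zQ-anti
        ; z-last = last z , l , z-last , last-zQ
        ; card = cardQ
        ; X-all = λ q → Sum.map₂ (λ (x , p , s) → XQ , x , refl , p , s) (XQ-all q)
        ; X-sum = λ q a≢ε → XQ , refl , unwrap (XQ-sum q a≢ε)
        ; X-last = λ { refl → last-XQ } ; X-len = len-XQ }
        where
        unwrap : ∀ {a} → HalfSum a → _
        unwrap (half-sum s) = s

-- Parity of lengths and the spiral order of levels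

odd? : ℕ → Bool
odd? zero    = false
odd? (suc n) = not (odd? n)

odd?-+ : ∀ m n → odd? (m + n) ≡ odd? m xor odd? n
odd?-+ zero    n = refl
odd?-+ (suc m) n = trans (cong not (odd?-+ m n)) (Boolₚ.not-distribˡ-xor (odd? m) (odd? n))

oddLen-len : {A : Set} (w : Walk A) → oddLen w ≡ odd? (len w)
oddLen-len [ a ]   = refl
oddLen-len (u ⌢ v) = trans (cong₂ _xor_ (oddLen-len u) (oddLen-len v)) (sym (odd?-+ (len u) (len v)))

odd?-2* : ∀ k → odd? (suc (2 * k)) ≡ true
odd?-2* k = cong not (trans (odd?-+ k (k + 0)) (trans (cong (λ t → odd? k xor odd? t) (ℕₚ.+-identityʳ k)) (Boolₚ.xor-same (odd? k))))

-- u, u+2, u+4, …, u+3, u+1: the levels u, …, u+r, ordered so that the sums of neighbours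
-- are 2v for u < v < u+r, and 2(u+r)-1.
spiral : ℕ → ℕ → Walk ℕ
spiral u 0             = [ u ]
spiral u 1             = [ u ] ⌢ [ suc u ]
spiral u (suc (suc r)) = ([ u ] ⌢ spiral (2 + u) r) ⌢ [ suc u ]

-- The spiral climbs through every other level and descends through the rest, so the order within a
-- pair depends on parity; sums do not see it.
Adjacent : {A : Set} → A → A → Walk A → Set
Adjacent x y w = Edge x y w ⊎ Edge y x w

first-spiral : ∀ u r → first (spiral u r) ≡ u
first-spiral u 0 = refl
first-spiral u 1 = refl
first-spiral u (suc (suc r)) = refl

last-spiral : ∀ u r → last (spiral u (suc r)) ≡ suc u
last-spiral u 0 = refl
last-spiral u (suc r) = refl

len-spiral : ∀ u r → len (spiral u r) ≡ suc r
len-spiral u 0 = refl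
len-spiral u 1 = refl
len-spiral u (suc (suc r)) = cong suc (trans (cong (_+ 1) (len-spiral (2 + u) r)) (ℕₚ.+-comm (suc r) 1))

∈-spiral : ∀ u r {i} → i ≤ r → i + u ∈ spiral u r
∈-spiral u 0 z≤n = this
∈-spiral u 1 {zero} le = inˡ this
∈-spiral u 1 {suc zero} le = inʳ this
∈-spiral u 1 {suc (suc i)} (s≤s ())
∈-spiral u (suc (suc r)) {zero} le = inˡ (inˡ this)
∈-spiral u (suc (suc r)) {suc zero} le = inʳ this
∈-spiral u (suc (suc r)) {suc (suc i)} (s≤s (s≤s le)) =
  inˡ (inʳ (subst (_∈ spiral (2 + u) r) (trans (ℕₚ.+-suc i (suc u)) (cong suc (ℕₚ.+-suc i u))) (∈-spiral (2 + u) r le)))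

spiral-skip : ∀ u r {i} → 2 + i ≤ r → Adjacent (i + u) (2 + i + u) (spiral u r)
spiral-skip u (suc (suc r)) {zero} le = inj₁ (inˡ (join′ refl (first-spiral (2 + u) r)))
spiral-skip u 1 (s≤s ())
spiral-skip u 2 {suc zero} (s≤s (s≤s ()))
spiral-skip u (suc (suc (suc r))) {suc zero} le = inj₂ (join′ (last-spiral (2 + u) r) refl)
spiral-skip u (suc (suc r)) {suc (suc i)} (s≤s (s≤s le)) =
  subst₂ (λ x y → Adjacent x y (spiral u (2 + r))) eq (cong (λ t → suc (suc t)) eq)
    (Sum.map (λ E → inˡ (inʳ E)) (λ E → inˡ (inʳ E)) (spiral-skip (2 + u) r {i} le))
  where
  eq : i + suc (suc u) ≡ suc (suc (i + u))
  eq = trans (ℕₚ.+-suc i (suc u)) (cong suc (ℕₚ.+-suc i u))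

spiral-turn : ∀ u r → Adjacent (r + u) (suc r + u) (spiral u (suc r))
spiral-turn u 0 = inj₁ join
spiral-turn u 1 = inj₂ join
spiral-turn u (suc (suc r)) = subst₂ (λ x y → Adjacent x y (spiral u (3 + r))) eq (cong suc eq)
    (Sum.map (λ E → inˡ (inʳ E)) (λ E → inˡ (inʳ E)) (spiral-turn (2 + u) r))
  where
  eq : r + suc (suc u) ≡ suc (suc (r + u))
  eq = trans (ℕₚ.+-suc r (suc u)) (cong suc (ℕₚ.+-suc r u))

-- Growing lists along a chain of subgroups

module Harmonious {A : Set} {_∙_ : A → A → A} {ε : A} {_⁻¹ : A → A}
  (isAb : IsAbelianGroup _≡_ _∙_ ε _⁻¹) {N : ℕ} (fin : Fin N ↔ A)
  {e : ℕ} (torsion : ∀ x → AbelianGroup._·_ isAb e x ≡ ε)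
  (h₂ c₂ : ℕ) (half-eq : 2 * h₂ ≡ 1 + c₂ * e)
  (h₃ c₃ : ℕ) (third-eq : 3 * h₃ ≡ 1 + c₃ * e) where

  open AbelianGroup isAb
  open Lexicographic isAb fin {e} torsion h₂ c₂ half-eq h₃ c₃ third-eq
  open Subgroup

  record Order (S : Subgroup) (g : A) : Set where
    field
      l′      : ℕ
      multiple : P S (suc (suc l′ + suc l′) · g)
      minimal : ∀ j → suc j < suc (suc l′ + suc l′) → ¬ P S (suc j · g)
      i₃ k₃   : ℕ
      inv₃    : 3 * i₃ ≡ 1 + k₃ * suc (suc l′ + suc l′)

  -- If the least multiple of `g` in `S` were 2m or 3m times `g`, halving or thirding would already
  -- put mg into `S`. So the order is odd and prime to 3, and it is not 1 because `g` is outside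
  -- `S`.
  order : ∀ S g → ¬ P S g → Order S g
  order S g g∉ = build (least (λ j → P? S (suc j · g)) (e-pred (positive e half-eq)) (subst (P S) (sym (e-mult (positive e half-eq))) (P-ε S)))
    where
    positive : ∀ e → 2 * h₂ ≡ 1 + c₂ * e → ∃ λ e′ → e ≡ suc e′
    positive (suc e) eq = e , refl
    positive zero eq = contradiction (trans (sym (cong odd? (trans eq (cong suc (ℕₚ.*-zeroʳ c₂)))))
      (trans (odd?-+ h₂ (h₂ + 0)) (trans (cong (λ t → odd? h₂ xor odd? t) (ℕₚ.+-identityʳ h₂)) (Boolₚ.xor-same (odd? h₂))))) λ ()
    e-pred : ∃ (λ e′ → e ≡ suc e′) → ℕ
    e-pred (e′ , _) = e′
    e-mult : ∀ q → suc (e-pred q) · g ≡ ε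
    e-mult (e′ , eq) = trans (cong (_· g) (sym eq)) (torsion g)

    inverse₃ : ∀ m → P S (suc m · g) → (∀ j → j < m → ¬ P S (suc j · g)) → ∀ n → n ≡ suc m → ∃₂ λ i k → 3 * i ≡ 1 + k * n
    inverse₃ m p below n eq with mod3 n
    ... | r1 j = suc (j + j) , 2 , lem j
      where
      lem : ∀ j → 3 * suc (j + j) ≡ 1 + 2 * (1 + j * 3)
      lem = solve-∀
    ... | r2 j = suc j , 1 , lem j
      where
      lem : ∀ j → 3 * suc j ≡ 1 + 1 * (2 + j * 3)
      lem = solve-∀
    inverse₃ m p below .(suc j * 3) eq | r0 (suc j) = contradiction
      (subst (P S) (trans (cong (h₃ ·_) (trans (cong (_· g) (trans (sym eq) (ℕₚ.*-comm (suc j) 3))) (·-· 3 (suc j) g))) (third·3 _))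
        (P-· S h₃ p))
      (below j (ℕₚ.≤-trans (s≤s (ℕₚ.≤-trans (ℕₚ.m≤m*n j 3) (ℕₚ.n≤1+n _))) (ℕₚ.≤-reflexive (ℕₚ.suc-injective eq))))
    
    build : (∃ λ m → P S (suc m · g) × (∀ j → j < m → ¬ P S (suc j · g))) → Order S g
    build (m , p , below) with mod2 m
    ... | even zero = contradiction (subst (P S) (identityʳ g) p) g∉
    ... | odd j = contradiction
      (subst (P S) (trans (cong (h₂ ·_) (trans (cong (_· g) (lem j)) (·-· 2 (suc j) g))) (half·2 _)) (P-· S h₂ p))
      (below j (s≤s (ℕₚ.m≤m+n j j)))
      where
      lem : ∀ j → suc (suc (j + j)) ≡ 2 * suc j
      lem = solve-∀
    ... | even (suc l′) = let i , k , eq = inverse₃ _ p below _ refl in record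
      { l′ = l′ ; multiple = p ; minimal = λ j lt → below j (s≤s⁻¹ lt) ; i₃ = i ; k₃ = k ; inv₃ = eq }

  module ExtendBy (S : Subgroup) (g : A) (o : Order S g) =
    Extend S g (Order.l′ o) (Order.multiple o) (Order.minimal o) (Order.i₃ o) (Order.k₃ o) (Order.inv₃ o)

  private
    -- Each extension lengthens a list without repetitions, so the room left below `N` serves as
    -- fuel.
    Lex-grow : ∀ T fuel S (L : Lex (P S)) → (∀ {a} → P S a → P T a) → N < len (Lex.z L) + fuel → Lex (P T)
    Lex-grow T fuel S L S⊆T lt with search (λ a → P? T a ×-dec ¬? (P? S a))
    ... | no none = Lex-⊆ in-S S⊆T L
      where
      in-S : ∀ {a} → P T a → P S a
      in-S {a} t with P? S a
      ... | yes s = s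
      ... | no ¬s = contradiction (a , t , ¬s) none
    Lex-grow T zero S L S⊆T lt | yes _ =
      contradiction (Card-≤ {P S} (Lex.card L)) (ℕₚ.<⇒≱ (subst (N <_) (ℕₚ.+-identityʳ _) lt))
    Lex-grow T (suc fuel) S L S⊆T lt | yes (g , t , g∉) =
      Lex-grow T fuel extended (extend L) Q⊆T (ℕₚ.<-≤-trans lt bound)
      where
      o = order S g g∉
      open ExtendBy S g o
      Q⊆T : ∀ {a} → Q a → P T a
      Q⊆T (d , j , p , refl) = P-∙ T (S⊆T p) (P-· T j t)
      pos : ∀ (u : Walk A) → 1 ≤ len u
      pos [ _ ]   = s≤s z≤n
      pos (u ⌢ v) = ℕₚ.≤-trans (pos u) (ℕₚ.m≤m+n _ _)
      M = len (Lex.z L)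
      r = Order.l′ o + suc (Order.l′ o)
      bound : M + suc fuel ≤ len (zQ L) + fuel
      bound = ℕₚ.≤-trans (ℕₚ.≤-reflexive (trans (ℕₚ.+-suc M fuel) (cong (_+ fuel) (ℕₚ.+-comm 1 M))))
        (ℕₚ.+-monoˡ-≤ fuel (ℕₚ.≤-trans
          (ℕₚ.+-monoʳ-≤ M (ℕₚ.≤-trans (pos (Lex.z L)) (ℕₚ.m≤m*n M (suc r))))
          (ℕₚ.≤-reflexive (trans (sym (ℕₚ.*-suc M (suc r))) (sym (len-bind levels _ (Lex.z L) (len-levels L)))))))

  lex : ∀ T → Lex (P T)
  lex T = Lex-grow T N trivialSubgroup Lex-trivial (λ { refl → P-ε T }) ℕₚ.≤-refl
    where
    trivialSubgroup : Subgroup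
    trivialSubgroup = record { P = _≡ ε ; P? = _≟ ε ; P-ε = refl
      ; P-∙ = λ { refl refl → identityˡ ε } ; P-⁻¹ = λ { refl → solve (:- :ε) :ε [] refl } }

  -- The most recent generator comes first in the half list, so a first element is prescribed by
  -- making it the final extension.
  lex-from : ∀ T S g → (∀ {a} → P S a → P T a) → P T g → ¬ P S g →
    (∀ {a} → P T a → ∃₂ λ d j → P S d × a ≡ d ∙ (j · g)) →
    Σ (Lex (P T)) λ L → ∃ λ X → Lex.X? L ≡ just X × first X ≡ g
  lex-from T S g S⊆T t g∉ generated =
    Lex-⊆ generated (λ { (d , j , p , refl) → P-∙ T (S⊆T p) (P-· T j t) }) (extend (lex S)) ,
    _ , refl , first-XQ (lex S)
    where open ExtendBy S g (order S g g∉)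

module Signs {A : Set} {_∙_ : A → A → A} {ε : A} {_⁻¹ : A → A}
  (isAb : IsAbelianGroup _≡_ _∙_ ε _⁻¹) where
  open AbelianGroup isAb

  infix 4 _±_
  _±_ : A → A → Set
  x ± a = x ≡ a ⊎ x ≡ a ⁻¹

  sgn : Bool → A → A
  sgn false x = x
  sgn true  x = x ⁻¹

  inv-inv : ∀ x → (x ⁻¹) ⁻¹ ≡ x
  inv-inv x = solve (:- (:- v₀)) v₀ (x ∷ []) refl

  ±-⁻¹ : ∀ {x a} → x ± a → x ⁻¹ ± a
  ±-⁻¹ (inj₁ refl) = inj₂ refl
  ±-⁻¹ (inj₂ refl) = inj₁ (inv-inv _)

  ±-sgn : ∀ b {x a} → x ± a → sgn b x ± a
  ±-sgn false s = s
  ±-sgn true  s = ±-⁻¹ s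

  sgn-∙ : ∀ b x y → sgn b x ∙ sgn b y ≡ sgn b (x ∙ y)
  sgn-∙ false x y = refl
  sgn-∙ true  x y = solve (:- v₀ :∙ :- v₁) (:- (v₀ :∙ v₁)) (x ∷ y ∷ []) refl

  sgn-not : ∀ b x → sgn (not b) x ≡ sgn b (x ⁻¹)
  sgn-not false x = refl
  sgn-not true  x = sym (inv-inv x)

-- The last extension: prescribed ends, and walks through a complement

module Splitting {A : Set} {_∙_ : A → A → A} {ε : A} {_⁻¹ : A → A}
  (isAb : IsAbelianGroup _≡_ _∙_ ε _⁻¹) {N : ℕ} (fin : Fin N ↔ A)
  {e : ℕ} (torsion : ∀ x → AbelianGroup._·_ isAb e x ≡ ε)
  (h₂ c₂ : ℕ) (half-eq : 2 * h₂ ≡ 1 + c₂ * e)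
  (h₃ c₃ : ℕ) (third-eq : 3 * h₃ ≡ 1 + c₃ * e) where

  open AbelianGroup isAb
  open Signs isAb
  open Lexicographic isAb fin {e} torsion h₂ c₂ half-eq h₃ c₃ third-eq
  open Harmonious isAb fin {e} torsion h₂ c₂ half-eq h₃ c₃ third-eq
  open Subgroup

  -- Here l is at least 2, so that the levels 1 and 2 at which the spiral starts and ends both
  -- exist. This excludes only order 3.
  module Split (S : Subgroup) (w : A) (l″ : ℕ)
    (nw : P S (suc (suc (suc l″) + suc (suc l″)) · w))
    (minimal : ∀ j → suc j < suc (suc (suc l″) + suc (suc l″)) → ¬ P S (suc j · w))
    (i₃ k₃ : ℕ) (inv₃ : 3 * i₃ ≡ 1 + k₃ * suc (suc (suc l″) + suc (suc l″)))
    (spans : ∀ a → ∃₂ λ d j → P S d × a ≡ d ∙ (j · w)) (L : Lex (P S)) where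

    open Extend S w (suc l″) nw minimal i₃ k₃ inv₃ public using (l; n; reduce; zQ; cardQ; len-levels; levels)
    open Lex L using (z; X?; z-all; z-sum; z-sum₃; z-anti; z-last)

    W : A
    W = n · w

    neg-rest : ∀ {a d} j i → j + i ≡ n → a ≡ d ∙ (j · w) → a ⁻¹ ≡ ((d ⁻¹) ∙ (W ⁻¹)) ∙ (i · w)
    neg-rest {a} {d} j i eq refl =
      trans (solve (:- (v₀ :∙ v₁)) ((:- v₀ :∙ :- (v₁ :∙ v₂)) :∙ v₂) (d ∷ (j · w) ∷ (i · w) ∷ []) refl)
        (cong (λ s → ((d ⁻¹) ∙ (s ⁻¹)) ∙ (i · w)) (trans (sym (·-+ j i w)) (cong (_· w) eq)))

    level : ∀ a → P S a ⊎ ∃₂ λ u t → u < l × P S t × (t ∙ (suc u · w) ± a)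
    level a with reduce (spans a)
    ... | d , zero , p , lt , eq = inj₁ (subst (P S) (sym (trans eq (identityʳ d))) p)
    ... | d , suc j , p , lt , eq with j <? l
    ... | yes j<l = inj₂ (j , d , j<l , p , inj₁ (sym eq))
    ... | no j≮l = inj₂ (u , _ , u<l , P-∙ S (P-⁻¹ S p) (P-⁻¹ S nw) , inj₂ (sym (neg-rest (suc j) (suc u) rest eq)))
      where
      u = l + l ∸ suc j
      rest : suc j + suc u ≡ n
      rest = trans (ℕₚ.+-suc (suc j) u) (cong suc (ℕₚ.m+[n∸m]≡n (s≤s⁻¹ lt)))
      u<l : u < l
      u<l = ℕₚ.+-cancelˡ-< l _ _ (ℕₚ.≤-trans (ℕₚ.≤-trans (ℕₚ.≤-reflexive (sym (ℕₚ.+-suc l u)))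
        (ℕₚ.+-monoˡ-≤ (suc u) (ℕₚ.≮⇒≥ j≮l))) (s≤s⁻¹ (ℕₚ.≤-reflexive rest)))

    -- Doubling permutes the classes modulo the odd `n`, so up to sign 2, 4, ..., 2l are all the
    -- nonzero ones; spiral sums arrive in this form.
    double : ∀ a → P S a ⊎ ∃₂ λ u t → u < l × P S t × (t ∙ ((suc u + suc u) · w) ± a)
    double a with reduce (spans a)
    ... | d , j , p , lt , eq with mod2 j
    ... | even zero = inj₁ (subst (P S) (sym (trans eq (identityʳ d))) p)
    ... | even (suc u) = inj₂ (u , d , half-≤ u l (s≤s⁻¹ lt) , p , inj₁ (sym eq))
      where
      half-≤ : ∀ u l → suc u + suc u ≤ l + l → u < l
      half-≤ u l le = ℕₚ.≮⇒≥ λ l<u → ℕₚ.<⇒≱ (ℕₚ.+-mono-< l<u l<u) le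
    ... | odd j′ = inj₂ (u , _ , ℕₚ.≤-trans (s≤s (ℕₚ.m≤n+m u j′)) (ℕₚ.≤-reflexive j′+u) ,
        P-∙ S (P-⁻¹ S p) (P-⁻¹ S nw) , inj₂ (sym (neg-rest (suc (j′ + j′)) (suc u + suc u) rest eq)))
      where
      j′<l : j′ < l
      j′<l = ℕₚ.≰⇒> λ l≤j → ℕₚ.<⇒≱ (s≤s⁻¹ lt) (ℕₚ.+-mono-≤ l≤j l≤j)
      u = l ∸ suc j′
      j′+u : suc (j′ + u) ≡ l
      j′+u = ℕₚ.m+[n∸m]≡n j′<l
      rest : suc (j′ + j′) + (suc u + suc u) ≡ n
      rest = trans (lem j′ u) (cong (λ t → suc (t + t)) j′+u)
        where
        lem : ∀ a b → suc (a + a) + (suc b + suc b) ≡ suc (suc (a + b) + suc (a + b))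
        lem = solve-∀

    ys : Walk ℕ
    ys = spiral 1 (suc l″)

    ∈-ys : ∀ {u} → u < l → suc u ∈ ys
    ∈-ys {u} (s≤s le) = subst (_∈ ys) (ℕₚ.+-comm u 1) (∈-spiral 1 (suc l″) le)

    -- Of the levels 2, 4, ..., 2l, the spiral has 4, ..., 2l - 2 as sums, and 2 up to sign, since
    -- its sum 2l - 1 is n - 2. The remaining 2l = n - 1 must come from joins.
    data Neighbours (u : ℕ) : Set where
      middle : ∀ x y → Adjacent x y ys → x < y → x + y ≡ suc u + suc u → Neighbours u
      turn   : ∀ x y → Adjacent x y ys → x < y → (x + y) + 2 ≡ n → u ≡ 0 → Neighbours u
      top    : suc u ≡ l → Neighbours u

    neighbours : ∀ {u} → u < l → Neighbours u
    neighbours {zero} lt = turn (l″ + 1) (suc l″ + 1) (spiral-turn 1 l″) ℕₚ.≤-refl (lem l″) refl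
      where
      lem : ∀ a → ((a + 1) + (suc a + 1)) + 2 ≡ suc (suc (suc a) + suc (suc a))
      lem = solve-∀
    neighbours {suc v} (s≤s (s≤s le)) with ℕₚ.m≤n⇒m<n∨m≡n le
    ... | inj₂ refl = top refl
    ... | inj₁ lt = middle (v + 1) (2 + v + 1) (spiral-skip 1 (suc l″) (s≤s lt)) (s≤s (ℕₚ.n≤1+n _)) (lem v)
      where
      lem : ∀ v → (v + 1) + (2 + v + 1) ≡ suc (suc v) + suc (suc v)
      lem = solve-∀

    swap-edge : ∀ {f : ℕ → A} {w′ : Walk A} {x y} →
      (∀ {s t} → Edge s t ys → Edge (f s) (f t) w′) → Adjacent x y ys →
      ∃₂ λ s t → Edge s t w′ × s ∙ t ≡ f x ∙ f y
    swap-edge h (inj₁ E) = _ , _ , h E , refl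
    swap-edge h (inj₂ E) = _ , _ , h E , comm _ _

    top-double : ∀ {t} → t ∙ ((l + l) · w) ≡ ((t ∙ W) ∙ (w ⁻¹))
    top-double {t} = solve (v₀ :∙ v₁) ((v₀ :∙ (v₂ :∙ v₁)) :∙ :- v₂) (t ∷ ((l + l) · w) ∷ w ∷ []) refl

    -- The shift at level 2, the last one, makes the walk end exactly in 2·w.
    module Prescribed (X₀ : Walk A) (X≡ : X? ≡ just X₀) where
      m : A
      m = last z

      shift : ℕ → A → A
      shift 2 d = (2 · m) ∙ ((2 · d) ⁻¹)
      shift _ d = d

      shift-else : ∀ {y} → y ≢ 2 → ∀ d → shift y d ≡ d
      shift-else {0} _ d = refl
      shift-else {1} _ d = refl
      shift-else {2} y≢2 d = contradiction refl y≢2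
      shift-else {suc (suc (suc y))} _ d = refl

      element : A → ℕ → A
      element d y = (y · w) ∙ shift y d

      piece : Bool × A → Walk A
      piece (b , d) = mapW (λ y → sgn b (element d y)) ys

      -- Doubling permutes `S`, so the doubled `X₀` still serves `S`. The factor 2 is chosen for the
      -- join: 2m + (w - m) = w + m is the one sum of level 1 that consecutive pieces miss.
      X : Walk A
      X = mapW (2 ·_) X₀ ⌢ bind piece (tag false z)

      solve-shift : ∀ y {t} → P S t → ∃ λ d → P S d × shift y d ≡ t
      solve-shift y {t} p with y ℕₚ.≟ 2
      ... | no y≢2 = t , p , shift-else y≢2 t
      ... | yes refl = half ((2 · m) ∙ (t ⁻¹)) , P-· S h₂ (∙⁻¹ S (P-· S 2 z-last) p) ,
        trans (cong (λ s → (2 · m) ∙ (s ⁻¹)) (2·half _))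
          (solve ((2 :· v₀) :∙ :- ((2 :· v₀) :∙ :- v₁)) v₁ (m ∷ t ∷ []) refl)

      -- At most one of two different levels is 2, so the joint shift is 2d or 2m - d, in both cases
      -- a bijection of `S`.
      solve-shifts : ∀ {x y t} → x < y → P S t → ∃ λ d → P S d × shift x d ∙ shift y d ≡ t
      solve-shifts {x} {y} {t} x<y p with x ℕₚ.≟ 2 | y ℕₚ.≟ 2
      ... | yes refl | yes refl = contradiction x<y (ℕₚ.<-irrefl refl)
      ... | yes refl | no y≢2 = (2 · m) ∙ (t ⁻¹) , ∙⁻¹ S (P-· S 2 z-last) p ,
        trans (∙-congˡ (shift-else y≢2 _))
          (solve (((2 :· v₀) :∙ :- (2 :· ((2 :· v₀) :∙ :- v₁))) :∙ ((2 :· v₀) :∙ :- v₁)) v₁ (m ∷ t ∷ []) refl)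
      ... | no x≢2 | yes refl = (2 · m) ∙ (t ⁻¹) , ∙⁻¹ S (P-· S 2 z-last) p ,
        trans (∙-congʳ (shift-else x≢2 _))
          (solve (((2 :· v₀) :∙ :- v₁) :∙ ((2 :· v₀) :∙ :- (2 :· ((2 :· v₀) :∙ :- v₁)))) v₁ (m ∷ t ∷ []) refl)
      ... | no x≢2 | no y≢2 = half t , P-· S h₂ p , trans (cong₂ _∙_ (shift-else x≢2 _) (shift-else y≢2 _))
        (trans (solve (v₀ :∙ v₀) (2 :· v₀) (half t ∷ []) refl) (2·half t))

      ∈-piece : ∀ {u t a} → u < l → P S t → t ∙ (suc u · w) ± a → ∃ λ x → x ∈ X × x ± a
      ∈-piece {u} {t} lt p s with solve-shift (suc u) p
      ... | d , d∈ , eq with ∈-tag false (z-all d∈)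
      ... | b , tagged = _ , inʳ (∈-bind tagged (∈-map _ (∈-ys lt))) ,
        ±-sgn b (subst (_± _) (trans (comm t _) (∙-congˡ (sym eq))) s)

      X-all : ∀ a → a ≡ ε ⊎ ∃ λ x → x ∈ X × x ± a
      X-all a with level a
      ... | inj₂ (u , t , lt , p , s) = inj₂ (∈-piece lt p s)
      ... | inj₁ p with Lex.X-all L (P-· S h₂ p)
      ... | inj₁ eq = inj₁ (trans (sym (2·half a)) (trans (cong (2 ·_) eq) (·-ε 2)))
      ... | inj₂ (_ , x , X≡′ , x∈ , s) with trans (sym X≡) X≡′
      ... | refl = inj₂ (2 · x , inˡ (∈-map (2 ·_) x∈) , Sum.map from₁ from₂ s)
        where
        from₁ : half a ≡ x → 2 · x ≡ a
        from₁ refl = 2·half a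
        from₂ : half a ⁻¹ ≡ x → 2 · x ≡ a ⁻¹
        from₂ refl = trans (solve (2 :· (:- v₀)) (:- (2 :· v₀)) (half a ∷ []) refl) (cong _⁻¹ (2·half a))

      Sum : A → Set
      Sum a = first X ± a ⊎ ∃₂ λ x y → Edge x y X × x ∙ y ± a

      within-piece : ∀ {x y t a} → Adjacent x y ys → x < y → P S t → t ∙ ((x + y) · w) ± a → Sum a
      within-piece {x} {y} {t} adj x<y p s with solve-shifts x<y p
      ... | d , d∈ , eq with ∈-tag false (z-all d∈)
      ... | b , tagged with swap-edge {f = λ v → sgn b (element d v)} (λ E → inʳ (edge-bind tagged (edge-map _ E))) adj
      ... | _ , _ , E , sum = inj₂ (_ , _ , E , subst (_± _) (sym (trans sum (sgn-∙ b _ _)))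
        (±-sgn b (subst (_± _) (sym (trans (interchange _ _ _ _)
          (trans (cong₂ _∙_ (sym (·-+ x y w)) eq) (comm _ _)))) s)))

      -- Levels 2 and 1 with opposite signs leave w, with remainder 2m - (2x + y). By `z-sum₃` only
      -- the remainder m is missing, which is the join after the doubled `X₀`.
      between-pieces : ∀ {t a} → P S t → w ∙ t ± a → Sum a
      between-pieces {t} {a} p s with (((2 · m) ∙ (t ⁻¹))) ≟ m
      ... | yes eq = inj₂ (_ , _ , join′ (trans (last-bind _ X₀) (cong (2 ·_) (Lex.X-last L X≡)))
          (trans (first-bind piece (tag false z)) (cong (λ l → first (piece l)) (first-tag false z))) ,
          subst (_± a) (sym (trans (cong ((2 · m) ∙_) (trans (first-bind _ ys) (trans (cong (λ v → sgn false (element (first z) v)) (first-spiral 1 (suc l″)))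
            (∙-congˡ z-anti)))) (trans (solve ((2 :· v₀) :∙ ((1 :· v₁) :∙ :- v₀)) (v₁ :∙ v₀) (m ∷ w ∷ []) refl) (cong (w ∙_) m≡t)))) s)
        where
        m≡t : m ≡ t
        m≡t = trans (solve v₀ ((2 :· v₀) :∙ :- v₀) (m ∷ []) refl) (trans (cong (λ r → (2 · m) ∙ (r ⁻¹)) (sym eq))
          (solve ((2 :· v₀) :∙ :- ((2 :· v₀) :∙ :- v₁)) v₁ (m ∷ t ∷ []) refl))
      ... | no neq with z-sum₃ (∙⁻¹ S (P-· S 2 z-last) p) neq
      ... | x , y , E , eq with edge-tag false E
      ... | b , E′ = inj₂ (_ , _ , inʳ (edge-join E′) , subst (_± a) (sym (trans (cong₂ _∙_
          (trans (last-bind _ ys) (cong (λ v → sgn b (element x v)) (last-spiral 1 l″)))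
          (trans (first-bind _ ys) (trans (cong (λ v → sgn (not b) (element y v)) (first-spiral 1 (suc l″))) (sgn-not b _))))
          (trans (sgn-∙ b _ _) (cong (sgn b) sum)))) (±-sgn b s))
        where
        sum : ((2 · w) ∙ ((2 · m) ∙ ((2 · x) ⁻¹))) ∙ (((1 · w) ∙ y) ⁻¹) ≡ w ∙ t
        sum = trans (solve (((2 :· v₀) :∙ ((2 :· v₁) :∙ :- (2 :· v₂))) :∙ :- ((1 :· v₀) :∙ v₃))
                (v₀ :∙ ((2 :· v₁) :∙ :- ((2 :· v₂) :∙ v₃))) (w ∷ m ∷ x ∷ y ∷ []) refl)
          (trans (cong (λ r → w ∙ ((2 · m) ∙ (r ⁻¹))) eq)
            (solve (v₀ :∙ ((2 :· v₁) :∙ :- ((2 :· v₁) :∙ :- v₂))) (v₀ :∙ v₂) (w ∷ m ∷ t ∷ []) refl))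

      X-sum : ∀ a → a ≢ ε → Sum a
      X-sum a a≢ε with double a
      ... | inj₂ (u , t , lt , p , s) with neighbours lt
      ...   | middle x y adj x<y x+y = within-piece adj x<y p (subst (λ k → t ∙ (k · w) ± a) (sym x+y) s)
      ...   | turn x y adj x<y x+y refl = within-piece adj x<y (P-∙ S (P-⁻¹ S p) (P-⁻¹ S nw))
                (subst (_± a) (neg-rest 2 (x + y) (trans (ℕₚ.+-comm 2 (x + y)) x+y) refl) (±-⁻¹ s))
      ...   | top refl = between-pieces (P-⁻¹ S (P-∙ S p nw)) (subst (_± a)
                (trans (cong _⁻¹ top-double) (solve (:- (v₀ :∙ :- v₁)) (v₁ :∙ :- v₀) ((t ∙ W) ∷ w ∷ []) refl)) (±-⁻¹ s))
      X-sum a a≢ε | inj₁ p with Lex.X-sum L (P-· S h₂ p) (λ eq → a≢ε (trans (sym (2·half a)) (trans (cong (2 ·_) eq) (·-ε 2))))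
      ... | _ , X≡′ , r with trans (sym X≡) X≡′
      ... | refl = Sum.map
          (λ s → subst (_± a) (sym (first-bind _ X₀)) (twice s))
          (λ (x , y , E , s) → _ , _ , inˡ (edge-map (2 ·_) E) , subst (_± a) (·-∙ 2 x y) (twice s)) r
        where
        twice : ∀ {x} → x ± half a → 2 · x ± a
        twice (inj₁ refl) = inj₁ (2·half a)
        twice (inj₂ refl) = inj₂ (trans (solve (2 :· (:- v₀)) (:- (2 :· v₀)) (half a ∷ []) refl) (cong _⁻¹ (2·half a)))

      X-first : first X ≡ 2 · first X₀
      X-first = first-bind _ X₀

      len-z : len z ≡ suc (2 * len X₀)
      len-z = trans (Lex.X-len L) (cong (λ r → suc (2 * Maybe.maybe len 0 r)) X≡)

      -- The pieces are odd in number, like the entries of `z`, so the last one carries a plus sign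
      -- again; at its end the shift 2m - 2m vanishes.
      X-last : last X ≡ 2 · w
      X-last = trans (last-bind piece (tag false z)) (trans (cong (λ r → last (piece r)) (trans (last-tag false z)
          (cong (λ b → not b , m) (trans (oddLen-len z) (trans (cong odd? len-z) (odd?-2* (len X₀)))))))
        (trans (last-bind _ ys) (trans (cong (element m) (last-spiral 1 l″))
          (solve ((2 :· v₀) :∙ ((2 :· v₁) :∙ :- (2 :· v₁))) (2 :· v₀) (w ∷ m ∷ []) refl))))

      len-X : len z * n ≡ suc (2 * len X)
      len-X = trans (cong (_* n) len-z) (trans (arith l (len X₀)) (cong (λ r → suc (2 * r))
        (sym (cong₂ _+_ (len-map (2 ·_) X₀)
          (trans (len-bind piece l (tag false z) (λ (b , d) → trans (len-map _ ys) (len-spiral 1 (suc l″))))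
            (cong (_* l) (trans (len-tag false z) len-z)))))))
        where
        arith : ∀ l x → suc (2 * x) * suc (l + l) ≡ suc (2 * (x + suc (2 * x) * l))
        arith = solve-∀

    module Complement (κ : A) (κ∈ : P S κ) where
      m : A
      m = last z

      -- Displacing level -2, where every round ends, by `κ` moves the missed sum from -w to κ - w,
      -- and the end of the walk with it.
      bump : ℕ → A
      bump 2 = κ
      bump _ = ε

      bump∈ : ∀ y → P S (bump y)
      bump∈ 0 = P-ε S
      bump∈ 1 = P-ε S
      bump∈ 2 = κ∈
      bump∈ (suc (suc (suc y))) = P-ε S

      above below : A → ℕ → A
      above d y = (y · w) ∙ d
      below d y = ((y · w) ⁻¹) ∙ (d ∙ bump y)

      -- The levels 1, 3, ..., 4, 2, -1, -3, ..., -4, -2. The turn from 2 to -1 gives sums of level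
      -- 1, the passage from -2 to the next round those of level -1.
      round : A → Walk A
      round d = mapW (above d) ys ⌢ mapW (below d) ys

      -- With `z` reversed, `C` starts at w + m just where `z` stops at m, so the jump between the
      -- two is -w whatever m is.
      C : Walk A
      C = bind round (rev z)

      label : ∀ {d} → P S d → d ∈ rev z
      label p = ∈-rev (z-all p)

      C-first : first C ≡ w ∙ m
      C-first = trans (first-bind round (rev z)) (trans (cong (λ d → first (round d)) (first-rev z))
        (trans (first-bind _ ys) (trans (cong (above m) (first-spiral 1 (suc l″))) (cong (_∙ m) (identityʳ w)))))

      last-round : ∀ d → last (round d) ≡ ((2 · w) ⁻¹) ∙ (d ∙ κ)
      last-round d = trans (last-bind _ ys) (cong (below d) (last-spiral 1 l″))

      C-last : last C ≡ ((2 · w) ⁻¹) ∙ ((m ⁻¹) ∙ κ)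
      C-last = trans (last-bind round (rev z)) (trans (cong (λ d → last (round d)) (last-rev z))
        (trans (last-round (first z)) (cong (λ d → ((2 · w) ⁻¹) ∙ (d ∙ κ)) z-anti)))

      C-all : ∀ a → P S a ⊎ a ∈ C
      C-all a with level a
      ... | inj₁ p = inj₁ p
      ... | inj₂ (u , t , lt , p , inj₁ eq) = inj₂ (subst (_∈ C) (trans (comm _ t) eq)
              (∈-bind (label p) (inˡ (∈-map (above t) (∈-ys lt)))))
      ... | inj₂ (u , t , lt , p , inj₂ eq) = inj₂ (subst (_∈ C)
              (trans (solve (:- v₀ :∙ ((:- v₁ :∙ :- v₂) :∙ v₂)) (:- (v₁ :∙ v₀)) ((suc u · w) ∷ t ∷ bump (suc u) ∷ []) refl)
                (trans (cong _⁻¹ eq) (inv-inv a)))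
              (∈-bind (label (∙⁻¹ S (P-⁻¹ S p) (bump∈ (suc u)))) (inʳ (∈-map (below _) (∈-ys lt)))))

      SumC : A → Set
      SumC a = ∃₂ λ x y → Edge x y C × x ∙ y ≡ a

      above-sum : ∀ {x y t} → Adjacent x y ys → P S t → SumC (t ∙ ((x + y) · w))
      above-sum {x} {y} {t} adj p with swap-edge {f = above (half t)}
        (λ E → edge-bind (label (P-· S h₂ p)) (inˡ (edge-map _ E))) adj
      ... | s , s′ , E , eq = s , s′ , E , trans eq (trans (interchange _ _ _ _)
        (trans (cong₂ _∙_ (sym (·-+ x y w)) (trans (solve (v₀ :∙ v₀) (2 :· v₀) (half t ∷ []) refl) (2·half t))) (comm _ t)))

      below-sum : ∀ {x y t} → Adjacent x y ys → P S t → SumC (t ∙ (((x + y) · w) ⁻¹))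
      below-sum {x} {y} {t} adj p with swap-edge {f = below d}
        (λ E → edge-bind (label (P-· S h₂ (∙⁻¹ S p (P-∙ S (bump∈ x) (bump∈ y))))) (inʳ (edge-map _ E))) adj
        where
        d = half (t ∙ ((bump x ∙ bump y) ⁻¹))
      ... | s , s′ , E , eq = s , s′ , E , trans eq (trans
        (solve ((:- v₀ :∙ (v₁ :∙ v₃)) :∙ (:- v₂ :∙ (v₁ :∙ v₄))) (((2 :· v₁) :∙ (v₃ :∙ v₄)) :∙ :- (v₀ :∙ v₂))
          ((x · w) ∷ half (t ∙ ((bump x ∙ bump y) ⁻¹)) ∷ (y · w) ∷ bump x ∷ bump y ∷ []) refl)
        (cong₂ (λ r r′ → (r ∙ (bump x ∙ bump y)) ∙ (r′ ⁻¹)) (2·half _) (sym (·-+ x y w)) ⟨trans⟩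
          cong (_∙ (((x + y) · w) ⁻¹)) (solve ((v₀ :∙ :- v₁) :∙ v₁) v₀ (t ∷ (bump x ∙ bump y) ∷ []) refl)))
        where
        infixr 2 _⟨trans⟩_
        _⟨trans⟩_ : ∀ {a b c : A} → a ≡ b → b ≡ c → a ≡ c
        _⟨trans⟩_ = trans

      -- The one sum outside S that C misses is the sum of its ends.
      ν : A
      ν = (w ⁻¹) ∙ κ

      wrap-sum : ∀ {t} → P S t → SumC ((w ⁻¹) ∙ t) ⊎ (w ⁻¹) ∙ t ≡ ν
      wrap-sum {t} p with (t ∙ (κ ⁻¹)) ≟ ε
      ... | yes eq = inj₂ (cong ((w ⁻¹) ∙_) (trans (solve v₀ ((v₀ :∙ :- v₁) :∙ v₁) (t ∷ κ ∷ []) refl)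
              (trans (cong (_∙ κ) eq) (identityˡ κ))))
      ... | no neq with z-sum (∙⁻¹ S p κ∈) neq
      ... | x , y , E , eq = inj₁ (_ , _ , edge-join (edge-rev E) , trans (cong₂ _∙_ (last-round y)
              (trans (first-bind _ ys) (cong (above x) (first-spiral 1 (suc l″)))))
            (trans (solve ((:- (2 :· v₀) :∙ (v₂ :∙ v₃)) :∙ ((1 :· v₀) :∙ v₁)) (:- v₀ :∙ ((v₁ :∙ v₂) :∙ v₃)) (w ∷ x ∷ y ∷ κ ∷ []) refl)
              (trans (cong (λ r → (w ⁻¹) ∙ (r ∙ κ)) eq) (solve (:- v₂ :∙ ((v₀ :∙ :- v₁) :∙ v₁)) (:- v₂ :∙ v₀) (t ∷ κ ∷ w ∷ []) refl))))

      turn-sum : ∀ {t} → P S t → SumC (w ∙ t)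
      turn-sum {t} p = _ , _ , edge-bind (label (P-· S h₂ p)) join , trans (cong₂ _∙_
          (trans (last-bind _ ys) (cong (above (half t)) (last-spiral 1 l″)))
          (trans (first-bind _ ys) (cong (below (half t)) (first-spiral 1 (suc l″)))))
        (trans (solve (((2 :· v₀) :∙ v₁) :∙ (:- (1 :· v₀) :∙ (v₁ :∙ :ε))) (v₀ :∙ (2 :· v₁)) (w ∷ half t ∷ []) refl)
          (cong (w ∙_) (2·half t)))

      C-sum : ∀ a → P S a ⊎ SumC a ⊎ a ≡ ν
      C-sum a with double a
      ... | inj₁ p = inj₁ p
      ... | inj₂ (u , t , lt , p , s) with neighbours lt | s
      ...   | middle x y adj _ x+y | inj₁ refl = inj₂ (inj₁ (subst (λ k → SumC (t ∙ (k · w))) x+y (above-sum adj p)))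
      ...   | middle x y adj _ x+y | inj₂ eq = inj₂ (inj₁ (subst SumC
                (trans (cong (λ k → (t ⁻¹) ∙ ((k · w) ⁻¹)) x+y) (trans (solve (:- v₀ :∙ :- v₁) (:- (v₀ :∙ v₁)) (t ∷ _ ∷ []) refl)
                  (trans (cong _⁻¹ eq) (inv-inv a)))) (below-sum adj (P-⁻¹ S p))))
      -- As 2 = n - (2l - 1), level 2 is obtained from the negative levels, and level -2 from the
      -- positive ones.
      ...   | turn x y adj _ x+y refl | inj₁ refl = inj₂ (inj₁ (subst SumC
                (trans (solve ((v₀ :∙ (v₁ :∙ v₂)) :∙ :- v₁) (v₀ :∙ v₂) (t ∷ ((x + y) · w) ∷ (2 · w) ∷ []) refl) refl)
                (subst (λ r → SumC ((t ∙ r) ∙ (((x + y) · w) ⁻¹))) (trans (cong (_· w) (sym x+y)) (·-+ (x + y) 2 w)) (below-sum adj (P-∙ S p nw)))))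
      ...   | turn x y adj _ x+y refl | inj₂ eq = inj₂ (inj₁ (subst SumC
                (trans (sym (neg-rest 2 (x + y) (trans (ℕₚ.+-comm 2 (x + y)) x+y) refl)) (trans (cong _⁻¹ eq) (inv-inv a)))
                (above-sum adj (P-∙ S (P-⁻¹ S p) (P-⁻¹ S nw)))))
      ...   | top refl | inj₁ refl = inj₂ (subst (λ r → SumC r ⊎ r ≡ ν) (trans (comm _ _) (sym top-double)) (wrap-sum (P-∙ S p nw)))
      ...   | top refl | inj₂ eq = inj₂ (inj₁ (subst SumC
                (trans (trans (solve (v₁ :∙ :- v₀) (:- (v₀ :∙ :- v₁)) ((t ∙ W) ∷ w ∷ []) refl) (cong _⁻¹ (sym top-double)))
                  (trans (cong _⁻¹ eq) (inv-inv a))) (turn-sum (P-⁻¹ S (P-∙ S p nw)))))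

      len-C : len z + len C ≡ len z * n
      len-C = trans (cong (len z +_) (trans (len-bind round (l + l) (rev z) (λ d → cong₂ _+_ (len-ys _) (len-ys _)))
        (cong (_* (l + l)) (len-rev z)))) (sym (ℕₚ.*-suc (len z) (l + l)))
        where
        len-ys : ∀ (f : ℕ → A) → len (mapW f ys) ≡ l
        len-ys f = trans (len-map f ys) (len-spiral 1 (suc l″))

-- Sequencings as walks

avoids⇒≤ : ∀ {n M} (f : Fin (suc n) → Fin M) (g : Fin M → Fin (suc n)) → (∀ y → f (g y) ≡ y) →
  ∀ k → (∀ y → g y ≢ k) → M ≤ n
avoids⇒≤ f g f∘g k av = Finₚ.injective⇒≤ {f = λ y → punchOut (av y ∘ sym)} λ {y} {y′} e →
  trans (sym (f∘g y)) (trans (cong f (Finₚ.punchOut-injective (av y ∘ sym) (av y′ ∘ sym) e)) (f∘g y′))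

-- A choice of preimages is injective. If i and j had the same image it would miss one of them, and
-- `Fin M` would embed into fewer than n elements.
surjective⇒injective : ∀ {n M} → n ≤ M → (f : Fin n → Fin M) → (∀ y → ∃ λ x → f x ≡ y) →
  ∀ {i j} → f i ≡ f j → i ≡ j
surjective⇒injective {suc n} {M} n≤M f onto {i} {j} eq with i Finₚ.≟ j | proj₁ (onto (f i)) Finₚ.≟ i
... | yes i≡j | _ = i≡j
... | no i≢j | yes hits = contradiction n≤M (ℕₚ.<⇒≱ (s≤s (avoids⇒≤ f (proj₁ ∘ onto) (proj₂ ∘ onto) j λ y eq′ → i≢j (trans (sym hits)
        (trans (cong (proj₁ ∘ onto) (trans eq (trans (cong f (sym eq′)) (proj₂ (onto y))))) eq′)))))
... | no i≢j | no misses = contradiction n≤M (ℕₚ.<⇒≱ (s≤s (avoids⇒≤ f (proj₁ ∘ onto) (proj₂ ∘ onto) i λ y eq′ → misses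
        (trans (cong (proj₁ ∘ onto) (trans (cong f (sym eq′)) (proj₂ (onto y)))) eq′))))

module _ {G : Set} where
  rest : Walk G → List G
  rest [ a ]   = []
  rest (u ⌢ v) = rest u ++ first v ∷ rest v

  vertices : Walk G → List G
  vertices w = first w ∷ rest w

  length-vertices : ∀ w → length (vertices w) ≡ len w
  length-vertices [ a ]   = refl
  length-vertices (u ⌢ v) = trans (cong suc (Listₚ.length-++ (rest u)))
    (cong₂ _+_ (length-vertices u) (length-vertices v))

  lookup-++ʳ : ∀ (x : G) xs y ys i → List.lookup (y ∷ ys) i ≡ x → ∃ λ k → List.lookup (xs ++ y ∷ ys) k ≡ x
  lookup-++ʳ x []       y ys i eq = i , eq
  lookup-++ʳ x (z ∷ xs) y ys i eq = let k , eq′ = lookup-++ʳ x xs y ys i eq in suc k , eq′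

  lookup-++ˡ : ∀ (x : G) xs ys i → List.lookup xs i ≡ x → ∃ λ k → List.lookup (xs ++ ys) k ≡ x
  lookup-++ˡ x (z ∷ xs) ys zero    eq = zero , eq
  lookup-++ˡ x (z ∷ xs) ys (suc i) eq = let k , eq′ = lookup-++ˡ x xs ys i eq in suc k , eq′

  ∈-vertices : ∀ {x w} → x ∈ w → ∃ λ i → List.lookup (vertices w) i ≡ x
  ∈-vertices this = zero , refl
  ∈-vertices {x} (inˡ {u} {v} p) = let i , eq = ∈-vertices p in lookup-++ˡ x (vertices u) (vertices v) i eq
  ∈-vertices {x} (inʳ {u} {v} p) = let i , eq = ∈-vertices p in lookup-++ʳ x (vertices u) (first v) (rest v) i eq

module Sequencing {G : Set} {M : ℕ} (fin : Fin M ↔ G) (_·_ : G → G → G) (e : G)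
  (assoc : ∀ x y z → (x · y) · z ≡ x · (y · z)) (identityʳ : ∀ x → x · e ≡ x)
  (_\\_ : G → G → G) (\\-· : ∀ x y → x \\ (x · y) ≡ y) (·-\\ : ∀ x y → x · (x \\ y) ≡ y) where

  steps : (x : G) (xs : List G) → Fin (length xs) → G
  steps x (y ∷ ys) zero    = x \\ y
  steps x (y ∷ ys) (suc i) = steps y ys i

  -- Partial products are the vertices up to left translation by the starting vertex, so
  -- distinctness can be checked on the vertices.
  partials-steps : ∀ x xs a y → a · y ≡ x → ∀ i → a · partialsFrom _·_ y (steps x xs) i ≡ List.lookup (x ∷ xs) i
  partials-steps x []       a y eq zero = eq
  partials-steps x (z ∷ xs) a y eq zero = eq
  partials-steps x (z ∷ xs) a y eq (suc i) = partials-steps z xs a _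
    (trans (sym (assoc a y _)) (trans (cong (_· (x \\ z)) eq) (·-\\ x z))) i

  steps-++ʳ : ∀ x xs y ys i s → steps y ys i ≡ s → ∃ λ k → steps x (xs ++ y ∷ ys) k ≡ s
  steps-++ʳ x []       y ys i s eq = suc i , eq
  steps-++ʳ x (z ∷ xs) y ys i s eq = let k , eq′ = steps-++ʳ z xs y ys i s eq in suc k , eq′

  steps-++ˡ : ∀ x xs ys i s → steps x xs i ≡ s → ∃ λ k → steps x (xs ++ ys) k ≡ s
  steps-++ˡ x (z ∷ xs) ys zero    s eq = zero , eq
  steps-++ˡ x (z ∷ xs) ys (suc i) s eq = let k , eq′ = steps-++ˡ z xs ys i s eq in suc k , eq′

  steps-join : ∀ u y ys → ∃ λ k → steps (first u) (rest u ++ y ∷ ys) k ≡ last u \\ y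
  steps-join [ a ]   y ys = zero , refl
  steps-join (u ⌢ v) y ys with steps-join v y ys
  ... | k , eq with steps-++ʳ (first u) (rest u) (first v) (rest v ++ y ∷ ys) k _ eq
  ... | k′ , eq′ = subst (λ l → ∃ λ k → steps (first u) l k ≡ last v \\ y)
    (sym (Listₚ.++-assoc (rest u) (first v ∷ rest v) (y ∷ ys))) (k′ , eq′)

  edge-steps : ∀ {x y w} → Edge x y w → ∃ λ i → steps (first w) (rest w) i ≡ x \\ y
  edge-steps (join {u} {v}) = steps-join u (first v) (rest v)
  edge-steps (inˡ {u = u} E) = let i , eq = edge-steps E in steps-++ˡ _ (rest u) _ i _ eq
  edge-steps (inʳ {u = u} E) = let i , eq = edge-steps E in steps-++ʳ _ (rest u) _ _ i _ eq

  sequenceable : ∀ w → len w ≤ M → (∀ x → x ∈ w) → (∀ s → s ≡ e ⊎ ∃ λ x → Edge x (x · s) w) → Sequenceable G _·_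
  sequenceable w len≤ all realised = length (rest w) , s ,
    (injective s onto , λ y → let i , eq = onto y in i , λ z≡i → trans (cong s z≡i) eq) ,
    λ {i} {j} eq → injective (List.lookup (vertices w)) (λ x → ∈-vertices (all x))
      (trans (sym (at i)) (trans (cong (first w ·_) eq) (at j)))
    where
    s : Fin (suc (length (rest w))) → G
    s zero    = e
    s (suc i) = steps (first w) (rest w) i

    at : ∀ i → first w · partials _·_ s i ≡ List.lookup (vertices w) i
    at = partials-steps (first w) (rest w) (first w) e (identityʳ (first w))

    onto : ∀ y → ∃ λ i → s i ≡ y
    onto y with realised y
    ... | inj₁ refl = zero , refl
    ... | inj₂ (x , E) = let i , eq = edge-steps E in suc i , trans eq (\\-· x y)

    injective : (f : Fin (length (vertices w)) → G) → (∀ y → ∃ λ i → f i ≡ y) → ∀ {i j} → f i ≡ f j → i ≡ j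
    injective f f-onto eq = surjective⇒injective (ℕₚ.≤-trans (ℕₚ.≤-reflexive (length-vertices w)) len≤)
      (Inverse.from fin ∘ f)
      (λ y → let i , eq′ = f-onto (Inverse.to fin y) in i , trans (cong (Inverse.from fin) eq′) (Inverse.strictlyInverseʳ fin y))
      (cong (Inverse.from fin) eq)
 

-- The walk through the semidirect product

iter-+ : ∀ {A : Set} (f : A → A) m n x → iter f (m + n) x ≡ iter f m (iter f n x)
iter-+ f zero    n x = refl
iter-+ f (suc m) n x = cong f (iter-+ f m n x)

module Residues (q′ : ℕ) where
  q : ℕ
  q = suc q′

  abstract
    F : ℕ → Fin q
    F n = n mod q

    F-cong-% : ∀ m n → m % q ≡ n % q → F m ≡ F n
    F-cong-% m n eq = Finₚ.fromℕ<-cong _ _ eq (m%n<n m q) (m%n<n n q)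

    F-mod : ∀ n → n mod q ≡ F n
    F-mod n = refl

    F-zero : F 0 ≡ zero
    F-zero = refl

    toℕ-F : ∀ n → toℕ (F n) ≡ n % q
    toℕ-F n = Finₚ.toℕ-fromℕ< (m%n<n n q)

    F-+ : ∀ m n → F m +ᶠ F n ≡ F (m + n)
    F-+ m n = trans (cong₂ (λ a b → F (a + b)) (toℕ-F m) (toℕ-F n)) (F-cong-% (m % q + n % q) (m + n) (trans (%-distribˡ-+ (m % q) (n % q) q)
      (trans (cong₂ (λ a b → (a + b) % q) (lem m) (lem n)) (sym (%-distribˡ-+ m n q)))))
      where
      lem : ∀ m → (m % q) % q ≡ m % q
      lem m = m<n⇒m%n≡m (m%n<n m q)

    F-q+ : ∀ n → F (q + n) ≡ F n
    F-q+ n = F-cong-% (q + n) n (trans (cong (_% q) (ℕₚ.+-comm q n)) ([m+n]%n≡m%n n q))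

    F-toℕ : ∀ v → F (toℕ v) ≡ v
    F-toℕ v = Finₚ.toℕ-injective (trans (toℕ-F (toℕ v)) (m<n⇒m%n≡m (Finₚ.toℕ<n v)))

  +ᶠ-assoc : ∀ (i j k : Fin q) → (i +ᶠ j) +ᶠ k ≡ i +ᶠ (j +ᶠ k)
  +ᶠ-assoc i j k = subst (λ i → (i +ᶠ j) +ᶠ k ≡ i +ᶠ (j +ᶠ k)) (F-toℕ i) (subst (λ j → (F a +ᶠ j) +ᶠ k ≡ F a +ᶠ (j +ᶠ k)) (F-toℕ j)
    (subst (λ k → (F a +ᶠ F b) +ᶠ k ≡ F a +ᶠ (F b +ᶠ k)) (F-toℕ k)
      (trans (cong (_+ᶠ F c) (F-+ a b)) (trans (F-+ (a + b) c) (trans (cong F (ℕₚ.+-assoc a b c))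
        (sym (trans (cong (F a +ᶠ_) (F-+ b c)) (F-+ a (b + c)))))))))
    where
    a = toℕ i
    b = toℕ j
    c = toℕ k

  +ᶠ-comm : ∀ (i j : Fin q) → i +ᶠ j ≡ j +ᶠ i
  +ᶠ-comm i j = cong (_mod q) (ℕₚ.+-comm (toℕ i) (toℕ j))

  +ᶠ-identityʳ : ∀ i → i +ᶠ F 0 ≡ i
  +ᶠ-identityʳ i = trans (cong (_+ᶠ F 0) (sym (F-toℕ i))) (trans (F-+ (toℕ i) 0) (trans (cong F (ℕₚ.+-identityʳ (toℕ i))) (F-toℕ i)))

  +ᶠ-identityˡ : ∀ i → F 0 +ᶠ i ≡ i
  +ᶠ-identityˡ i = trans (+ᶠ-comm (F 0) i) (+ᶠ-identityʳ i)

  −ᶠ_ : Fin q → Fin q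
  −ᶠ i = F (q ∸ toℕ i)

  +ᶠ-inverseˡ : ∀ i → (−ᶠ i) +ᶠ i ≡ F 0
  +ᶠ-inverseˡ i = trans (cong ((−ᶠ i) +ᶠ_) (sym (F-toℕ i))) (trans (F-+ (q ∸ toℕ i) (toℕ i))
    (trans (cong F (trans (ℕₚ.m∸n+n≡m (ℕₚ.<⇒≤ (Finₚ.toℕ<n i))) (sym (ℕₚ.+-identityʳ q)))) (F-q+ 0)))

  +ᶠ-inverseʳ : ∀ i → i +ᶠ (−ᶠ i) ≡ F 0
  +ᶠ-inverseʳ i = trans (+ᶠ-comm i (−ᶠ i)) (+ᶠ-inverseˡ i)

  module Periodic {A : Set} (α : A → A) (period : ∀ x → iter α q x ≡ x) where
    iter-* : ∀ k x → iter α (k * q) x ≡ x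
    iter-* zero    x = refl
    iter-* (suc k) x = trans (iter-+ α q (k * q) x) (trans (period _) (iter-* k x))

    iter-% : ∀ n x → iter α (n % q) x ≡ iter α n x
    iter-% n x = sym (trans (cong (λ k → iter α k x) (m≡m%n+[m/n]*n n q))
      (trans (iter-+ α (n % q) _ x) (cong (iter α (n % q)) (iter-* (n / q) x))))

    iter-F : ∀ n x → iter α (toℕ (F n)) x ≡ iter α n x
    iter-F n x = trans (cong (λ k → iter α k x) (toℕ-F n)) (iter-% n x)

module Hom {A : Set} {_∙_ : A → A → A} {ε : A} {_⁻¹ : A → A}
  (isAb : IsAbelianGroup _≡_ _∙_ ε _⁻¹) (α : A → A) (α-∙ : ∀ x y → α (x ∙ y) ≡ α x ∙ α y) where
  open AbelianGroup isAb

  α-ε : α ε ≡ ε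
  α-ε = cancelʳ (α ε) (trans (sym (α-∙ ε ε)) (trans (cong α (identityˡ ε)) (sym (identityˡ (α ε)))))

  α-⁻¹ : ∀ x → α (x ⁻¹) ≡ α x ⁻¹
  α-⁻¹ x = cancelʳ (α x) (trans (sym (α-∙ (x ⁻¹) x)) (trans (cong α (inverseˡ x)) (trans α-ε (sym (inverseˡ (α x))))))

  iter-∙ : ∀ n x y → iter α n (x ∙ y) ≡ iter α n x ∙ iter α n y
  iter-∙ zero    x y = refl
  iter-∙ (suc n) x y = trans (cong α (iter-∙ n x y)) (α-∙ _ _)

  iter-ε : ∀ n → iter α n ε ≡ ε
  iter-ε zero    = refl
  iter-ε (suc n) = trans (cong α (iter-ε n)) α-ε

  iter-⁻¹ : ∀ n x → iter α n (x ⁻¹) ≡ iter α n x ⁻¹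
  iter-⁻¹ zero    x = refl
  iter-⁻¹ (suc n) x = trans (cong α (iter-⁻¹ n x)) (α-⁻¹ _)

-- `P` is walked through by `C₁` and its complement by `C₂`; `turning` is the jump inside fibre -s.
-- The two cases of `shape` are h odd and h even, and `r` is the power of `α` that carries the
-- missed step from the special block to fibre h.
module Construction {A : Set} {_∙_ : A → A → A} {ε : A} {_⁻¹ : A → A}
  (isAb : IsAbelianGroup _≡_ _∙_ ε _⁻¹)
  (half : A → A) (2·half : ∀ x → AbelianGroup._·_ isAb 2 (half x) ≡ x)
  (_≟_ : DecidableEquality A)
  (h : ℕ) (α : A → A) (α-∙ : ∀ x y → α (x ∙ y) ≡ α x ∙ α y) (period : ∀ x → iter α (suc (h + h)) x ≡ x)
  (X : Walk A) (X-all : ∀ a → a ≡ ε ⊎ ∃ λ x → x ∈ X × (x ≡ a ⊎ x ≡ a ⁻¹))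
  (X-sum : ∀ a → a ≢ ε → (first X ≡ a ⊎ first X ≡ a ⁻¹) ⊎ ∃₂ λ x y → Edge x y X × (x ∙ y ≡ a ⊎ x ∙ y ≡ a ⁻¹))
  (P : A → Set) (P-half : ∀ {a} → P a → P (half a)) (P-double : ∀ {a} → P (half a) → P a)
  (C₁ C₂ : Walk A) (C₁-all : ∀ {a} → P a → a ∈ C₁)
  (C₁-sum : ∀ {a} → P a → a ≢ ε → ∃₂ λ x y → Edge x y C₁ × x ∙ y ≡ a)
  (C₂-all : ∀ a → P a ⊎ a ∈ C₂)
  (ν : A) (C₂-sum : ∀ a → P a ⊎ (∃₂ λ x y → Edge x y C₂ × x ∙ y ≡ a) ⊎ a ≡ ν)
  (N : ℕ) (len-X : suc (2 * len X) ≤ N) (len-C : len C₁ + len C₂ ≤ N)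
  (s : ℕ) (0<s : 0 < s) (s≤h : s ≤ h)
  (turning : last C₁ ∙ (first C₂ ⁻¹) ≡ iter α (suc (h + h) ∸ s) (first X ⁻¹))
  (offset : A) (r : ℕ)
  (shape : (offset ≡ ν × suc h ≡ s + s × r ≡ h + s) ⊎ (offset ≡ ε × h ≡ s + s × r ≡ s))
  (finish : Signs.sgn isAb (oddLen X) (last X) ≡ ((first X ∙ (first C₁ ⁻¹)) ∙ last C₂) ∙ (iter α r ν ⁻¹)) where

  open AbelianGroup isAb
  open Signs isAb
  open Hom isAb α α-∙
  open Residues (h + h)
  open Periodic α period

  G : Set
  G = A × Fin q

  iter-injective : ∀ {n y} → n ≤ q → iter α n y ≡ ε → y ≡ ε
  iter-injective {n} {y} le eq = trans (sym (period y)) (trans (cong (λ k → iter α k y) (sym (ℕₚ.m∸n+n≡m le)))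
    (trans (iter-+ α (q ∸ n) n y) (trans (cong (iter α (q ∸ n)) eq) (iter-ε (q ∸ n)))))

  -- `Y` is γ_1, ..., γ_K: tagging starts with `true`, hence with a minus sign.
  Y Zₛ Zₑ zA : Walk A
  Y  = mapW (λ (b , x) → sgn b x) (tag true X)
  Zₛ = rev (mapW _⁻¹ Y)
  Zₑ = rev Y ⌢ [ ε ]
  zA = rev (mapW _⁻¹ X) ⌢ ([ ε ] ⌢ X)

  first-Y : first Y ≡ first X ⁻¹
  first-Y = trans (first-bind _ (tag true X)) (cong (λ (b , x) → sgn b x) (first-tag true X))

  last-Y : last Y ≡ sgn (oddLen X) (last X)
  last-Y = trans (last-bind _ (tag true X)) (trans (cong (λ (b , x) → sgn b x) (last-tag true X))
    (cong (λ b → sgn b (last X)) (Boolₚ.not-involutive (oddLen X))))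

  zA-all : ∀ a → a ∈ zA
  zA-all a with X-all a
  ... | inj₁ refl = inʳ (inˡ this)
  ... | inj₂ (x , x∈ , inj₁ refl) = inʳ (inʳ x∈)
  ... | inj₂ (x , x∈ , inj₂ refl) = subst (_∈ zA) (inv-inv a) (inˡ (∈-rev (∈-map _⁻¹ x∈)))

  zA-sum : ∀ {a} → a ≢ ε → ∃₂ λ x y → Edge x y zA × x ∙ y ≡ a
  zA-sum {a} a≢ε with X-sum a a≢ε
  ... | inj₁ (inj₁ refl) = _ , _ , inʳ join , identityˡ _
  ... | inj₁ (inj₂ eq) = _ , _ , join , trans (identityʳ _) (trans (last-rev (mapW _⁻¹ X)) (trans (first-bind _ X)
          (trans (cong _⁻¹ eq) (inv-inv a))))
  ... | inj₂ (x , y , E , inj₁ refl) = _ , _ , inʳ (inʳ E) , refl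
  ... | inj₂ (x , y , E , inj₂ eq) = _ , _ , inˡ (edge-rev (edge-map _⁻¹ E)) ,
          trans (solve (:- v₁ :∙ :- v₀) (:- (v₀ :∙ v₁)) (x ∷ y ∷ []) refl) (trans (cong _⁻¹ eq) (inv-inv a))

  first-zA : first zA ≡ last X ⁻¹
  first-zA = trans (first-rev (mapW _⁻¹ X)) (last-bind _ X)

  len-zA : len zA ≡ suc (2 * len X)
  len-zA = trans (cong (_+ (1 + len X)) (trans (len-rev (mapW _⁻¹ X)) (len-map _⁻¹ X))) (arith (len X))
    where
    arith : ∀ x → x + (1 + x) ≡ suc (2 * x)
    arith = solve-∀

  Move : Walk G → Fin q → Fin q → A → Set
  Move w i i′ δ = ∃₂ λ a b → Edge (a , i) (b , i′) w × b ≡ a ∙ δ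

  Move-map : ∀ {w w′ i i′ δ} → (∀ {g g′} → Edge g g′ w → Edge g g′ w′) → Move w i i′ δ → Move w′ i i′ δ
  Move-map f (a , b , E , eq) = a , b , f E , eq

  -- Along zA the moves from fibre i to i′ are -2t and those back are the sums of neighbours.
  module Ordinary (E : A) (i i′ : Fin q) where
    -- `zA` runs from -x_K to x_K, so with this centre the block is entered and left at the same
    -- `E`, and the link to the next block is a move by 0.
    o : A
    o = E ∙ last X

    pair : A → Walk G
    pair t = [ o ∙ t , i ] ⌢ [ o ∙ (t ⁻¹) , i′ ]

    walk : Walk G
    walk = bind pair zA

    first-walk : first walk ≡ (E , i)
    first-walk = trans (first-bind pair zA) (cong (_, i) (trans (∙-congˡ first-zA)
      (solve ((v₀ :∙ v₁) :∙ :- v₁) v₀ (E ∷ last X ∷ []) refl)))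

    last-walk : last walk ≡ (E , i′)
    last-walk = trans (last-bind pair zA) (cong (_, i′) (solve ((v₀ :∙ v₁) :∙ :- v₁) v₀ (E ∷ last X ∷ []) refl))

    ∈-walk : ∀ a → (a , i) ∈ walk
    ∈-walk a = subst (λ b → (b , i) ∈ walk) (solve (v₀ :∙ (:- v₀ :∙ v₁)) v₁ (o ∷ a ∷ []) refl)
      (∈-bind (zA-all ((o ⁻¹) ∙ a)) (inˡ this))

    ∈-walk′ : ∀ a → (a , i′) ∈ walk
    ∈-walk′ a = subst (λ b → (b , i′) ∈ walk) (solve (v₀ :∙ :- (v₀ :∙ :- v₁)) v₁ (o ∷ a ∷ []) refl)
      (∈-bind (zA-all (o ∙ (a ⁻¹))) (inʳ this))

    move : ∀ δ → Move walk i i′ δ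
    move δ = _ , _ , edge-bind (zA-all (half δ ⁻¹)) join ,
      trans (solve (v₀ :∙ :- (:- v₁)) ((v₀ :∙ :- v₁) :∙ (2 :· v₁)) (o ∷ half δ ∷ []) refl) (∙-congˡ (2·half δ))

    move′ : ∀ {δ} → δ ≢ ε → Move walk i′ i δ
    move′ δ≢ε with zA-sum δ≢ε
    ... | x , y , E , refl = _ , _ , edge-join E , solve (v₀ :∙ v₂) ((v₀ :∙ :- v₁) :∙ (v₁ :∙ v₂)) (o ∷ x ∷ y ∷ []) refl

    len-walk : len walk ≤ N * 2
    len-walk = ℕₚ.≤-trans (ℕₚ.≤-reflexive (trans (len-bind pair 2 zA (λ _ → refl)) (cong (_* 2) len-zA)))
      (ℕₚ.*-monoˡ-≤ 2 len-X)

  -- Blocks before the special one are entered and left at `E₀`, those after it at `E₁`; `e` makes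
  -- the special block itself start at `E₀`.
  E₀ E₁ e : A
  E₀ = first X
  e  = E₀ ∙ (first C₁ ⁻¹)
  E₁ = e ∙ last C₂

  -- Two such walks in one, in opposite orientations: the jump between them stays within the
  -- fibre i′, and each direction misses a single value.
  module Special where
    i i′ : Fin q
    i  = F s
    i′ = F (q ∸ s)

    up down : A → G
    up t   = e ∙ t , i
    down t = (e ∙ offset) ∙ (t ⁻¹) , i′

    pair₁ pair₂ : A → Walk G
    pair₁ t = [ up t ] ⌢ [ down t ]
    pair₂ t = [ down t ] ⌢ [ up t ]

    walk : Walk G
    walk = bind pair₁ C₁ ⌢ bind pair₂ C₂

    first-walk : first walk ≡ (E₀ , i)
    first-walk = trans (first-bind pair₁ C₁) (cong (_, i) (solve ((v₀ :∙ :- v₁) :∙ v₁) v₀ (E₀ ∷ first C₁ ∷ []) refl))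

    last-walk : last walk ≡ (E₁ , i)
    last-walk = last-bind pair₂ C₂

    both-∈ : ∀ t → up t ∈ walk × down t ∈ walk
    both-∈ t with C₂-all t
    ... | inj₁ p = inˡ (∈-bind (C₁-all p) (inˡ this)) , inˡ (∈-bind (C₁-all p) (inʳ this))
    ... | inj₂ p = inʳ (∈-bind p (inʳ this)) , inʳ (∈-bind p (inˡ this))

    ∈-walk : ∀ a → (a , i) ∈ walk
    ∈-walk a = subst (λ b → (b , i) ∈ walk) (solve (v₀ :∙ (:- v₀ :∙ v₁)) v₁ (e ∷ a ∷ []) refl) (proj₁ (both-∈ ((e ⁻¹) ∙ a)))

    ∈-walk′ : ∀ a → (a , i′) ∈ walk
    ∈-walk′ a = subst (λ b → (b , i′) ∈ walk) (solve (v₀ :∙ :- (v₀ :∙ :- v₁)) v₁ ((e ∙ offset) ∷ a ∷ []) refl)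
      (proj₂ (both-∈ ((e ∙ offset) ∙ (a ⁻¹))))

    descend : ∀ {t t′ δ} → Edge (up t) (down t′) walk → t ∙ t′ ≡ offset ∙ (δ ⁻¹) → Move walk i i′ δ
    descend {t} {t′} {δ} E eq = _ , _ , E ,
      trans (solve ((v₀ :∙ v₁) :∙ :- v₃) ((v₀ :∙ v₂) :∙ (v₁ :∙ :- (v₂ :∙ v₃))) (e ∷ offset ∷ t ∷ t′ ∷ []) refl)
      (∙-congˡ (trans (cong (λ a → offset ∙ (a ⁻¹)) eq) (solve (v₀ :∙ :- (v₀ :∙ :- v₁)) v₁ (offset ∷ δ ∷ []) refl)))

    ascend : ∀ {t t′ δ} → Edge (down t) (up t′) walk → t ∙ t′ ≡ offset ∙ δ → Move walk i′ i δ
    ascend {t} {t′} {δ} E eq = _ , _ , E ,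
      trans (solve (v₀ :∙ v₃) (((v₀ :∙ v₁) :∙ :- v₂) :∙ (:- v₁ :∙ (v₂ :∙ v₃))) (e ∷ offset ∷ t ∷ t′ ∷ []) refl)
      (∙-congˡ (trans (cong ((offset ⁻¹) ∙_) eq) (solve (:- v₀ :∙ (v₀ :∙ v₁)) v₁ (offset ∷ δ ∷ []) refl)))

    halves : ∀ a → half a ∙ half a ≡ a
    halves a = trans (solve (v₀ :∙ v₀) (2 :· v₀) (half a ∷ []) refl) (2·half a)

    -- Along `C₁` the two parameters agree and their sum is 2t with t in `P`; along `C₂` it is a sum
    -- of neighbours, which outside `P` is anything but `ν`.
    move : ∀ δ → Move walk i i′ δ ⊎ δ ≡ offset ∙ (ν ⁻¹)
    move δ with C₂-sum (offset ∙ (δ ⁻¹))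
    ... | inj₁ p = inj₁ (descend (inˡ (edge-bind (C₁-all (P-half p)) join)) (halves _))
    ... | inj₂ (inj₁ (x , y , E , eq)) = inj₁ (descend (inʳ (edge-join E)) eq)
    ... | inj₂ (inj₂ eq) = inj₂ (trans (solve v₁ (v₀ :∙ :- (v₀ :∙ :- v₁)) (offset ∷ δ ∷ []) refl) (cong (λ a → offset ∙ (a ⁻¹)) eq))

    -- The roles are exchanged: doubles from `C₂`, neighbours from `C₁`. Only the sum 0 is missing.
    move′ : ∀ δ → Move walk i′ i δ ⊎ δ ≡ offset ⁻¹
    move′ δ with C₂-all (half (offset ∙ δ)) | (offset ∙ δ) ≟ ε
    ... | inj₂ p | _ = inj₁ (ascend (inʳ (edge-bind p join)) (halves _))
    ... | inj₁ p | yes eq = inj₂ (trans (solve v₁ (:- v₀ :∙ (v₀ :∙ v₁)) (offset ∷ δ ∷ []) refl)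
            (trans (∙-congˡ eq) (identityʳ _)))
    ... | inj₁ p | no neq with C₁-sum (P-double p) neq
    ... | x , y , E , eq = inj₁ (ascend (inˡ (edge-join E)) eq)

    turn : Move walk i′ i′ (iter α (q ∸ s) (first X ⁻¹))
    turn = _ , _ , join′ (last-bind pair₁ C₁) (first-bind pair₂ C₂) ,
      trans (solve (v₀ :∙ :- v₂) ((v₀ :∙ :- v₁) :∙ (v₁ :∙ :- v₂)) ((e ∙ offset) ∷ last C₁ ∷ first C₂ ∷ []) refl) (∙-congˡ turning)

    len-walk : len walk ≤ N * 2
    len-walk = ℕₚ.≤-trans (ℕₚ.≤-reflexive (trans
      (cong₂ _+_ (len-bind pair₁ 2 C₁ (λ _ → refl)) (len-bind pair₂ 2 C₂ (λ _ → refl)))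
      (sym (ℕₚ.*-distribʳ-+ 2 (len C₁) (len C₂))))) (ℕₚ.*-monoˡ-≤ 2 len-C)

  -- The special block ends in fibre s instead of -s, so from there on every block is entered at -j
  -- and left at j.
  module Early (j : ℕ) = Ordinary E₀ (F j) (F (q ∸ j))
  module Late (j : ℕ) = Ordinary E₁ (F (q ∸ j)) (F j)

  choose : ∀ j → Tri (j < s) (j ≡ s) (s < j) → Walk G
  choose j (tri< _ _ _) = Early.walk j
  choose j (tri≈ _ _ _) = Special.walk
  choose j (tri> _ _ _) = Late.walk j

  block : ℕ → Walk G
  block zero    = mapW (_, F 0) Zₛ
  block (suc j) = choose (suc j) (ℕₚ.<-cmp (suc j) s)

  last-Zₛ : last Zₛ ≡ E₀
  last-Zₛ = trans (last-rev (mapW _⁻¹ Y)) (trans (first-bind _ Y) (trans (cong _⁻¹ first-Y) (inv-inv _)))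

  first-block : ∀ j → suc j ≤ s → first (block (suc j)) ≡ (E₀ , F (suc j))
  first-block j le with ℕₚ.<-cmp (suc j) s
  ... | tri< _ _ _    = Early.first-walk (suc j)
  ... | tri≈ _ refl _ = Special.first-walk
  ... | tri> _ _ gt   = contradiction le (ℕₚ.<⇒≱ gt)

  first-block′ : ∀ j → s ≤ j → first (block (suc j)) ≡ (E₁ , F (q ∸ suc j))
  first-block′ j le with ℕₚ.<-cmp (suc j) s
  ... | tri< lt _ _   = contradiction (ℕₚ.≤-trans le (ℕₚ.n≤1+n j)) (ℕₚ.<⇒≱ lt)
  ... | tri≈ _ refl _ = contradiction le ℕₚ.1+n≰n
  ... | tri> _ _ _    = Late.first-walk (suc j)

  last-block : ∀ j → j < s → last (block j) ≡ (E₀ , F (q ∸ j))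
  last-block zero lt = trans (last-bind _ Zₛ) (cong₂ _,_ last-Zₛ (trans (sym (F-q+ 0)) (cong F (ℕₚ.+-identityʳ q))))
  last-block (suc j) lt with ℕₚ.<-cmp (suc j) s
  ... | tri< _ _ _    = Early.last-walk (suc j)
  ... | tri≈ _ refl _ = contradiction lt (ℕₚ.<-irrefl refl)
  ... | tri> _ _ gt   = contradiction lt (ℕₚ.<-asym gt)

  last-block′ : ∀ j → s ≤ j → last (block j) ≡ (E₁ , F j)
  last-block′ zero le = contradiction 0<s (ℕₚ.≤⇒≯ le)
  last-block′ (suc j) le with ℕₚ.<-cmp (suc j) s
  ... | tri< lt _ _   = contradiction le (ℕₚ.<⇒≱ lt)
  ... | tri≈ _ refl _ = Special.last-walk
  ... | tri> _ _ _    = Late.last-walk (suc j)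

  ∈-block : ∀ j a → (a , F (suc j)) ∈ block (suc j) × (a , F (q ∸ suc j)) ∈ block (suc j)
  ∈-block j a with ℕₚ.<-cmp (suc j) s
  ... | tri< _ _ _    = Early.∈-walk (suc j) a , Early.∈-walk′ (suc j) a
  ... | tri≈ _ refl _ = Special.∈-walk a , Special.∈-walk′ a
  ... | tri> _ _ _    = Late.∈-walk′ (suc j) a , Late.∈-walk (suc j) a

  len-block : ∀ j → len (block (suc j)) ≤ N * 2
  len-block j with ℕₚ.<-cmp (suc j) s
  ... | tri< _ _ _ = Early.len-walk (suc j)
  ... | tri≈ _ _ _ = Special.len-walk
  ... | tri> _ _ _ = Late.len-walk (suc j)

  forward : ∀ j δ → Move (block (suc j)) (F (suc j)) (F (q ∸ suc j)) δ
    ⊎ (δ ≡ ε × s < suc j) ⊎ (suc j ≡ s × δ ≡ offset ∙ (ν ⁻¹))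
  forward j δ with ℕₚ.<-cmp (suc j) s
  ... | tri< _ _ _ = inj₁ (Early.move (suc j) δ)
  ... | tri≈ _ refl _ with Special.move δ
  ... | inj₁ m = inj₁ m
  ... | inj₂ eq = inj₂ (inj₂ (refl , eq))
  forward j δ | tri> _ _ gt with δ ≟ ε
  ... | yes eq = inj₂ (inj₁ (eq , gt))
  ... | no neq = inj₁ (Late.move′ (suc j) neq)

  backward : ∀ j δ → Move (block (suc j)) (F (q ∸ suc j)) (F (suc j)) δ
    ⊎ (δ ≡ ε × suc j < s) ⊎ (suc j ≡ s × δ ≡ offset ⁻¹)
  backward j δ with ℕₚ.<-cmp (suc j) s
  ... | tri> _ _ _ = inj₁ (Late.move (suc j) δ)
  ... | tri≈ _ refl _ with Special.move′ δ
  ... | inj₁ m = inj₁ m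
  ... | inj₂ eq = inj₂ (inj₂ (refl , eq))
  backward j δ | tri< lt _ _ with δ ≟ ε
  ... | yes eq = inj₂ (inj₁ (eq , lt))
  ... | no neq = inj₁ (Early.move′ (suc j) neq)

  turn-block : Move (block s) (F (q ∸ s)) (F (q ∸ s)) (iter α (q ∸ s) (first X ⁻¹))
  turn-block = go s refl
    where
    go : ∀ j → j ≡ s → Move (block j) (F (q ∸ s)) (F (q ∸ s)) (iter α (q ∸ s) (first X ⁻¹))
    go zero refl = contradiction 0<s λ ()
    go (suc j) eq with ℕₚ.<-cmp (suc j) s
    ... | tri< _ neq _ = contradiction eq neq
    ... | tri≈ _ _ _   = Special.turn
    ... | tri> _ neq _ = contradiction eq neq

  chain : ℕ → Walk G
  chain zero    = block 0
  chain (suc n) = chain n ⌢ block (suc n)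

  last-chain : ∀ n → last (chain n) ≡ last (block n)
  last-chain zero    = refl
  last-chain (suc n) = refl

  ∈-chain : ∀ {j n g} → j ≤ n → g ∈ block j → g ∈ chain n
  ∈-chain {zero} {zero} le p = p
  ∈-chain {j} {suc n} le p with ℕₚ.m≤n⇒m<n∨m≡n le
  ... | inj₁ lt   = inˡ (∈-chain (s≤s⁻¹ lt) p)
  ... | inj₂ refl = inʳ p

  edge-chain : ∀ {j n g g′} → j ≤ n → Edge g g′ (block j) → Edge g g′ (chain n)
  edge-chain {zero} {zero} le E = E
  edge-chain {j} {suc n} le E with ℕₚ.m≤n⇒m<n∨m≡n le
  ... | inj₁ lt   = inˡ (edge-chain (s≤s⁻¹ lt) E)
  ... | inj₂ refl = inʳ E

  join-chain : ∀ {l n} → l < n → Edge (last (block l)) (first (block (suc l))) (chain n)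
  join-chain {l} {suc n} lt with ℕₚ.m≤n⇒m<n∨m≡n (s≤s⁻¹ lt)
  ... | inj₁ lt′  = inˡ (join-chain lt′)
  ... | inj₂ refl = join′ (last-chain l) refl

  path : Walk G
  path = chain h ⌢ mapW (_, F 0) Zₑ

  len-path : len path ≤ N * q
  len-path = ℕₚ.≤-trans (ℕₚ.+-mono-≤ (len-chain h)
      (ℕₚ.≤-reflexive (trans (len-map (_, F 0) Zₑ) (cong (_+ 1) (trans (len-rev Y) len-Y)))))
    (ℕₚ.≤-trans (ℕₚ.≤-reflexive (arith (len X) (h * (N * 2)))) (ℕₚ.≤-trans (ℕₚ.+-monoˡ-≤ (h * (N * 2)) len-X)
      (ℕₚ.≤-reflexive (arith′ N h))))
    where
    len-Y : len Y ≡ len X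
    len-Y = trans (len-map _ (tag true X)) (len-tag true X)
    len-chain : ∀ n → len (chain n) ≤ len X + n * (N * 2)
    len-chain zero = ℕₚ.≤-reflexive
      (trans (len-map (_, F 0) Zₛ) (trans (len-rev (mapW _⁻¹ Y)) (trans (len-map _⁻¹ Y) (trans len-Y (sym (ℕₚ.+-identityʳ _))))))
    len-chain (suc n) = ℕₚ.≤-trans (ℕₚ.+-mono-≤ (len-chain n) (len-block n)) (ℕₚ.≤-reflexive (step (len X) n (N * 2)))
      where
      step : ∀ x n c → (x + n * c) + c ≡ x + (c + n * c)
      step = solve-∀
    arith : ∀ x c → (x + c) + (x + 1) ≡ suc (2 * x) + c
    arith = solve-∀
    arith′ : ∀ m h → m + h * (m * 2) ≡ m * suc (h + h)
    arith′ = solve-∀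

  link : ∀ {l} → l < h → l < s → Move path (F (q ∸ l)) (F (suc l)) ε
  link {l} l<h l<s = _ , _ , inˡ (subst₂ (λ g g′ → Edge g g′ (chain h)) (last-block l l<s) (first-block l l<s) (join-chain l<h)) ,
    sym (identityʳ _)

  link′ : ∀ {l} → l < h → s ≤ l → Move path (F l) (F (q ∸ suc l)) ε
  link′ {l} l<h s≤l = _ , _ , inˡ (subst₂ (λ g g′ → Edge g g′ (chain h)) (last-block′ l s≤l) (first-block′ l s≤l) (join-chain l<h)) ,
    sym (identityʳ _)

  final-link : Move path (F h) (F 0) (iter α r ν ⁻¹)
  final-link = _ , _ , join′ (trans (last-chain h) (last-block′ h s≤h))
    (trans (first-bind _ (rev Y)) (cong (_, F 0) (trans (first-rev Y) (trans last-Y finish)))) , refl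

  Realised : A → Fin q → Set
  Realised y v = ∃₂ λ a i → Edge (a , i) (a ∙ iter α (toℕ i) y , i +ᶠ v) path

  realise : ∀ i j {k y δ} → Move path (F i) (F k) δ → iter α i y ≡ δ → F k ≡ F (i + j) → Realised y (F j)
  realise i j {k} {y} (a , b , E , refl) refl eq = a , F i ,
    subst (λ g → Edge (a , F i) g path) (cong₂ _,_ (∙-congˡ (sym (iter-F i y))) (trans eq (sym (F-+ i j)))) E

  block-move : ∀ {j i i′ δ} → j ≤ h → Move (block j) i i′ δ → Move path i i′ δ
  block-move le = Move-map (λ E → inˡ (edge-chain {n = h} le E))

  q∸ : ∀ a b → a + b ≡ q → q ∸ a ≡ b
  q∸ a b eq = trans (cong (_∸ a) (sym eq)) (ℕₚ.m+n∸m≡n a b)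

  h≤q : h ≤ q
  h≤q = ℕₚ.≤-trans (ℕₚ.m≤m+n h h) (ℕₚ.n≤1+n _)

  -- Modulo q, the passage from fibre j + 1 to its negative is the step 2l + 1, and the way back is
  -- 2(j + 1). Over all blocks these are the nonzero residues.
  module _ (l j : ℕ) (l+j : l + suc j ≡ h) where
    private
      j≤h : suc j ≤ h
      j≤h = ℕₚ.≤-trans (ℕₚ.m≤n+m (suc j) l) (ℕₚ.≤-reflexive l+j)
      l<h : l < h
      l<h = ℕₚ.≤-trans (ℕₚ.m<m+n l (s≤s z≤n)) (ℕₚ.≤-reflexive l+j)
      s+s≤ : s + s ≤ suc h
      s+s≤ with Sum.swap shape
      ... | inj₂ (_ , eq , _) = ℕₚ.≤-reflexive (sym eq)
      ... | inj₁ (_ , eq , _) = ℕₚ.≤-trans (ℕₚ.≤-reflexive (sym eq)) (ℕₚ.n≤1+n h)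
      h≤ss : h ≤ s + s
      h≤ss with Sum.swap shape
      ... | inj₂ (_ , eq , _) = ℕₚ.≤-trans (ℕₚ.n≤1+n h) (ℕₚ.≤-reflexive eq)
      ... | inj₁ (_ , eq , _) = ℕₚ.≤-reflexive eq
      -- A late block lacks the move by 0 at step 2l + 1, which the link after block l provides when
      -- l < s; this needs h ≤ 2s. For early blocks, `s≤l` likewise needs 2s ≤ h + 1.
      l<s : s < suc j → l < s
      l<s lt = ℕₚ.+-cancelʳ-< s l s (ℕₚ.<-≤-trans (ℕₚ.+-monoʳ-< l lt) (ℕₚ.≤-trans (ℕₚ.≤-reflexive l+j) h≤ss))
      s≤l : suc j < s → s ≤ l
      s≤l lt = ℕₚ.≮⇒≥ λ l<s → ℕₚ.1+n≰n (ℕₚ.≤-trans (ℕₚ.≤-trans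
        (ℕₚ.≤-reflexive (cong suc (trans (cong suc (sym l+j)) (sym (ℕₚ.+-suc l (suc j))))))
        (ℕₚ.+-mono-≤ l<s lt)) s+s≤)
      twice : l + suc j + (l + suc j) ≡ h + h
      twice = cong₂ _+_ l+j l+j
      minus-j : q ∸ suc j ≡ suc j + suc (l + l)
      minus-j = q∸ (suc j) _ (trans (arith l (suc j)) (cong suc twice))
        where
        arith : ∀ l j → j + (j + suc (l + l)) ≡ suc (l + j + (l + j))
        arith = solve-∀
      minus-l : q ∸ l ≡ suc l + (suc j + suc j)
      minus-l = q∸ l _ (trans (arith l (suc j)) (cong suc twice))
        where
        arith : ∀ l j → l + (suc l + (j + j)) ≡ suc (l + j + (l + j))
        arith = solve-∀
      minus-sl : q ∸ suc l ≡ l + (suc j + suc j)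
      minus-sl = q∸ (suc l) _ (trans (arith l (suc j)) (cong suc twice))
        where
        arith : ∀ l j → suc l + (l + (j + j)) ≡ suc (l + j + (l + j))
        arith = solve-∀
      through : ∀ {a b} → a ≡ q + b → F b ≡ F a
      through {b = b} eq = trans (sym (F-q+ b)) (cong F (sym eq))

    odd-zero : l < s → Realised ε (F (suc (l + l)))
    odd-zero lt = realise (q ∸ l) (suc (l + l)) (link l<h lt) (iter-ε (q ∸ l))
      (through (trans (cong (_+ suc (l + l)) minus-l) (trans (arith l (suc j)) (cong (λ k → suc k + suc l) twice))))
      where
      arith : ∀ l j → suc l + (j + j) + suc (l + l) ≡ suc (l + j + (l + j)) + suc l
      arith = solve-∀

    even-zero : s ≤ l → Realised ε (F (suc j + suc j))
    even-zero le = realise l (suc j + suc j) (link′ l<h le) (iter-ε l) (cong F minus-sl)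

    odd-step : ∀ y → Realised y (F (suc (l + l)))
    odd-step y with forward j (iter α (suc j) y)
    ... | inj₁ m = realise (suc j) (suc (l + l)) (block-move j≤h m) refl (cong F minus-j)
    ... | inj₂ (inj₁ (eq , gt)) = subst (λ y → Realised y _) (sym (iter-injective {suc j} (ℕₚ.≤-trans j≤h h≤q) eq)) (odd-zero (l<s gt))
    ... | inj₂ (inj₂ (refl , eq)) with Sum.swap shape
    ... | inj₂ (refl , h≡ , _) = subst (λ y → Realised y _)
            (sym (iter-injective {suc j} (ℕₚ.≤-trans j≤h h≤q) (trans eq (inverseʳ ν))))
            (odd-zero (ℕₚ.+-cancelʳ-≤ s (suc l) s (ℕₚ.≤-reflexive (trans (cong suc l+j) h≡))))
    -- For h = 2s the missed step starts in fibre s. The closing link starts in fibre h, which is s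
    -- further, so -ν turns into its image under the s-th power.
    ... | inj₁ (refl , h≡ , refl) = realise h (suc (l + l)) final-link
            (trans (cong (λ k → iter α k y) h≡) (trans (iter-+ α s s y) (trans (cong (iter α s) (trans eq (identityˡ _))) (iter-⁻¹ s ν))))
            (through (trans (cong (λ k → h + suc (k + k)) (ℕₚ.+-cancelʳ-≡ s l s (trans l+j h≡)))
              (trans (cong (λ k → h + suc k) (sym h≡)) (trans (ℕₚ.+-suc h h) (sym (ℕₚ.+-identityʳ q))))))

    even-step : ∀ y → Realised y (F (suc j + suc j))
    even-step y with backward j (iter α (q ∸ suc j) y)
    ... | inj₁ m = realise (q ∸ suc j) (suc j + suc j) (block-move j≤h m) refl
            (through (trans (cong (_+ (suc j + suc j)) minus-j) (trans (arith l (suc j)) (cong (λ k → suc k + suc j) twice))))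
      where
      arith : ∀ l j → j + suc (l + l) + (j + j) ≡ suc (l + j + (l + j)) + j
      arith = solve-∀
    ... | inj₂ (inj₁ (eq , lt)) = subst (λ y → Realised y _) (sym (iter-injective {q ∸ suc j} (ℕₚ.m∸n≤m q (suc j)) eq)) (even-zero (s≤l lt))
    ... | inj₂ (inj₂ (refl , eq)) with Sum.swap shape
    ... | inj₁ (refl , h≡ , _) = subst (λ y → Realised y _)
            (sym (iter-injective {q ∸ suc j} (ℕₚ.m∸n≤m q (suc j)) (trans eq (solve (:- :ε) :ε [] refl))))
            (even-zero (ℕₚ.≤-reflexive (sym (ℕₚ.+-cancelʳ-≡ s l s (trans l+j h≡)))))
    -- For h + 1 = 2s the missed step starts in fibre -s, and from there to fibre h the distance is
    -- h + s.
    ... | inj₂ (refl , h≡ , refl) = realise h (s + s) final-link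
            (trans (sym (period _)) (trans (sym (iter-+ α q h y))
              (trans (cong (λ k → iter α k y) (sym (trans (ℕₚ.+-assoc h s (q ∸ s))
                (trans (cong (h +_) (ℕₚ.m+[n∸m]≡n (ℕₚ.≤-trans s≤h h≤q))) (ℕₚ.+-comm h q)))))
              (trans (iter-+ α (h + s) (q ∸ s) y) (trans (cong (iter α (h + s)) eq) (iter-⁻¹ (h + s) ν))))))
            (through (trans (cong (h +_) (sym h≡)) (trans (ℕₚ.+-suc h h) (sym (ℕₚ.+-identityʳ q)))))

  zero-step : ∀ y → y ≢ ε → Realised y (F 0)
  zero-step y y≢ε with X-sum y y≢ε
  ... | inj₁ (inj₁ eq) = realise 0 0
          (_ , _ , inʳ (join′ (trans (last-bind _ (rev Y)) (cong (_, F 0) (trans (last-rev Y) first-Y))) refl) ,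
            trans (sym (inverseˡ y)) (∙-congʳ (cong _⁻¹ (sym eq)))) refl refl
  ... | inj₁ (inj₂ eq) = realise (q ∸ s) 0 (block-move s≤h turn-block)
          (cong (iter α (q ∸ s)) (trans (sym (inv-inv y)) (cong _⁻¹ (sym eq)))) (cong F (sym (ℕₚ.+-identityʳ _)))
  ... | inj₂ (x , z , E , sum) with edge-tag true E
  ... | c , E′ = go (±-sgn c sum)
    where
    E″ : Edge (sgn (not c) z) (sgn c x) (rev Y)
    E″ = edge-rev (edge-map (λ (b , x) → sgn b x) E′)
    difference : sgn c x ≡ sgn (not c) z ∙ sgn c (x ∙ z)
    difference = trans (solve v₀ (:- v₁ :∙ (v₀ :∙ v₁)) (sgn c x ∷ sgn c z ∷ []) refl)
      (cong₂ _∙_ (sym (trans (sgn-not c z) (sgn-⁻¹ c z))) (sgn-∙ c x z))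
      where
      sgn-⁻¹ : ∀ c z → sgn c (z ⁻¹) ≡ sgn c z ⁻¹
      sgn-⁻¹ false z = refl
      sgn-⁻¹ true  z = refl
    -- The closing list realises one sign of each neighbour sum; the opening list is its entrywise
    -- negative and realises the other.
    go : sgn c (x ∙ z) ± y → Realised y (F 0)
    go (inj₁ eq) = realise 0 0 (_ , _ , inʳ (inˡ (edge-map (_, F 0) E″)) , trans difference (∙-congˡ eq)) refl refl
    go (inj₂ eq) = realise 0 0 (_ , _ , inˡ (edge-chain {0} {h} z≤n (edge-map (_, F 0)
        (edge-rev (edge-map _⁻¹ (edge-map (λ (b , x) → sgn b x) E′))))) ,
      trans (cong _⁻¹ difference) (trans (solve (:- (v₀ :∙ v₁)) (:- v₀ :∙ :- v₁) (sgn (not c) z ∷ sgn c (x ∙ z) ∷ []) refl)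
        (∙-congˡ (trans (cong _⁻¹ eq) (inv-inv y))))) refl refl

  data Step : ℕ → Set where
    none : Step 0
    odd  : ∀ l j → l + suc j ≡ h → Step (suc (l + l))
    even : ∀ l j → l + suc j ≡ h → Step (suc j + suc j)

  step-of : ∀ n → n < q → Step n
  step-of n lt with mod2 n
  ... | even zero = none
  ... | even (suc j) = even (h ∸ suc j) j (ℕₚ.m∸n+n≡m {h} {suc j} (ℕₚ.≮⇒≥ λ gt →
          ℕₚ.<⇒≱ (ℕₚ.+-mono-< gt gt) (s≤s⁻¹ lt)))
  ... | odd l = odd l (h ∸ suc l) (trans (ℕₚ.+-suc l _) (ℕₚ.m+[n∸m]≡n (ℕₚ.≮⇒≥ λ gt →
          ℕₚ.<⇒≱ (s≤s⁻¹ lt) (ℕₚ.+-mono-≤ (s≤s⁻¹ gt) (s≤s⁻¹ gt)))))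

  all-steps : ∀ y v → (y , v) ≡ (ε , F 0) ⊎ Realised y v
  all-steps y v = subst (λ v → (y , v) ≡ (ε , F 0) ⊎ Realised y v) (F-toℕ v) (go (step-of (toℕ v) (Finₚ.toℕ<n v)))
    where
    go : ∀ {n} → Step n → (y , F n) ≡ (ε , F 0) ⊎ Realised y (F n)
    go (odd l j eq) = inj₂ (odd-step l j eq y)
    go (even l j eq) = inj₂ (even-step l j eq y)
    go none with y ≟ ε
    ... | yes refl = inj₁ refl
    ... | no y≢ε = inj₂ (zero-step y y≢ε)

  all-vertices : ∀ a v → (a , v) ∈ path
  all-vertices a v = subst (λ v → (a , v) ∈ path) (F-toℕ v) (go (toℕ v) (Finₚ.toℕ<n v))
    where
    fibre-0 : (a , F 0) ∈ path
    fibre-0 with X-all a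
    ... | inj₁ refl = inʳ (inʳ this)
    ... | inj₂ (x , x∈ , x±a) with ∈-tag true x∈
    ... | c , tagged with ∈-map (λ (b , x) → sgn b x) tagged | ±-sgn c x±a
    ... | p | inj₁ eq = inʳ (inˡ (∈-map (_, F 0) (∈-rev (subst (_∈ Y) eq p))))
    ... | p | inj₂ eq = inˡ (∈-chain {0} {h} z≤n (∈-map (_, F 0) (∈-rev (subst (_∈ mapW _⁻¹ Y)
            (trans (cong _⁻¹ eq) (inv-inv a)) (∈-map _⁻¹ p)))))
    go : ∀ n → n < q → (a , F n) ∈ path
    go zero _ = fibre-0
    go (suc n) lt with suc n ≤? h
    ... | yes le = inˡ (∈-chain {n = h} le (proj₁ (∈-block n a)))
    ... | no gt = subst (λ k → (a , F k) ∈ path) (q∸ (suc (h + h ∸ suc n)) (suc n) (trans (cong (_+ suc n) (sym complement)) (ℕₚ.m∸n+n≡m {q} {suc n} (ℕₚ.<⇒≤ lt))))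
            (inˡ (∈-chain {n = h} le (proj₂ (∈-block (h + h ∸ suc n) a))))
      where
      complement : q ∸ suc n ≡ suc (h + h ∸ suc n)
      complement = ℕₚ.+-∸-assoc 1 (s≤s⁻¹ lt)
      le : suc (h + h ∸ suc n) ≤ h
      le = ℕₚ.+-cancelʳ-≤ (suc n) _ h (ℕₚ.≤-trans (ℕₚ.≤-reflexive (trans (cong (_+ suc n) (sym complement)) (ℕₚ.m∸n+n≡m {q} {suc n} (ℕₚ.<⇒≤ lt))))
        (ℕₚ.≤-trans (ℕₚ.≤-reflexive (sym (ℕₚ.+-suc h h))) (ℕₚ.+-monoʳ-≤ h (ℕₚ.≰⇒> gt))))

-- The semidirect product and its left division

module SemidirectProduct {A : Set} {_∙_ : A → A → A} {ε : A} {_⁻¹ : A → A}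
  (isAb : IsAbelianGroup _≡_ _∙_ ε _⁻¹) {N : ℕ} (fin : Fin N ↔ A)
  (q′ : ℕ) (α : A → A) (α-∙ : ∀ x y → α (x ∙ y) ≡ α x ∙ α y) (period : ∀ x → iter α (suc q′) x ≡ x)
  (mul : A × Fin (suc q′) → A × Fin (suc q′) → A × Fin (suc q′))
  (mul-def : ∀ a i b j → mul (a , i) (b , j) ≡ (a ∙ iter α (toℕ i) b , i +ᶠ j)) where

  open AbelianGroup isAb
  open Hom isAb α α-∙
  open Residues q′
  open Periodic α period

  mul-assoc : ∀ x y z → mul (mul x y) z ≡ mul x (mul y z)
  mul-assoc (a , i) (b , j) (c , k) = begin
    mul (mul (a , i) (b , j)) (c , k)                                    ≡⟨ cong (λ x → mul x (c , k)) (mul-def a i b j) ⟩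
    mul (a ∙ αᵢ b , i +ᶠ j) (c , k)                                      ≡⟨ mul-def _ _ c k ⟩
    ((a ∙ αᵢ b) ∙ iter α (toℕ (i +ᶠ j)) c , (i +ᶠ j) +ᶠ k)              ≡⟨ cong₂ _,_ coordinate (+ᶠ-assoc i j k) ⟩
    (a ∙ αᵢ (b ∙ iter α (toℕ j) c) , i +ᶠ (j +ᶠ k))                     ≡⟨ mul-def a i _ _ ⟨
    mul (a , i) (b ∙ iter α (toℕ j) c , j +ᶠ k)                          ≡⟨ cong (mul (a , i)) (mul-def b j c k) ⟨
    mul (a , i) (mul (b , j) (c , k))                                    ∎
    where
    open ≡-Reasoning
    αᵢ : A → A
    αᵢ = iter α (toℕ i)
    i+j : i +ᶠ j ≡ F (toℕ i + toℕ j)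
    i+j = trans (sym (cong₂ _+ᶠ_ (F-toℕ i) (F-toℕ j))) (F-+ (toℕ i) (toℕ j))
    coordinate : (a ∙ αᵢ b) ∙ iter α (toℕ (i +ᶠ j)) c ≡ a ∙ αᵢ (b ∙ iter α (toℕ j) c)
    coordinate = trans (∙-congˡ (trans (cong (λ v → iter α (toℕ v) c) i+j) (trans (iter-F (toℕ i + toℕ j) c) (iter-+ α (toℕ i) (toℕ j) c))))
      (trans (assoc a _ _) (∙-congˡ (sym (iter-∙ (toℕ i) b _))))

  unit : A × Fin q
  unit = ε , F 0

  mul-unit : ∀ x → mul x unit ≡ x
  mul-unit (a , i) = trans (mul-def a i ε (F 0))
    (cong₂ _,_ (trans (∙-congˡ (iter-ε (toℕ i))) (identityʳ a)) (+ᶠ-identityʳ i))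

  quotient : A × Fin q → A × Fin q → A × Fin q
  quotient (a , i) (b , j) = iter α (q ∸ toℕ i) ((a ⁻¹) ∙ b) , (−ᶠ i) +ᶠ j

  private
    q∸+ : ∀ (i : Fin q) → q ∸ toℕ i + toℕ i ≡ q
    q∸+ i = ℕₚ.m∸n+n≡m (ℕₚ.<⇒≤ (Finₚ.toℕ<n i))

  quotient-mul : ∀ x y → quotient x (mul x y) ≡ y
  quotient-mul (a , i) (b , j) = trans (cong (quotient (a , i)) (mul-def a i b j)) (cong₂ _,_
    (trans (cong (iter α (q ∸ toℕ i)) (solve (:- v₀ :∙ (v₀ :∙ v₁)) v₁ (a ∷ iter α (toℕ i) b ∷ []) refl))
      (trans (sym (iter-+ α (q ∸ toℕ i) (toℕ i) b)) (trans (cong (λ k → iter α k b) (q∸+ i)) (period b))))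
    (trans (sym (+ᶠ-assoc (−ᶠ i) i j)) (trans (cong (_+ᶠ j) (+ᶠ-inverseˡ i)) (+ᶠ-identityˡ j))))

  mul-quotient : ∀ x y → mul x (quotient x y) ≡ y
  mul-quotient (a , i) (b , j) = trans (mul-def a i _ _) (cong₂ _,_
    (trans (∙-congˡ (trans (sym (iter-+ α (toℕ i) (q ∸ toℕ i) _)) (trans
        (cong (λ k → iter α k ((a ⁻¹) ∙ b)) (trans (ℕₚ.+-comm (toℕ i) _) (q∸+ i))) (period _))))
      (solve (v₀ :∙ (:- v₀ :∙ v₁)) v₁ (a ∷ b ∷ []) refl))
    (trans (sym (+ᶠ-assoc i (−ᶠ i) j)) (trans (cong (_+ᶠ j) (+ᶠ-inverseʳ i)) (+ᶠ-identityˡ j))))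

  finite : Fin (N * q) ↔ (A × Fin q)
  finite = ↔-trans Finₚ.*↔× (fin ×-↔ ↔-refl)

  open Sequencing finite mul unit mul-assoc mul-unit quotient quotient-mul mul-quotient public

-- From subgroups with prescribed elements to a sequencing

module Assembly {A : Set} {_∙_ : A → A → A} {ε : A} {_⁻¹ : A → A}
  (isAb : IsAbelianGroup _≡_ _∙_ ε _⁻¹) {N : ℕ} (fin : Fin N ↔ A)
  {e : ℕ} (torsion : ∀ x → AbelianGroup._·_ isAb e x ≡ ε)
  (h₂ c₂ : ℕ) (half-eq : 2 * h₂ ≡ 1 + c₂ * e)
  (h₃ c₃ : ℕ) (third-eq : 3 * h₃ ≡ 1 + c₃ * e) where

  open AbelianGroup isAb
  open Signs isAb
  open Lexicographic isAb fin {e} torsion h₂ c₂ half-eq h₃ c₃ third-eq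
  open Harmonious isAb fin {e} torsion h₂ c₂ half-eq h₃ c₃ third-eq
  open Splitting isAb fin {e} torsion h₂ c₂ half-eq h₃ c₃ third-eq
  open Subgroup

  Spans : (A → Set) → A → Set
  Spans Q g = ∀ a → ∃₂ λ d j → Q d × a ≡ d ∙ (j · g)

  ·-⁻¹ : ∀ k g → k · (g ⁻¹) ≡ (k · g) ⁻¹
  ·-⁻¹ zero    g = solve :ε (:- :ε) [] refl
  ·-⁻¹ (suc k) g = trans (∙-congˡ (·-⁻¹ k g)) (solve (:- v₀ :∙ :- v₁) (:- (v₀ :∙ v₁)) (g ∷ (k · g) ∷ []) refl)

  3∤ : ∀ i k → 3 * i ≢ 1 + k * 3
  3∤ i k eq = contradiction (trans (sym ([m+kn]%n≡m%n 1 k 3))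
    (trans (cong (_% 3) (sym eq)) (trans (cong (_% 3) (ℕₚ.*-comm 3 i)) (m*n%n≡0 i 3)))) λ ()

  Order-⁻¹ : ∀ {S g} → Order S g → Order S (g ⁻¹)
  Order-⁻¹ {S} {g} o = record
    { l′ = l′ ; multiple = subst (P S) (sym (·-⁻¹ (suc (suc l′ + suc l′)) g)) (P-⁻¹ S multiple)
    ; minimal = λ j lt p → minimal j lt (subst (P S) (inv-inv _) (P-⁻¹ S (subst (P S) (·-⁻¹ (suc j) g) p)))
    ; i₃ = i₃ ; k₃ = k₃ ; inv₃ = inv₃ }
    where open Order o

  record Halving (first′ last′ : A) (size : ℕ) : Set where
    field
      X       : Walk A
      X-all   : ∀ a → a ≡ ε ⊎ ∃ λ x → x ∈ X × x ± a
      X-sum   : ∀ a → a ≢ ε → first X ± a ⊎ ∃₂ λ x y → Edge x y X × x ∙ y ± a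
      X-first : first X ≡ first′
      X-last  : last X ≡ last′
      X-size  : suc (2 * len X) ≡ size
      X-≤     : suc (2 * len X) ≤ N

  halving : ∀ S w (o : Order S w) → Spans (P S) w → (L : Lex (P S)) → ∀ X₀ → Lex.X? L ≡ just X₀ →
    Halving (2 · first X₀) (2 · w) (len (Lex.z L) * suc (suc (Order.l′ o) + suc (Order.l′ o)))
  -- Order 3 modulo `S` contradicts the invertibility of 3 modulo the order.
  halving S w record { l′ = zero ; i₃ = i₃ ; k₃ = k₃ ; inv₃ = inv₃ } spans L X₀ X≡ = contradiction inv₃ (3∤ i₃ k₃)
  halving S w record { l′ = suc l″ ; multiple = nw ; minimal = minimal ; i₃ = i₃ ; k₃ = k₃ ; inv₃ = inv₃ } spans L X₀ X≡ = record
    { X = X ; X-all = X-all ; X-sum = X-sum ; X-first = X-first ; X-last = X-last ; X-size = sym len-X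
    ; X-≤ = ℕₚ.≤-trans (ℕₚ.≤-reflexive (trans (sym len-X) (sym (len-bind levels n (Lex.z L) (len-levels L))))) (Card-≤ {Q} (cardQ L)) }
    where
    open Split S w l″ nw minimal i₃ k₃ inv₃ spans L
    open Prescribed X₀ X≡
    open Extend S w (suc l″) nw minimal i₃ k₃ inv₃ using (Q)

  -- The parity of the length of X, which decides the sign of its last element, is that of a
  -- size which w and w⁻¹ share.
  halving-signed : ∀ S T → ¬ P S T → Spans (P S) T → (L : Lex (P S)) → ∀ X₀ → Lex.X? L ≡ just X₀ →
    ∃₂ λ last′ size → Σ (Halving (2 · first X₀) last′ size) λ U → sgn (oddLen (Halving.X U)) (last (Halving.X U)) ≡ T
  halving-signed S T T∉ spans L X₀ X≡ = choose (oddLen X) refl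
    where
    w : A
    w = half T
    w∉ : ¬ P S w
    w∉ p = T∉ (subst (P S) (2·half T) (P-· S 2 p))
    o : Order S w
    o = order S w w∉
    spans-w : Spans (P S) w
    spans-w a with spans a
    ... | d , j , p , eq = d , j * 2 , p , trans eq (cong (d ∙_) (trans (cong (j ·_) (sym (2·half T))) (sym (·-· j 2 w))))
    spans-w⁻¹ : Spans (P S) (w ⁻¹)
    spans-w⁻¹ a with spans-w (a ⁻¹)
    ... | d , j , p , eq = d ⁻¹ , j , P-⁻¹ S p , trans (sym (inv-inv a)) (trans (cong _⁻¹ eq)
      (trans (solve (:- (v₀ :∙ v₁)) (:- v₀ :∙ :- v₁) (d ∷ (j · w) ∷ []) refl) (∙-congˡ (sym (·-⁻¹ j _)))))
    U  = halving S w o spans-w L X₀ X≡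
    U′ = halving S (w ⁻¹) (Order-⁻¹ o) spans-w⁻¹ L X₀ X≡
    X  = Halving.X U
    X′ = Halving.X U′
    same-parity : oddLen X ≡ oddLen X′
    same-parity = trans (oddLen-len X) (trans (cong odd? (ℕₚ.*-cancelˡ-≡ (len X) (len X′) 2
      (ℕₚ.suc-injective (trans (Halving.X-size U) (sym (Halving.X-size U′)))))) (sym (oddLen-len X′)))
    choose : ∀ b → oddLen X ≡ b → _
    choose false eq = _ , _ , U , trans (cong₂ sgn eq (Halving.X-last U)) (2·half T)
    choose true  eq = _ , _ , U′ , trans (cong₂ sgn (trans (sym same-parity) eq) (Halving.X-last U′))
      (trans (solve (:- (2 :· (:- v₀))) (2 :· v₀) (w ∷ []) refl) (2·half T))

  record Covering (S : Subgroup) (Δ κ : A) : Set where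
    field
      C₁ C₂   : Walk A
      C₁-all  : ∀ {a} → P S a → a ∈ C₁
      C₁-sum  : ∀ {a} → P S a → a ≢ ε → ∃₂ λ x y → Edge x y C₁ × x ∙ y ≡ a
      C₂-all  : ∀ a → P S a ⊎ a ∈ C₂
      C₂-sum  : ∀ a → P S a ⊎ (∃₂ λ x y → Edge x y C₂ × x ∙ y ≡ a) ⊎ a ≡ Δ ∙ κ
      turning : last C₁ ∙ (first C₂ ⁻¹) ≡ Δ
      shift   : (first C₁ ⁻¹) ∙ last C₂ ≡ (2 · Δ) ∙ κ
      C-≤     : len C₁ + len C₂ ≤ N

  -- `Complement` is used with w = -Δ: its jump -w becomes `Δ`, its missed sum κ - w becomes Δ + κ,
  -- and the level -2 at its end contributes 2Δ.
  covering : ∀ S Δ κ → ¬ P S Δ → P S κ → Spans (P S) Δ → Covering S Δ κ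
  covering S Δ κ Δ∉ κ∈ spans = build (order S w w∉)
    where
    w : A
    w = Δ ⁻¹
    w∉ : ¬ P S w
    w∉ p = Δ∉ (subst (P S) (inv-inv Δ) (P-⁻¹ S p))
    spans-w : Spans (P S) w
    spans-w a with spans (a ⁻¹)
    ... | d , j , p , eq = d ⁻¹ , j , P-⁻¹ S p , trans (sym (inv-inv a)) (trans (cong _⁻¹ eq)
      (trans (solve (:- (v₀ :∙ v₁)) (:- v₀ :∙ :- v₁) (d ∷ (j · Δ) ∷ []) refl) (∙-congˡ (sym (·-⁻¹ j _)))))
    build : Order S w → Covering S Δ κ
    build record { l′ = zero ; i₃ = i₃ ; k₃ = k₃ ; inv₃ = inv₃ } = contradiction inv₃ (3∤ i₃ k₃)
    build record { l′ = suc l″ ; multiple = nw ; minimal = minimal ; i₃ = i₃ ; k₃ = k₃ ; inv₃ = inv₃ } = record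
      { C₁ = z ; C₂ = C ; C₁-all = z-all ; C₁-sum = z-sum ; C₂-all = C-all
      ; C₂-sum = λ a → Sum.map₂ (Sum.map₂ (λ eq → trans eq (∙-congʳ (inv-inv Δ)))) (C-sum a)
      ; turning = trans (∙-congˡ (cong _⁻¹ C-first)) (trans (solve (v₀ :∙ :- (:- v₁ :∙ v₀)) v₁ (last z ∷ Δ ∷ []) refl) refl)
      ; shift = trans (cong₂ (λ a b → (a ⁻¹) ∙ b) z-anti C-last)
          (solve (:- (:- v₀) :∙ (:- (2 :· (:- v₁)) :∙ (:- v₀ :∙ v₂))) ((2 :· v₁) :∙ v₂) (last z ∷ Δ ∷ κ ∷ []) refl)
      ; C-≤ = ℕₚ.≤-trans (ℕₚ.≤-reflexive (trans len-C (sym (len-bind levels n z (len-levels L))))) (Card-≤ {Q} (cardQ L)) }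
      where
      L = lex S
      open Lex L using (z; z-all; z-sum; z-anti)
      open Split S w l″ nw minimal i₃ k₃ inv₃ spans-w L
      open Complement κ κ∈
      open Extend S w (suc l″) nw minimal i₃ k₃ inv₃ using (Q)

  -- `v` is γ_1 and `T` is γ_K. The list of `D` is built with `v`, up to a factor, as its final
  -- generator over `D′`; the extension from `D` to the whole group then fixes the end `T`. `S` and
  -- `Δ` determine the special block.
  module Final (h : ℕ) (α : A → A) (α-∙ : ∀ x y → α (x ∙ y) ≡ α x ∙ α y) (period : ∀ x → iter α (suc (h + h)) x ≡ x)
    (mul : A × Fin (suc (h + h)) → A × Fin (suc (h + h)) → A × Fin (suc (h + h)))
    (mul-def : ∀ a i b j → mul (a , i) (b , j) ≡ (a ∙ iter α (toℕ i) b , i +ᶠ j))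
    (s : ℕ) (0<s : 0 < s) (s≤h : s ≤ h) (r : ℕ) (shape : (suc h ≡ s + s × r ≡ h + s) ⊎ (h ≡ s + s × r ≡ s))
    (v Δ κ T : A) (Δ≡ : iter α (suc (h + h) ∸ s) v ≡ Δ)
    (T≡ : T ≡ ((v ⁻¹) ∙ ((2 · Δ) ∙ κ)) ∙ (iter α r (Δ ∙ κ) ⁻¹))
    (S : Subgroup) (Δ∉ : ¬ P S Δ) (κ∈ : P S κ) (S-spans : Spans (P S) Δ)
    (D : Subgroup) (v∈ : P D v) (T∉ : ¬ P D T) (D-spans : Spans (P D) T)
    (D′ : Subgroup) (D′⊆D : ∀ {a} → P D′ a → P D a) (v∉ : ¬ P D′ v)
    (D-generated : ∀ {a} → P D a → ∃₂ λ d j → P D′ d × a ≡ d ∙ (j · v)) where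

    -- `Prescribed` doubles the first entry `g` to -v, and γ_1 is the negative of that.
    g : A
    g = half (v ⁻¹)

    2g : 2 · g ≡ v ⁻¹
    2g = 2·half (v ⁻¹)

    g∉ : ¬ P D′ g
    g∉ p = v∉ (subst (P D′) (inv-inv v) (P-⁻¹ D′ (subst (P D′) 2g (P-· D′ 2 p))))

    generated : ∀ {a} → P D a → ∃₂ λ d j → P D′ d × a ≡ d ∙ (j · g)
    generated {a} p with D-generated (P-⁻¹ D p)
    ... | d , j , p′ , eq = d ⁻¹ , j * 2 , P-⁻¹ D′ p′ , trans (sym (inv-inv a)) (trans (cong _⁻¹ eq)
      (trans (solve (:- (v₀ :∙ v₁)) (:- v₀ :∙ :- v₁) (d ∷ (j · v) ∷ []) refl)
        (∙-congˡ (sym (trans (·-· j 2 g) (trans (cong (j ·_) 2g) (·-⁻¹ j v)))))))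

    Shape : Set
    Shape = (suc h ≡ s + s × r ≡ h + s) ⊎ (h ≡ s + s × r ≡ s)

    offset : Shape → A
    offset = Sum.[ (λ _ → Δ ∙ κ) , (λ _ → ε) ]′

    shape-offset : ∀ sh → (offset sh ≡ Δ ∙ κ × suc h ≡ s + s × r ≡ h + s) ⊎ (offset sh ≡ ε × h ≡ s + s × r ≡ s)
    shape-offset (inj₁ eqs) = inj₁ (refl , eqs)
    shape-offset (inj₂ eqs) = inj₂ (refl , eqs)

    sequencing : Sequenceable (A × Fin (suc (h + h))) mul
    sequencing = go (lex-from D D′ g D′⊆D (P-· D h₂ (P-⁻¹ D v∈)) g∉ generated)
      where
      go : (Σ (Lex (P D)) λ L → ∃ λ X → Lex.X? L ≡ just X × first X ≡ g) → Sequenceable (A × Fin (suc (h + h))) mul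
      go (L , X₀ , X≡ , X₀≡) with halving-signed D T T∉ D-spans L X₀ X≡
      ... | _ , _ , U , signed = sequenceable path len-path (λ (a , i) → all-vertices a i) λ (y , v) →
          Sum.map₂ (λ (a , i , E) → (a , i) , subst (λ x → Edge (a , i) x path) (sym (mul-def a i y v)) E) (all-steps y v)
        where
        open Halving U
        open Covering (covering S Δ κ Δ∉ κ∈ S-spans)
        first-X : first X ≡ v ⁻¹
        first-X = trans X-first (trans (cong (2 ·_) X₀≡) 2g)
        finish : sgn (oddLen X) (last X) ≡ ((first X ∙ (first C₁ ⁻¹)) ∙ last C₂) ∙ (iter α r (Δ ∙ κ) ⁻¹)
        finish = trans signed (trans T≡ (∙-congʳ (sym (trans (assoc _ _ _) (cong₂ _∙_ first-X shift)))))
        turning′ : last C₁ ∙ (first C₂ ⁻¹) ≡ iter α (suc (h + h) ∸ s) (first X ⁻¹)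
        turning′ = trans turning (trans (sym Δ≡) (cong (iter α (suc (h + h) ∸ s)) (trans (sym (inv-inv v)) (cong _⁻¹ (sym first-X)))))
        open Construction isAb half 2·half _≟_ h α α-∙ period X X-all X-sum (P S) (P-· S h₂)
          (λ {a} p → subst (P S) (2·half a) (P-· S 2 p)) C₁ C₂ C₁-all C₁-sum C₂-all (Δ ∙ κ) C₂-sum
          N X-≤ C-≤ s 0<s s≤h turning′ (offset shape) r (shape-offset shape) finish
        open SemidirectProduct isAb fin (h + h) α α-∙ period mul mul-def using (sequenceable)
 

-- Vectors over the prime field

abelian : ∀ {A : Set} {_∙_ : A → A → A} {ε : A} {_⁻¹ : A → A} →
  (∀ x y z → (x ∙ y) ∙ z ≡ x ∙ (y ∙ z)) → (∀ x y → x ∙ y ≡ y ∙ x) → (∀ x → ε ∙ x ≡ x) → (∀ x → (x ⁻¹) ∙ x ≡ ε) →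
  IsAbelianGroup _≡_ _∙_ ε _⁻¹
abelian {_∙_ = _∙_} {_⁻¹ = _⁻¹} assoc comm identityˡ inverseˡ = record
  { isGroup = record
    { isMonoid = record
      { isSemigroup = record
        { isMagma = record { isEquivalence = isEquivalence ; ∙-cong = cong₂ _∙_ } ; assoc = assoc }
      ; identity = identityˡ , λ x → trans (comm x _) (identityˡ x) }
    ; inverse = inverseˡ , λ x → trans (comm x _) (inverseˡ x)
    ; ⁻¹-cong = cong _⁻¹ }
  ; comm = comm }

-- Translating by b permutes the group, hence preserves the sum of all elements.
order-torsion : ∀ {A : Set} {_∙_ : A → A → A} {ε : A} {_⁻¹ : A → A} (isAb : IsAbelianGroup _≡_ _∙_ ε _⁻¹)
  {n : ℕ} → Fin n ↔ A → ∀ b → AbelianGroup._·_ isAb n b ≡ ε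
order-torsion {A} {_∙_} {ε} {_⁻¹} isAb {n} fin b = cancelʳ (sum enum)
  (trans (sym (trans (∑-distrib-+ {n} (λ _ → b) enum) (∙-congʳ (constant n))))
    (trans (sym (trans (sum-permute enum translation) (sum-cong-≗ {n} λ i → Inverse.strictlyInverseˡ fin (b ∙ enum i))))
      (sym (identityˡ (sum enum)))))
  where
  open AbelianGroup isAb
  monoid : CommutativeMonoid _ _
  monoid = record { isCommutativeMonoid = IsAbelianGroup.isCommutativeMonoid isAb }
  open Sums monoid using (sum; ∑-distrib-+; sum-permute; sum-cong-≗)
  enum : Fin n → A
  enum = Inverse.to fin
  constant : ∀ n → sum {n} (λ _ → b) ≡ n · b
  constant zero    = refl
  constant (suc n) = ∙-congˡ (constant n)
  translation : Fin n ↔ Fin n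
  translation = ↔-trans fin (↔-trans (mk↔ₛ′ (b ∙_) ((b ⁻¹) ∙_)
    (λ y → solve (v₀ :∙ (:- v₀ :∙ v₁)) v₁ (b ∷ y ∷ []) refl) (λ y → solve (:- v₀ :∙ (v₀ :∙ v₁)) v₁ (b ∷ y ∷ []) refl)) (↔-sym fin))

module PrimeField (p′ : ℕ) (p-prime : Prime (suc p′)) where
  open Residues p′ renaming (q to p) public

  isAbF : IsAbelianGroup _≡_ _+ᶠ_ (F 0) −ᶠ_
  isAbF = abelian +ᶠ-assoc +ᶠ-comm +ᶠ-identityˡ +ᶠ-inverseˡ

  module 𝔽 = AbelianGroup isAbF

  F-* : ∀ m n → F m *ᶠ F n ≡ F (m * n)
  F-* m n = trans (F-mod (toℕ (F m) * toℕ (F n))) (trans (cong₂ (λ a b → F (a * b)) (toℕ-F m) (toℕ-F n))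
    (F-cong-% (m % p * (n % p)) (m * n) (trans (%-distribˡ-* (m % p) (n % p) p)
      (trans (cong₂ (λ a b → (a * b) % p) (lem m) (lem n)) (sym (%-distribˡ-* m n p))))))
    where
    lem : ∀ m → (m % p) % p ≡ m % p
    lem m = m<n⇒m%n≡m (m%n<n m p)

  *ᶠ-comm : ∀ (x y : Fin p) → x *ᶠ y ≡ y *ᶠ x
  *ᶠ-comm x y = cong (λ k → fromℕ< (m%n<n k p)) (ℕₚ.*-comm (toℕ x) (toℕ y))

  *ᶠ-distribʳ : ∀ (x y z : Fin p) → (x +ᶠ y) *ᶠ z ≡ (x *ᶠ z) +ᶠ (y *ᶠ z)
  *ᶠ-distribʳ x y z = subst₂ (λ x y → (x +ᶠ y) *ᶠ z ≡ (x *ᶠ z) +ᶠ (y *ᶠ z)) (F-toℕ x) (F-toℕ y)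
    (subst (λ z → (F a +ᶠ F b) *ᶠ z ≡ (F a *ᶠ z) +ᶠ (F b *ᶠ z)) (F-toℕ z)
      (trans (cong (_*ᶠ F c) (F-+ a b)) (trans (F-* (a + b) c) (trans (cong F (ℕₚ.*-distribʳ-+ c a b))
        (sym (trans (cong₂ _+ᶠ_ (F-* a c) (F-* b c)) (F-+ (a * c) (b * c))))))))
    where
    a = toℕ x
    b = toℕ y
    c = toℕ z

  *ᶠ-identityʳ : ∀ x → x *ᶠ F 1 ≡ x
  *ᶠ-identityʳ x = trans (cong (_*ᶠ F 1) (sym (F-toℕ x))) (trans (F-* (toℕ x) 1) (trans (cong F (ℕₚ.*-identityʳ (toℕ x))) (F-toℕ x)))

  *ᶠ-zeroˡ : ∀ x → F 0 *ᶠ x ≡ F 0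
  *ᶠ-zeroˡ x = trans (cong (F 0 *ᶠ_) (sym (F-toℕ x))) (F-* 0 (toℕ x))

  *ᶠ-zeroʳ : ∀ x → x *ᶠ F 0 ≡ F 0
  *ᶠ-zeroʳ x = trans (*ᶠ-comm x (F 0)) (*ᶠ-zeroˡ x)

  ·-F : ∀ n x → n 𝔽.· x ≡ F (n * toℕ x)
  ·-F zero    x = refl
  ·-F (suc n) x = trans (cong₂ _+ᶠ_ (sym (F-toℕ x)) (·-F n x)) (F-+ (toℕ x) (n * toℕ x))

  coprime : ∀ {n} → ¬ (p ∣ n) → Coprime p n
  coprime p∤n (d∣p , d∣n) with prime⇒irreducible p-prime d∣p
  ... | inj₁ d≡1  = d≡1
  ... | inj₂ refl = contradiction d∣n p∤n

  bezout : ∀ {n} → ¬ (p ∣ n) → ∃₂ λ i c → i * n ≡ 1 + c * p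
  bezout {n} p∤n with coprime-Bézout (coprime p∤n)
  ... | Bézout.-+ x y eq = y , x , sym eq
  ... | Bézout.+- x y eq = negate p′ x refl eq
    where
    negate : ∀ p″ x → p″ ≡ p′ → 1 + y * n ≡ x * p → ∃₂ λ i c → i * n ≡ 1 + c * p
    negate zero     x       refl eq = contradiction (divides n (sym (ℕₚ.*-identityʳ n))) p∤n
    -- Here yn is -1 modulo p, so the further factor p - 1 makes it 1.
    negate (suc p″) (suc x) refl eq = y * p′ , x + p″ * suc x ,
      ℕₚ.+-cancelʳ-≡ p _ _ (trans (arith y p″ n) (trans (cong (λ k → p′ * k + 1) eq) (arith′ x p″)))
      where
      arith : ∀ y p″ n → y * suc p″ * n + suc (suc p″) ≡ suc p″ * (1 + y * n) + 1
      arith = solve-∀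
      arith′ : ∀ x p″ → suc p″ * (suc x * suc (suc p″)) + 1 ≡ 1 + (x + p″ * suc x) * suc (suc p″) + suc (suc p″)
      arith′ = solve-∀

  -- A nonzero residue generates the additive group, so scalars can be natural multiples, which
  -- exist in every abelian group.
  divide : ∀ {c} → c ≢ F 0 → ∀ t → ∃ λ j → j 𝔽.· c ≡ t
  divide {c} c≢0 t with bezout {toℕ c} p∤c
    where
    p∤c : ¬ (p ∣ toℕ c)
    p∤c p∣c = c≢0 (trans (sym (F-toℕ c)) (F-cong-% (toℕ c) 0 (n∣m⇒m%n≡0 (toℕ c) p p∣c)))
  ... | i , k , eq = toℕ t * i , trans (·-F (toℕ t * i) c) (trans (F-cong-% (toℕ t * i * toℕ c) (toℕ t)
    (trans (cong (_% p) (trans (ℕₚ.*-assoc (toℕ t) i (toℕ c)) (trans (cong (toℕ t *_) eq) (arith (toℕ t) k p)))) ([m+kn]%n≡m%n (toℕ t) (toℕ t * k) p)))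
    (F-toℕ t))
    where
    arith : ∀ t k p → t * (1 + k * p) ≡ t + t * k * p
    arith = solve-∀

  p-torsion : ∀ x → p 𝔽.· x ≡ F 0
  p-torsion x = trans (·-F p x) (F-cong-% (p * toℕ x) 0 (trans (cong (_% p) (ℕₚ.*-comm p (toℕ x))) (m*n%n≡0 (toℕ x) p)))
 

module Vectors (p′ : ℕ) (p-prime : Prime (suc p′)) where
  open PrimeField p′ p-prime

  𝟎 : ∀ {k} → Vp p k
  𝟎 = replicate _ (F 0)

  −_ : ∀ {k} → Vp p k → Vp p k
  −_ = map −ᶠ_

  ⊕-identityˡ : ∀ {k} (x : Vp p k) → 𝟎 ⊕ x ≡ x
  ⊕-identityˡ []      = refl
  ⊕-identityˡ (x ∷ v) = cong₂ _∷_ (+ᶠ-identityˡ x) (⊕-identityˡ v)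

  ⊕-inverseˡ : ∀ {k} (x : Vp p k) → (− x) ⊕ x ≡ 𝟎
  ⊕-inverseˡ []      = refl
  ⊕-inverseˡ (x ∷ v) = cong₂ _∷_ (+ᶠ-inverseˡ x) (⊕-inverseˡ v)

  isAbV : ∀ {k} → IsAbelianGroup _≡_ _⊕_ (𝟎 {k}) −_
  isAbV = abelian (Vecₚ.zipWith-assoc +ᶠ-assoc) (Vecₚ.zipWith-comm +ᶠ-comm) ⊕-identityˡ ⊕-inverseˡ

  module 𝕍 {k : ℕ} = AbelianGroup (isAbV {k})

  V-torsion : ∀ {k} (x : Vp p k) → p 𝕍.· x ≡ 𝟎
  V-torsion x = trans (pointwise p x) (zeros x)
    where
    pointwise : ∀ {k} n (x : Vp p k) → n 𝕍.· x ≡ map (n 𝔽.·_) x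
    pointwise zero    []      = refl
    pointwise (suc n) []      = cong ([] ⊕_) (pointwise n [])
    pointwise zero    (x ∷ v) = cong (F 0 ∷_) (pointwise zero v)
    pointwise (suc n) (x ∷ v) with n 𝕍.· (x ∷ v) | pointwise n (x ∷ v)
    ... | _ | refl = cong ((x +ᶠ (n 𝔽.· x)) ∷_) (trans (cong (v ⊕_) (sym (pointwise n v))) (pointwise (suc n) v))
    zeros : ∀ {k} (x : Vp p k) → map (p 𝔽.·_) x ≡ 𝟎
    zeros []      = refl
    zeros (x ∷ v) = cong₂ _∷_ (p-torsion x) (zeros v)

  finite-V : ∀ k → ∃ λ N → Fin N ↔ Vp p k
  finite-V zero    = 1 , mk↔ₛ′ (λ _ → []) (λ _ → zero) (λ { [] → refl }) (λ { zero → refl })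
  finite-V (suc k) = let N , fin = finite-V k in p * N ,
    ↔-trans Finₚ.*↔× (↔-trans (↔-refl ×-↔ fin)
      (mk↔ₛ′ (λ (x , v) → x ∷ v) (λ { (x ∷ v) → x , v }) (λ { (x ∷ v) → refl }) (λ { (x , v) → refl })))

  nonzero-coordinate : ∀ {k} (x : Vp p k) → x ≢ 𝟎 → ∃ λ i → lookup x i ≢ F 0
  nonzero-coordinate x x≢𝟎 with Finₚ.any? (λ i → ¬? (lookup x i Finₚ.≟ F 0))
  ... | yes found = found
  ... | no none = contradiction (all-zero x λ i → decidable-stable (lookup x i Finₚ.≟ F 0) λ neq → none (i , neq)) x≢𝟎
    where
    all-zero : ∀ {k} (x : Vp p k) → (∀ i → lookup x i ≡ F 0) → x ≡ 𝟎
    all-zero []      h = refl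
    all-zero (x ∷ v) h = cong₂ _∷_ (h zero) (all-zero v (h ∘ suc))

  unit : ∀ {k} → Fin k → Vp p k
  unit i = 𝟎 [ i ]≔ F 1

  abstract
    -- With one argument fixed, this is an additive functional that kills the fixed vector; no basis
    -- has to be completed to obtain it.
    minor : ∀ {k} → Fin k → Fin k → Vp p k → Vp p k → Fin p
    minor i j x y = (lookup x i *ᶠ lookup y j) +ᶠ (−ᶠ (lookup x j *ᶠ lookup y i))

    minor-⊕ˡ : ∀ {k} i j (x x′ y : Vp p k) → minor i j (x ⊕ x′) y ≡ minor i j x y +ᶠ minor i j x′ y
    minor-⊕ˡ i j x x′ y = trans
      (cong₂ (λ a b → (a *ᶠ lookup y j) +ᶠ (−ᶠ (b *ᶠ lookup y i))) (Vecₚ.lookup-zipWith _+ᶠ_ i x x′) (Vecₚ.lookup-zipWith _+ᶠ_ j x x′))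
      (trans (cong₂ (λ a b → a +ᶠ (−ᶠ b)) (*ᶠ-distribʳ (lookup x i) (lookup x′ i) (lookup y j)) (*ᶠ-distribʳ (lookup x j) (lookup x′ j) (lookup y i)))
        (𝔽.solve ((v₀ :∙ v₁) :∙ (:- (v₂ :∙ v₃))) ((v₀ :∙ (:- v₂)) :∙ (v₁ :∙ (:- v₃)))
          ((lookup x i *ᶠ lookup y j) ∷ (lookup x′ i *ᶠ lookup y j) ∷ (lookup x j *ᶠ lookup y i) ∷ (lookup x′ j *ᶠ lookup y i) ∷ []) refl))
      where open 𝔽

    minor-swap : ∀ {k} i j (x y : Vp p k) → minor i j x y ≡ −ᶠ (minor i j y x)
    minor-swap i j x y = trans (cong₂ (λ a b → a +ᶠ (−ᶠ b)) (*ᶠ-comm (lookup x i) (lookup y j)) (*ᶠ-comm (lookup x j) (lookup y i)))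
      (𝔽.solve (v₀ :∙ (:- v₁)) (:- (v₁ :∙ (:- v₀))) ((lookup y j *ᶠ lookup x i) ∷ (lookup y i *ᶠ lookup x j) ∷ []) refl)
      where open 𝔽

    minor-⊕ʳ : ∀ {k} i j (x y y′ : Vp p k) → minor i j x (y ⊕ y′) ≡ minor i j x y +ᶠ minor i j x y′
    minor-⊕ʳ i j x y y′ = trans (minor-swap i j x (y ⊕ y′)) (trans (cong −ᶠ_ (minor-⊕ˡ i j y y′ x))
      (trans (𝔽.solve (:- (v₀ :∙ v₁)) ((:- v₀) :∙ (:- v₁)) (minor i j y x ∷ minor i j y′ x ∷ []) refl)
        (sym (cong₂ _+ᶠ_ (minor-swap i j x y) (minor-swap i j x y′)))))
      where open 𝔽

    minor-self : ∀ {k} i j (x : Vp p k) → minor i j x x ≡ F 0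
    minor-self i j x = trans (cong (λ a → a +ᶠ (−ᶠ (lookup x j *ᶠ lookup x i))) (*ᶠ-comm (lookup x i) (lookup x j))) (+ᶠ-inverseʳ (lookup x j *ᶠ lookup x i))

    -- Shows that `minor i j x` is a nonzero functional once coordinate i of `x` is nonzero. The
    -- second coordinate j is where dimension at least 2 enters.
    minor-unit : ∀ {k} i j (x : Vp p k) → j ≢ i → minor i j x (unit j) ≡ lookup x i
    minor-unit i j x j≢i = trans (cong₂ (λ a b → (lookup x i *ᶠ a) +ᶠ (−ᶠ (lookup x j *ᶠ b)))
        (Vecₚ.lookup∘update j 𝟎 (F 1)) (trans (Vecₚ.lookup∘update′ (j≢i ∘ sym) 𝟎 (F 1)) (Vecₚ.lookup-replicate i (F 0))))
      (trans (cong₂ (λ a b → a +ᶠ (−ᶠ b)) (*ᶠ-identityʳ (lookup x i)) (*ᶠ-zeroʳ (lookup x j)))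
        (𝔽.solve (v₀ :∙ (:- :ε)) v₀ (lookup x i ∷ []) refl))
      where open 𝔽

  other : ∀ {k} (i : Fin (suc (suc k))) → ∃ λ j → j ≢ i
  other zero    = suc zero , λ ()
  other (suc i) = zero , λ ()

  −-nonzero : ∀ {x} → x ≢ F 0 → −ᶠ x ≢ F 0
  −-nonzero {x} x≢0 eq = x≢0 (𝔽.cancelʳ (−ᶠ x) (trans (+ᶠ-inverseʳ x) (trans (sym eq) (sym (+ᶠ-identityˡ (−ᶠ x))))))

module Additive (p′ : ℕ) (p-prime : Prime (suc p′)) {A : Set} {_∙_ : A → A → A} {ε : A} {_⁻¹ : A → A}
  (isAb : IsAbelianGroup _≡_ _∙_ ε _⁻¹) (φ : A → Fin (suc p′)) (φ-∙ : ∀ x y → φ (x ∙ y) ≡ φ x +ᶠ φ y) where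
  open PrimeField p′ p-prime
  open AbelianGroup isAb

  φ-ε : φ ε ≡ F 0
  φ-ε = 𝔽.cancelʳ (φ ε) (trans (sym (φ-∙ ε ε)) (trans (cong φ (identityˡ ε)) (sym (+ᶠ-identityˡ (φ ε)))))

  φ-⁻¹ : ∀ x → φ (x ⁻¹) ≡ −ᶠ φ x
  φ-⁻¹ x = 𝔽.cancelʳ (φ x) (trans (sym (φ-∙ (x ⁻¹) x)) (trans (cong φ (inverseˡ x)) (trans φ-ε (sym (+ᶠ-inverseˡ (φ x))))))

  φ-· : ∀ n x → φ (n · x) ≡ n 𝔽.· φ x
  φ-· zero    x = φ-ε
  φ-· (suc n) x = trans (φ-∙ x (n · x)) (cong (φ x +ᶠ_) (φ-· n x))

  coefficient : ∀ {g} → φ g ≢ F 0 → A → ℕ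
  coefficient {g} φg≢0 a = proj₁ (divide φg≢0 (φ a))

  remainder : ∀ {g} → φ g ≢ F 0 → A → A
  remainder {g} φg≢0 a = a ∙ ((coefficient {g} φg≢0 a · g) ⁻¹)

  remainder-kernel : ∀ {g} (φg≢0 : φ g ≢ F 0) a → φ (remainder {g} φg≢0 a) ≡ F 0
  remainder-kernel {g} φg≢0 a = trans (φ-∙ a _) (trans (cong (φ a +ᶠ_) (trans (φ-⁻¹ _)
    (cong −ᶠ_ (trans (φ-· (coefficient {g} φg≢0 a) g) (proj₂ (divide φg≢0 (φ a))))))) (+ᶠ-inverseʳ (φ a)))

  remainder-∙ : ∀ {g} (φg≢0 : φ g ≢ F 0) a → a ≡ remainder {g} φg≢0 a ∙ (coefficient {g} φg≢0 a · g)
  remainder-∙ {g} φg≢0 a = solve v₀ ((v₀ :∙ :- v₁) :∙ v₁) (a ∷ (coefficient {g} φg≢0 a · g) ∷ []) refl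

-- One of a, b and a ∙ b lies in neither kernel.
common-nonzero : ∀ p′ (p-prime : Prime (suc p′)) {A : Set} {_∙_ : A → A → A} (φ ψ : A → Fin (suc p′)) →
  (∀ x y → φ (x ∙ y) ≡ φ x +ᶠ φ y) → (∀ x y → ψ (x ∙ y) ≡ ψ x +ᶠ ψ y) →
  ∀ {z a b} → z ≡ PrimeField.F p′ p-prime 0 → φ a ≢ z → ψ b ≢ z → ∃ λ v → φ v ≢ z × ψ v ≢ z
common-nonzero p′ p-prime {_∙_ = _∙_} φ ψ φ-∙ ψ-∙ {_} {a} {b} refl φa ψb = go (ψ a Finₚ.≟ F 0) (φ b Finₚ.≟ F 0)
  where
  open PrimeField p′ p-prime
  go : Dec (ψ a ≡ F 0) → Dec (φ b ≡ F 0) → ∃ λ v → φ v ≢ F 0 × ψ v ≢ F 0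
  go (no ψa) _        = a , φa , ψa
  go (yes _) (no φb)  = b , φb , ψb
  go (yes ψa) (yes φb) = a ∙ b ,
    (λ eq → φa (trans (sym (trans (cong (φ a +ᶠ_) φb) (+ᶠ-identityʳ (φ a)))) (trans (sym (φ-∙ a b)) eq))) ,
    (λ eq → ψb (trans (sym (trans (cong (_+ᶠ ψ b) ψa) (+ᶠ-identityˡ (ψ b)))) (trans (sym (ψ-∙ a b)) eq)))

-- Subgroups as kernels of functionals

module Functionals (p′ : ℕ) (p-prime : Prime (suc p′)) {A : Set} {_∙_ : A → A → A} {ε : A} {_⁻¹ : A → A}
  (isAb : IsAbelianGroup _≡_ _∙_ ε _⁻¹) {N : ℕ} (fin : Fin N ↔ A)
  {e : ℕ} (torsion : ∀ x → AbelianGroup._·_ isAb e x ≡ ε)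
  (h₂ c₂ : ℕ) (half-eq : 2 * h₂ ≡ 1 + c₂ * e)
  (h₃ c₃ : ℕ) (third-eq : 3 * h₃ ≡ 1 + c₃ * e) where

  open PrimeField p′ p-prime
  open AbelianGroup isAb
  open Lexicographic isAb fin {e} torsion h₂ c₂ half-eq h₃ c₃ third-eq using (Subgroup)
  open Assembly isAb fin {e} torsion h₂ c₂ half-eq h₃ c₃ third-eq using (Spans; module Final)
  open Subgroup using (P)

  module Kernel (χ : A → Fin p) (χ-∙ : ∀ x y → χ (x ∙ y) ≡ χ x +ᶠ χ y) where
    open Additive p′ p-prime isAb χ χ-∙ public

    kernel : Subgroup
    kernel = record
      { P = λ x → χ x ≡ F 0 ; P? = λ x → χ x Finₚ.≟ F 0 ; P-ε = φ-ε
      ; P-∙ = λ {x} {y} p q → trans (χ-∙ x y) (trans (cong₂ _+ᶠ_ p q) (+ᶠ-identityˡ (F 0)))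
      ; P-⁻¹ = λ {x} p → trans (φ-⁻¹ x) (trans (cong −ᶠ_ p) −0) }
      where
      −0 : −ᶠ (F 0) ≡ F 0
      −0 = trans (sym (+ᶠ-identityˡ (−ᶠ (F 0)))) (+ᶠ-inverseʳ (F 0))

    spans : ∀ {g} → χ g ≢ F 0 → Spans (P kernel) g
    spans {g} χg a = remainder {g} χg a , coefficient {g} χg a , remainder-kernel {g} χg a , remainder-∙ {g} χg a

  module Kernels (χ ω : A → Fin p) (χ-∙ : ∀ x y → χ (x ∙ y) ≡ χ x +ᶠ χ y) (ω-∙ : ∀ x y → ω (x ∙ y) ≡ ω x +ᶠ ω y) where
    module χK = Kernel χ χ-∙
    module ωK = Kernel ω ω-∙

    both : Subgroup
    both = record
      { P = λ x → P χK.kernel x × P ωK.kernel x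
      ; P? = λ x → Subgroup.P? χK.kernel x ×-dec Subgroup.P? ωK.kernel x
      ; P-ε = Subgroup.P-ε χK.kernel , Subgroup.P-ε ωK.kernel
      ; P-∙ = λ {x} {y} (p , q) (p′ , q′) → Subgroup.P-∙ χK.kernel {x} {y} p p′ , Subgroup.P-∙ ωK.kernel {x} {y} q q′
      ; P-⁻¹ = λ {x} (p , q) → Subgroup.P-⁻¹ χK.kernel {x} p , Subgroup.P-⁻¹ ωK.kernel {x} q }

    generated : ∀ {g} → χ g ≡ F 0 → ω g ≢ F 0 → ∀ {a} → χ a ≡ F 0 → ∃₂ λ d m → P both d × a ≡ d ∙ (m · g)
    generated {g} χg ωg {a} χa = ωK.remainder {g} ωg a , ωK.coefficient {g} ωg a ,
      (Subgroup.∙⁻¹ χK.kernel {a} {ωK.coefficient {g} ωg a · g} χa (Subgroup.P-· χK.kernel (ωK.coefficient {g} ωg a) {g} χg) ,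
        ωK.remainder-kernel {g} ωg a) ,
      ωK.remainder-∙ {g} ωg a

  -- `σ` kills `u`, hence the admissible `κ`, but not `Δ`, and its kernel is the subgroup of the
  -- special block. The kernel of `μ` contains `v` but not the target; inside it, `φ` cuts out a
  -- complement to the multiples of `v`.
  module _ (h : ℕ) (α : A → A) (α-∙ : ∀ x y → α (x ∙ y) ≡ α x ∙ α y) (period : ∀ x → iter α (suc (h + h)) x ≡ x)
    (mul : A × Fin (suc (h + h)) → A × Fin (suc (h + h)) → A × Fin (suc (h + h)))
    (mul-def : ∀ a i b j → mul (a , i) (b , j) ≡ (a ∙ iter α (toℕ i) b , i +ᶠ j))
    (s : ℕ) (0<s : 0 < s) (s≤h : s ≤ h) (r : ℕ) (shape : (suc h ≡ s + s × r ≡ h + s) ⊎ (h ≡ s + s × r ≡ s))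
    (u v Δ : A) (Δ≡ : iter α (suc (h + h) ∸ s) v ≡ Δ) (φ μ σ : A → Fin p)
    (φ-∙ : ∀ x y → φ (x ∙ y) ≡ φ x +ᶠ φ y) (μ-∙ : ∀ x y → μ (x ∙ y) ≡ μ x +ᶠ μ y) (σ-∙ : ∀ x y → σ (x ∙ y) ≡ σ x +ᶠ σ y)
    (φ-v : φ v ≢ F 0) (μ-v : μ v ≡ F 0) (μ-n : μ (u ∙ (iter α r u ⁻¹)) ≢ F 0)
    (σ-u : σ u ≡ F 0) (σ-Δ : σ Δ ≢ F 0) where

    open Hom isAb α α-∙ using (iter-∙)

    module μK = Kernel μ μ-∙
    module σK = Kernel σ σ-∙
    module μφK = Kernels μ φ μ-∙ φ-∙

    target : A → A
    target κ = ((v ⁻¹) ∙ ((2 · Δ) ∙ κ)) ∙ (iter α r (Δ ∙ κ) ⁻¹)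

    target-double : target (u ∙ u) ≡ target u ∙ (u ∙ (iter α r u ⁻¹))
    target-double = trans (cong (λ x → ((v ⁻¹) ∙ ((2 · Δ) ∙ (u ∙ u))) ∙ (x ⁻¹)) (trans (iter-∙ r Δ _) (∙-congˡ (iter-∙ r u u))))
      (trans (solve ((:- v₀ :∙ ((2 :· v₁) :∙ (v₂ :∙ v₂))) :∙ :- (v₃ :∙ (v₄ :∙ v₄)))
          (((:- v₀ :∙ ((2 :· v₁) :∙ v₂)) :∙ :- (v₃ :∙ v₄)) :∙ (v₂ :∙ :- v₄))
          (v ∷ Δ ∷ u ∷ iter α r Δ ∷ iter α r u ∷ []) refl)
        (cong (λ x → (((v ⁻¹) ∙ ((2 · Δ) ∙ u)) ∙ (x ⁻¹)) ∙ (u ∙ (iter α r u ⁻¹))) (sym (iter-∙ r Δ u))))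

    -- The targets of u and 2u differ by u - αʳ u, which μ does not kill.
    multiple : ∃ λ κ → σ κ ≡ F 0 × μ (target κ) ≢ F 0
    multiple with μ (target u) Finₚ.≟ F 0
    ... | no neq = u , σ-u , neq
    ... | yes eq = u ∙ u , Subgroup.P-∙ σK.kernel {u} {u} σ-u σ-u , λ eq′ → μ-n
      (trans (sym (trans (cong (_+ᶠ μ (u ∙ (iter α r u ⁻¹))) eq) (+ᶠ-identityˡ _)))
        (trans (sym (μ-∙ (target u) _)) (trans (cong μ (sym target-double)) eq′)))

    sequencing : Sequenceable (A × Fin (suc (h + h))) mul
    sequencing = go multiple
      where
      go : (∃ λ κ → σ κ ≡ F 0 × μ (target κ) ≢ F 0) → Sequenceable (A × Fin (suc (h + h))) mul
      go (κ , σ-κ , μ-T) = Final.sequencing h α α-∙ period mul mul-def s 0<s s≤h r shape v Δ κ (target κ) Δ≡ refl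
        σK.kernel σ-Δ σ-κ (σK.spans {Δ} σ-Δ) μK.kernel μ-v μ-T (μK.spans {target κ} μ-T)
        μφK.both (λ {a} → proj₁) (λ (_ , q) → φ-v q) (λ {a} → μφK.generated {v} μ-v φ-v {a})

-- The action on the vectors and the choice of u and v

module Twisted (p′ : ℕ) (p-prime : Prime (suc p′)) (k′ : ℕ) (B : FinAbGroup) (p∤B : ¬ (suc p′ ∣ FinAbGroup.order B))
  (h₂ c₂ : ℕ) (half-eq : 2 * h₂ ≡ 1 + c₂ * (suc p′ * FinAbGroup.order B))
  (h₃ c₃ : ℕ) (third-eq : 3 * h₃ ≡ 1 + c₃ * (suc p′ * FinAbGroup.order B))
  (h : ℕ) (α : H (suc p′) (suc (suc k′)) B → H (suc p′) (suc (suc k′)) B)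
  (α-∙ : ∀ x y → α (_·H_ (suc p′) (suc (suc k′)) B x y) ≡ _·H_ (suc p′) (suc (suc k′)) B (α x) (α y))
  (period : ∀ x → iter α (suc (h + h)) x ≡ x)
  (ρ-order : HasOrder (restrict (suc p′) (suc (suc k′)) B α) (suc (h + h)))
  (s : ℕ) (0<s : 0 < s) (s≤h : s ≤ h) (r : ℕ) (0<r : 0 < r) (r<q : r < suc (h + h))
  (shape : (suc h ≡ s + s × r ≡ h + s) ⊎ (h ≡ s + s × r ≡ s)) where

  open PrimeField p′ p-prime
  open Vectors p′ p-prime
  open FinAbGroup B renaming (Carrier to BC; _∙_ to _∙ᴮ_; ε to εᴮ; _⁻¹ to _⁻¹ᴮ)

  k e : ℕ
  k = suc (suc k′)
  e = p * order

  A V : Set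
  A = H p k B
  V = Vp p k

  module 𝔹 = AbelianGroup isAbelianGroup

  infixl 7 _∙_
  _∙_ : A → A → A
  _∙_ = _·H_ p k B

  ε : A
  ε = 𝟎 , εᴮ

  _⁻¹ : A → A
  (v , b) ⁻¹ = − v , b ⁻¹ᴮ

  isAb : IsAbelianGroup _≡_ _∙_ ε _⁻¹
  isAb = abelian
    (λ (u , a) (v , b) (w , c) → cong₂ _,_ (𝕍.assoc u v w) (𝔹.assoc a b c))
    (λ (u , a) (v , b) → cong₂ _,_ (𝕍.comm u v) (𝔹.comm a b))
    (λ (u , a) → cong₂ _,_ (⊕-identityˡ u) (𝔹.identityˡ a))
    (λ (u , a) → cong₂ _,_ (⊕-inverseˡ u) (𝔹.inverseˡ a))

  open AbelianGroup isAb
  open Hom isAb α α-∙ using (α-ε; iter-∙; iter-⁻¹)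

  ·-coordinates : ∀ n v b → n · (v , b) ≡ (n 𝕍.· v , n 𝔹.· b)
  ·-coordinates zero    v b = refl
  ·-coordinates (suc n) v b = cong ((v , b) ∙_) (·-coordinates n v b)

  torsion : ∀ x → e · x ≡ ε
  torsion (v , b) = trans (·-coordinates e v b) (cong₂ _,_
    (trans (cong (𝕍._· v) (ℕₚ.*-comm p order)) (trans (𝕍.·-· order p v) (trans (cong (order 𝕍.·_) (V-torsion v)) (𝕍.·-ε order))))
    (trans (𝔹.·-· p order b) (trans (cong (p 𝔹.·_) (order-torsion isAbelianGroup enumeration b)) (𝔹.·-ε p))))

  finite : ∃ λ N → Fin N ↔ A
  finite = let N , fin = finite-V k in N * order , ↔-trans Finₚ.*↔× (fin ×-↔ enumeration)

  ι : V → A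
  ι v = v , εᴮ

  ρ : V → V
  ρ = restrict p k B α

  -- The orders of an element of B killed by p and of B itself are coprime.
  p-killed : ∀ b → p 𝔹.· b ≡ εᴮ → b ≡ εᴮ
  p-killed b pb≡ε with bezout p∤B
  ... | i , c , eq = begin
    b                              ≡⟨ 𝔹.identityʳ b ⟨
    b ∙ᴮ εᴮ                        ≡⟨ cong (b ∙ᴮ_) (trans (𝔹.·-· c p b) (trans (cong (c 𝔹.·_) pb≡ε) (𝔹.·-ε c))) ⟨
    (1 + c * p) 𝔹.· b              ≡⟨ cong (𝔹._· b) eq ⟨
    (i * order) 𝔹.· b              ≡⟨ 𝔹.·-· i order b ⟩
    i 𝔹.· (order 𝔹.· b)            ≡⟨ cong (i 𝔹.·_) (order-torsion isAbelianGroup enumeration b) ⟩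
    i 𝔹.· εᴮ                       ≡⟨ 𝔹.·-ε i ⟩
    εᴮ                             ∎
    where open ≡-Reasoning

  α-· : ∀ n x → α (n · x) ≡ n · α x
  α-· zero    x = α-ε
  α-· (suc n) x = trans (α-∙ x (n · x)) (cong (α x ∙_) (α-· n x))

  -- The component of the image in `B` is killed by p, hence trivial.
  α-ι : ∀ v → α (ι v) ≡ ι (ρ v)
  α-ι v = cong (ρ v ,_) (p-killed _ (cong proj₂ (trans (sym (·-coordinates p (ρ v) _)) (trans (sym (α-· p (ι v)))
    (trans (cong α (trans (·-coordinates p v εᴮ) (cong₂ _,_ (V-torsion v) (𝔹.·-ε p)))) α-ε)))))

  iter-ι : ∀ n v → iter α n (ι v) ≡ ι (iter ρ n v)
  iter-ι zero    v = refl
  iter-ι (suc n) v = trans (cong α (iter-ι n v)) (α-ι (iter ρ n v))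

  iter-ρ-⊕ : ∀ n v w → iter ρ n (v ⊕ w) ≡ iter ρ n v ⊕ iter ρ n w
  iter-ρ-⊕ n v w = cong proj₁ (trans (sym (iter-ι n (v ⊕ w))) (trans (cong (iter α n) (cong (v ⊕ w ,_) (sym (𝔹.identityˡ εᴮ))))
    (trans (iter-∙ n (ι v) (ι w)) (cong₂ _∙_ (iter-ι n v) (iter-ι n w)))))

  -- As 0 < r < q, the r-th power of `ρ` is not the identity; searching the finite space turns this
  -- into a witness.
  moved : ∃ λ u → iter ρ r u ≢ u
  moved with finite-V k
  ... | N , fin with Finₚ.any? (λ i → ¬? (Vecₚ.≡-dec Finₚ._≟_ (iter ρ r (Inverse.to fin i)) (Inverse.to fin i)))
  ... | yes (i , neq) = _ , neq
  ... | no none = contradiction (λ v → subst (λ v → iter ρ r v ≡ v) (Inverse.strictlyInverseˡ fin v)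
          (decidable-stable (Vecₚ.≡-dec Finₚ._≟_ _ _) λ neq → none (Inverse.from fin v , neq))) (proj₂ ρ-order r 0<r r<q)

  displacement : V → V
  displacement u = u ⊕ (− iter ρ r u)

  displacement≢𝟎 : ∀ {u} → iter ρ r u ≢ u → displacement u ≢ 𝟎
  displacement≢𝟎 {u} moves eq = moves (sym (𝕍.cancelʳ (− iter ρ r u) (trans eq (sym (𝕍.inverseʳ (iter ρ r u))))))

  moved≢𝟎 : ∀ {u} → iter ρ r u ≢ u → u ≢ 𝟎
  moved≢𝟎 moves refl = moves (𝕍.cancelʳ (iter ρ r 𝟎)
    (trans (sym (iter-ρ-⊕ r 𝟎 𝟎)) (trans (cong (iter ρ r) (⊕-identityˡ 𝟎)) (sym (⊕-identityˡ _)))))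

  back : ℕ
  back = suc (h + h) ∸ s

  -- Both conditions say that a nonzero functional does not vanish at v. The first has value -nᵢ at
  -- `unit j`. The second is nonzero at the image of `unit j′` under the s-th power of `ρ`, which
  -- `back` steps return to `unit j′`.
  choose-v : ∀ (u n : V) i j i′ j′ → j ≢ i → lookup n i ≢ F 0 → j′ ≢ i′ → lookup u i′ ≢ F 0 →
    ∃ λ v → minor i j v n ≢ F 0 × minor i′ j′ u (iter ρ back v) ≢ F 0
  choose-v u n i j i′ j′ j≢i nᵢ≢0 j′≢i′ uᵢ≢0 = common-nonzero p′ p-prime
    (λ x → minor i j x n) (λ x → minor i′ j′ u (iter ρ back x))
    (λ x y → minor-⊕ˡ i j x y n)
    (λ x y → trans (cong (minor i′ j′ u) (iter-ρ-⊕ back x y)) (minor-⊕ʳ i′ j′ u (iter ρ back x) (iter ρ back y)))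
    {F 0} {unit j} {iter ρ s (unit j′)} refl
    (λ eq → −-nonzero nᵢ≢0 (trans (cong −ᶠ_ (sym (minor-unit i j n j≢i))) (trans (sym (minor-swap i j (unit j) n)) eq)))
    (λ eq → uᵢ≢0 (trans (sym (minor-unit i′ j′ u j′≢i′)) (trans (cong (minor i′ j′ u) (sym (return (unit j′)))) eq)))
    where
    return : ∀ x → iter ρ back (iter ρ s x) ≡ x
    return x = trans (sym (iter-+ ρ back s x)) (trans
      (cong (λ m → iter ρ m x) (ℕₚ.m∸n+n≡m (ℕₚ.≤-trans s≤h (ℕₚ.≤-trans (ℕₚ.m≤m+n h h) (ℕₚ.n≤1+n _)))))
      (proj₁ ρ-order x))

  module Chosen (N : ℕ) (fin : Fin N ↔ A) (u v : V) (i j i′ j′ : Fin k)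
    (φ-v : minor i j v (displacement u) ≢ F 0) (ψ-v : minor i′ j′ u (iter ρ back v) ≢ F 0) where

    -- The value of `φ` at v and that of `μ` at the displacement of u are the same minor, so one
    -- condition on v serves both.
    φ μ σ : A → Fin p
    φ (x , _) = minor i j x (displacement u)
    μ (x , _) = minor i j v x
    σ (x , _) = minor i′ j′ u x

    φ-∙ : ∀ x y → φ (x ∙ y) ≡ φ x +ᶠ φ y
    φ-∙ (x , _) (y , _) = minor-⊕ˡ i j x y (displacement u)

    μ-∙ : ∀ x y → μ (x ∙ y) ≡ μ x +ᶠ μ y
    μ-∙ (x , _) (y , _) = minor-⊕ʳ i j v x y

    σ-∙ : ∀ x y → σ (x ∙ y) ≡ σ x +ᶠ σ y
    σ-∙ (x , _) (y , _) = minor-⊕ʳ i′ j′ u x y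

    sequencing : Sequenceable (SD p k B (suc (h + h))) (sdMul p k B (suc (h + h)) α)
    sequencing = Functionals.sequencing p′ p-prime isAb fin {e} torsion h₂ c₂ half-eq h₃ c₃ third-eq
      h α α-∙ period (sdMul p k B (suc (h + h)) α) (λ _ _ _ _ → refl) s 0<s s≤h r shape
      (ι u) (ι v) (ι (iter ρ back v)) (iter-ι back v) φ μ σ φ-∙ μ-∙ σ-∙
      φ-v (minor-self i j v) μ-n (minor-self i′ j′ u) ψ-v
      where
      μ-n : μ (ι u ∙ (iter α r (ι u) ⁻¹)) ≢ F 0
      μ-n eq = φ-v (trans (cong (λ x → minor i j v (u ⊕ (− proj₁ x))) (sym (iter-ι r u))) eq)

  sequenceable : Sequenceable (SD p k B (suc (h + h))) (sdMul p k B (suc (h + h)) α)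
  sequenceable with finite | moved
  ... | N , fin | u , moves with nonzero-coordinate (displacement u) (displacement≢𝟎 moves) | nonzero-coordinate u (moved≢𝟎 moves)
  ... | i , nᵢ≢0 | i′ , uᵢ≢0 with other i | other i′
  ... | j , j≢i | j′ , j′≢i′ with choose-v u (displacement u) i j i′ j′ j≢i nᵢ≢0 j′≢i′ uᵢ≢0
  ... | v , φ-v , ψ-v = Chosen.sequencing N fin u v i j i′ j′ φ-v ψ-v

-- Arithmetic side conditions and the theorem

inverse-of-2 : ∀ e → ¬ (2 ∣ e) → ∃₂ λ i c → 2 * i ≡ 1 + c * e
inverse-of-2 e 2∤e with mod2 e
... | even j = contradiction (divides j (trans (cong (j +_) (sym (ℕₚ.+-identityʳ j))) (ℕₚ.*-comm 2 j))) 2∤e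
... | odd j  = suc j , 1 , arith j
  where
  arith : ∀ j → 2 * suc j ≡ 1 + 1 * suc (j + j)
  arith = solve-∀

inverse-of-3 : ∀ e → ¬ (3 ∣ e) → ∃₂ λ i c → 3 * i ≡ 1 + c * e
inverse-of-3 e 3∤e with mod3 e
... | r0 j = contradiction (divides j refl) 3∤e
... | r1 j = suc (j + j) , 2 , arith j
  where
  arith : ∀ j → 3 * suc (j + j) ≡ 1 + 2 * (1 + j * 3)
  arith = solve-∀
... | r2 j = suc j , 1 , arith j
  where
  arith : ∀ j → 3 * suc j ≡ 1 + 1 * (2 + j * 3)
  arith = solve-∀

-- The vector 1 is a basis, and whatever its image, it is a multiple of 1.
diagonalisable-1 : ∀ p′ → Prime (suc p′) → (f : Vp (suc p′) 1 → Vp (suc p′) 1) → Diagonalisable (suc p′) 1 f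
diagonalisable-1 p′ p-prime f = (λ _ → F 1 ∷ []) , (λ _ → head (f (F 1 ∷ []))) ,
  (λ _ → scalar (f (F 1 ∷ []))) ,
  (λ {c} {d} eq → trans (sym (identity c)) (trans eq (identity d))) ,
  λ c → c , λ { refl → identity c }
  where
  open PrimeField p′ p-prime
  scalar : (w : Vp p 1) → w ≡ head w ⊙ (F 1 ∷ [])
  scalar (x ∷ []) = cong (_∷ []) (sym (*ᶠ-identityʳ x))
  identity : (c : Vec (Fin p) 1) → lincomb (0V zero) c (λ _ → F 1 ∷ []) ≡ c
  identity (x ∷ []) = cong (_∷ []) (trans (cong₂ _+ᶠ_ (*ᶠ-identityʳ x) (sym F-zero)) (+ᶠ-identityʳ x))

-- `s` is half of `h`, rounded up.
split-index : ∀ h → 0 < h → ∃₂ λ s r → 0 < s × s ≤ h × 0 < r × r < suc (h + h) ×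
  ((suc h ≡ s + s × r ≡ h + s) ⊎ (h ≡ s + s × r ≡ s))
split-index h 0<h with mod2 h
... | even (suc j) = suc j , suc j , s≤s z≤n , ℕₚ.m≤m+n _ _ , s≤s z≤n ,
  s≤s (ℕₚ.≤-trans (ℕₚ.m≤m+n (suc j) (suc j)) (ℕₚ.m≤m+n _ _)) , inj₂ (refl , refl)
... | odd j = suc j , suc (j + j) + suc j , s≤s z≤n , s≤s (ℕₚ.m≤m+n j j) , s≤s z≤n ,
  s≤s (ℕₚ.+-monoʳ-≤ (suc (j + j)) (s≤s (ℕₚ.m≤m+n j j))) , inj₁ (cong suc (sym (ℕₚ.+-suc j j)) , refl)

theorem3p8 : (p q k : ℕ) → Prime p → Prime q → ¬ (2 ∣ p) → ¬ (2 ∣ q) → p ≢ 3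
    → 0 < k → q ∣ (p ^ k ∸ 1)
    → (B : FinAbGroup) → ¬ (2 ∣ FinAbGroup.order B) → ¬ (3 ∣ FinAbGroup.order B)
    → ¬ (p ∣ FinAbGroup.order B)
    → (α : H p k B → H p k B) → IsAutomorphism p k B α → HasOrder α q
    → HasOrder (restrict p k B α) q → ¬ Diagonalisable p k (restrict p k B α)
    → Sequenceable (SD p k B q) (sdMul p k B q α)
theorem3p8 zero q k pp pq 2∤p = contradiction (divides 0 refl) 2∤p
theorem3p8 (suc p′) q zero pp pq 2∤p 2∤q p≢3 ()
theorem3p8 (suc p′) q (suc zero) pp pq 2∤p 2∤q p≢3 0<k q∣ B 2∤B 3∤B p∤B α auto α-order ρ-order not-diagonal =
  contradiction (diagonalisable-1 p′ pp (restrict (suc p′) 1 B α)) not-diagonal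
theorem3p8 (suc p′) q (suc (suc k′)) pp pq 2∤p 2∤q p≢3 0<k q∣ B 2∤B 3∤B p∤B α (α-∙ , _) α-order ρ-order not-diagonal
  with mod2 q
... | even j = contradiction (divides j (trans (cong (j +_) (sym (ℕₚ.+-identityʳ j))) (ℕₚ.*-comm 2 j))) 2∤q
... | odd zero = contradiction pq ¬prime[1]
... | odd (suc h′) = sequence
  where
  h e : ℕ
  h = suc h′
  e = suc p′ * FinAbGroup.order B
  2∤e : ¬ (2 ∣ e)
  2∤e d with euclidsLemma (suc p′) (FinAbGroup.order B) prime[2] d
  ... | inj₁ d′ = 2∤p d′
  ... | inj₂ d′ = 2∤B d′
  3∤e : ¬ (3 ∣ e)
  3∤e d with euclidsLemma (suc p′) (FinAbGroup.order B) (from-yes (prime? 3)) d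
  ... | inj₂ d′ = 3∤B d′
  ... | inj₁ d′ with prime⇒irreducible pp d′
  ... | inj₂ eq = p≢3 (sym eq)
  sequence : Sequenceable (SD (suc p′) (suc (suc k′)) B (suc (h + h))) (sdMul (suc p′) (suc (suc k′)) B (suc (h + h)) α)
  sequence with inverse-of-2 e 2∤e | inverse-of-3 e 3∤e | split-index h (s≤s z≤n)
  ... | h₂ , c₂ , half-eq | h₃ , c₃ , third-eq | s , r , 0<s , s≤h , 0<r , r<q , shape =
    Twisted.sequenceable p′ pp k′ B p∤B h₂ c₂ half-eq h₃ c₃ third-eq h α α-∙ (proj₁ α-order) ρ-order s 0<s s≤h r 0<r r<q shape
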